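{- Let $K\ge 1$ and $T\ge 0$ be integers and $0<p<1/2$. In the adaptive sampling setting for computing $\mathsf{OR}$ from noisy queries, $$\inf_{\hat\mu}\ \sup_{\theta\in\{0,1\}^K}\ \mathbb{P}\big(\hat\mu\neq \mathsf{OR}(\theta)\big)\ \ge\ \frac14\exp\left(-\frac{T\cdot D_{\mathsf{KL}}(p\|1-p)}{K}\right),$$ where the infimum is over all adaptive algorithms making $T$ queries. Consequently, the number of queries required to recover the true value with probability at least $1-\delta$ is $\Omega\left(\frac{K}{1-H(p)}+\frac{K\log(1/\delta)}{D_{\mathsf{KL}}(p\|1-p)}\right)$; that is, there is a universal constant $c>0$ such that for all $K\ge1$, $p\in(0,1/2)$ and $\delta\in(0,0.49)$, any adaptive algorithm making $T$ queries with $\sup_{\theta\in\{0,1\}^K}\mathbb{P}(\hat\mu\ne\mathsf{OR}(\theta))\le\delta$ satisfies $$T\ \ge\ c\left(\frac{K}{1-H(p)}+\frac{K\log(1/\delta)}{D_{\mathsf{KL}}(p\|1-p)}\right).$$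
   Context: For $\theta=(\theta_1,\dots,\theta_K)\in\{0,1\}^K$, $\mathsf{OR}(\theta)=1$ if some $\theta_k=1$ and $\mathsf{OR}(\theta)=0$ otherwise. The sequence $\theta$ is unknown. One query consists of choosing an index $k\in[K]=\{1,\dots,K\}$ and observing $\theta_k$ passed through a binary symmetric channel with flip probability $p$: the observation equals $\theta_k$ with probability $1-p$ and $1-\theta_k$ with probability $p$, with noise independent across queries. An adaptive algorithm $\hat\mu$ with $T$ queries chooses the index queried in each of the $T$ rounds, possibly at random, as a function of all past queries and observations, and after $T$ rounds outputs a (possibly random) value in $\{0,1\}$, also denoted $\hat\mu$; $p$ is known. $\mathbb{P}$ is over the observation noise and the algorithm's randomness when the truth is $\theta$. Notation: $\log$ is natural; $H(p)=-p\log_2 p-(1-p)\log_2(1-p)$ is the binary entropy in bits; $D_{\mathsf{KL}}(p\|1-p)=(1-2p)\log\frac{1-p}{p}$ is the Kullback–Leibler divergence (in nats) between Bernoulli$(p)$ and Bernoulli$(1-p)$. -}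

module Defs where

open import Data.Bool.Base using (Bool; true; false; _∨_; if_then_else_)
import Data.Bool.Properties as Bool
open import Data.Fin.Base using (Fin)
open import Data.Vec.Base using (Vec; []; _∷_; lookup; foldr′)
import Data.Vec.Functional as Functional
open import Relation.Nullary.Decidable.Core using (does)
open import Data.Nat.Base as ℕ using (ℕ; zero; suc; s≤s; z≤n; _!)
import Data.Nat.Properties as ℕ
open import Data.Integer.Base as ℤ using (+_; -[1+_])
import Data.Integer.Properties as ℤ
import Data.Rational.Unnormalised.Base as ℚᵘ
import Data.Rational.Unnormalised.Properties as ℚᵘ
open import Data.Rational.Base as ℚ using (ℚ; mkℚ; 0ℚ; 1ℚ; ½)
import Data.Rational.Properties as ℚ
open import Data.Rational.Solver using (module +-*-Solver)
open import Data.Product.Base using (∃; Σ; _×_; _,_; proj₁; proj₂)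
open import Data.Sum.Base using (inj₁; inj₂)
open import Relation.Binary.PropositionalEquality
  using (_≡_; refl; sym; trans; cong; cong₂; subst; subst₂)

module ℚ-Lemmas where
  open import Data.Rational.Base using (_+_; _*_; _-_; -_; _≤_; _<_; ∣_∣; _⊔_; 1/_; _/_)
  open +-*-Solver using (solve; _:=_; _:+_; _:*_; _:-_; :-_; con)

  ≤-by : ∀ {a b} d → 0ℚ ≤ d → b ≡ a + d → a ≤ b
  ≤-by {a} d 0≤d b≡ =
    subst₂ _≤_ (ℚ.+-identityʳ a) (sym b≡) (ℚ.+-monoʳ-≤ a 0≤d)

  0≤-diff : ∀ {a b} → a ≤ b → 0ℚ ≤ b - a
  0≤-diff {a} {b} a≤b =
    subst (_≤ b - a) (ℚ.+-inverseʳ a) (ℚ.+-monoˡ-≤ (- a) a≤b)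

  *-monoˡ : ∀ {a b c} → 0ℚ ≤ c → a ≤ b → c * a ≤ c * b
  *-monoˡ {c = c} 0≤c = ℚ.*-monoˡ-≤-nonNeg c {{ℚ.nonNegative 0≤c}}

  *-monoʳ : ∀ {a b c} → 0ℚ ≤ c → a ≤ b → a * c ≤ b * c
  *-monoʳ {c = c} 0≤c = ℚ.*-monoʳ-≤-nonNeg c {{ℚ.nonNegative 0≤c}}

  *-mono : ∀ {a b c d} → 0ℚ ≤ a → 0ℚ ≤ d → a ≤ b → c ≤ d → a * c ≤ b * d
  *-mono 0≤a 0≤d a≤b c≤d = ℚ.≤-trans (*-monoˡ 0≤a c≤d) (*-monoʳ 0≤d a≤b)

  0≤* : ∀ {a b} → 0ℚ ≤ a → 0ℚ ≤ b → 0ℚ ≤ a * b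
  0≤* {a} {b} 0≤a 0≤b = subst (_≤ a * b) (ℚ.*-zeroʳ a) (*-monoˡ {0ℚ} {b} {a} 0≤a 0≤b)

  0<* : ∀ {a b} → 0ℚ < a → 0ℚ < b → 0ℚ < a * b
  0<* {a} {b} 0<a 0<b = ℚ.positive⁻¹ (a * b)
    {{ℚ.pos*pos⇒pos a {{ℚ.positive 0<a}} b {{ℚ.positive 0<b}}}}

  0<+ : ∀ {a b} → 0ℚ < a → 0ℚ < b → 0ℚ < a + b
  0<+ = ℚ.+-mono-<

  *-cancelˡ : ∀ {a b} c → 0ℚ < c → c * a ≤ c * b → a ≤ b
  *-cancelˡ c 0<c = ℚ.*-cancelˡ-≤-pos c {{ℚ.positive 0<c}}

  0<½ : 0ℚ < ½
  0<½ = ℚ.positive⁻¹ ½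

  0<1 : 0ℚ < 1ℚ
  0<1 = ℚ.positive⁻¹ 1ℚ

  0<half : ∀ {ε} → 0ℚ < ε → 0ℚ < ½ * ε
  0<half = 0<* 0<½

  half+half : ∀ ε → ½ * ε + ½ * ε ≡ ε
  half+half = solve 1 (λ e → con ½ :* e :+ con ½ :* e := e) refl

  ∣∣-≤ : ∀ {a b} → - b ≤ a → a ≤ b → ∣ a ∣ ≤ b
  ∣∣-≤ {a} {b} l u with ℚ.∣p∣≡p∨∣p∣≡-p a
  ... | inj₁ e = subst (_≤ b) (sym e) u
  ... | inj₂ e = subst₂ _≤_ (sym e) (solve 1 (λ x → :- :- x := x) refl b)
                   (ℚ.neg-antimono-≤ l)

  ≤∣∣ : ∀ a → a ≤ ∣ a ∣
  ≤∣∣ a with ℚ.≤-total 0ℚ a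
  ... | inj₁ p = ℚ.≤-reflexive (sym (ℚ.0≤p⇒∣p∣≡p p))
  ... | inj₂ p = ℚ.≤-trans p (ℚ.0≤∣p∣ a)

  ∣-∣-comm : ∀ a b → ∣ a - b ∣ ≡ ∣ b - a ∣
  ∣-∣-comm a b = trans (sym (ℚ.∣-p∣≡∣p∣ (a - b)))
    (cong ∣_∣ (solve 2 (λ x y → :- (x :- y) := y :- x) refl a b))

  triangle : ∀ a b c → ∣ a - c ∣ ≤ ∣ a - b ∣ + ∣ b - c ∣
  triangle a b c = subst (λ z → ∣ z ∣ ≤ ∣ a - b ∣ + ∣ b - c ∣)
    (solve 3 (λ x y z → (x :- y) :+ (y :- z) := x :- z) refl a b c)
    (ℚ.∣p+q∣≤∣p∣+∣q∣ (a - b) (b - c))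

  close-≤ : ∀ {a b e} → ∣ a - b ∣ ≤ e → a ≤ b + e
  close-≤ {a} {b} {e} h = subst (_≤ b + e)
    (solve 2 (λ x y → y :+ (x :- y) := x) refl a b)
    (ℚ.+-monoʳ-≤ b (ℚ.≤-trans (≤∣∣ (a - b)) h))

  close-≥ : ∀ {a b e} → ∣ a - b ∣ ≤ e → b ≤ a + e
  close-≥ {a} {b} h = close-≤ (subst (_≤ _) (∣-∣-comm a b) h)

  ≤-close : ∀ {a b e} → a ≤ b + e → b ≤ a + e → ∣ a - b ∣ ≤ e
  ≤-close {a} {b} {e} p q = ∣∣-≤
    (subst₂ _≤_ (solve 3 (λ a b e → b :+ (:- b :- e) := :- e) refl a b e)
                (solve 3 (λ a b e → (a :+ e) :+ (:- b :- e) := a :- b) refl a b e)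
                (ℚ.+-monoˡ-≤ (- b - e) q))
    (subst₂ _≤_ refl (solve 2 (λ b e → (b :+ e) :- b := e) refl b e)
                (ℚ.+-monoˡ-≤ (- b) p))

  close-+ : ∀ {a b c d e f} → ∣ a - c ∣ ≤ e → ∣ b - d ∣ ≤ f →
            ∣ (a + b) - (c + d) ∣ ≤ e + f
  close-+ {a} {b} {c} {d} h k = ℚ.≤-trans
    (subst (λ z → ∣ z ∣ ≤ ∣ a - c ∣ + ∣ b - d ∣)
      (solve 4 (λ a b c d → (a :- c) :+ (b :- d) := (a :+ b) :- (c :+ d)) refl a b c d)
      (ℚ.∣p+q∣≤∣p∣+∣q∣ (a - c) (b - d)))
    (ℚ.+-mono-≤ h k)

  close-neg : ∀ {a c e} → ∣ a - c ∣ ≤ e → ∣ (- a) - (- c) ∣ ≤ e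
  close-neg {a} {c} {e} = subst (_≤ e) (trans (∣-∣-comm a c)
    (cong ∣_∣ (solve 2 (λ a c → c :- a := :- a :- :- c) refl a c)))

  close-* : ∀ {a b c d A D e f} → ∣ a ∣ ≤ A → ∣ d ∣ ≤ D →
            ∣ a - c ∣ ≤ e → ∣ b - d ∣ ≤ f → ∣ a * b - c * d ∣ ≤ A * f + D * e
  close-* {a} {b} {c} {d} hA hD he hf = ℚ.≤-trans
    (subst (λ z → ∣ z ∣ ≤ ∣ a * (b - d) ∣ + ∣ d * (a - c) ∣)
      (solve 4 (λ a b c d → a :* (b :- d) :+ d :* (a :- c) := a :* b :- c :* d) refl a b c d)
      (ℚ.∣p+q∣≤∣p∣+∣q∣ (a * (b - d)) (d * (a - c))))
    (ℚ.+-mono-≤ (bound a (b - d) hA hf) (bound d (a - c) hD he))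
    where
    bound : ∀ x y {X Y} → ∣ x ∣ ≤ X → ∣ y ∣ ≤ Y → ∣ x * y ∣ ≤ X * Y
    bound x y {X} {Y} p q = subst (_≤ X * Y) (sym (ℚ.∣p*q∣≡∣p∣*∣q∣ x y))
      (*-mono (ℚ.0≤∣p∣ x) (ℚ.≤-trans (ℚ.0≤∣p∣ y) q) p q)

  close-⊔ : ∀ {a b c d e} → ∣ a - c ∣ ≤ e → ∣ b - d ∣ ≤ e → ∣ (a ⊔ b) - (c ⊔ d) ∣ ≤ e
  close-⊔ {a} {b} {c} {d} {e} h k = ≤-close {a ⊔ b} {c ⊔ d} {e}
    (ℚ.⊔-lub (ℚ.≤-trans (close-≤ {a} {c} h) (ℚ.+-monoˡ-≤ e (ℚ.p≤p⊔q c d)))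
             (ℚ.≤-trans (close-≤ {b} {d} k) (ℚ.+-monoˡ-≤ e (ℚ.p≤q⊔p c d))))
    (ℚ.⊔-lub (ℚ.≤-trans (close-≥ {a} {c} h) (ℚ.+-monoˡ-≤ e (ℚ.p≤p⊔q a b)))
             (ℚ.≤-trans (close-≥ {b} {d} k) (ℚ.+-monoˡ-≤ e (ℚ.p≤q⊔p a b))))

  recip : (q : ℚ) → 0ℚ < q → ℚ
  recip q 0<q = (1/ q) {{ℚ.>-nonZero 0<q}}

  *-recip : ∀ q (0<q : 0ℚ < q) → q * recip q 0<q ≡ 1ℚ
  *-recip q 0<q = ℚ.*-inverseʳ q {{ℚ.>-nonZero 0<q}}

  0<recip : ∀ q (0<q : 0ℚ < q) → 0ℚ < recip q 0<q
  0<recip q 0<q = ℚ.positive⁻¹ _ {{ℚ.1/pos⇒pos q {{ℚ.positive 0<q}}}}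

  recip-anti : ∀ {a b} (0<a : 0ℚ < a) (0<b : 0ℚ < b) → a ≤ b → recip b 0<b ≤ recip a 0<a
  recip-anti {a} {b} 0<a 0<b a≤b = subst₂ _≤_
    (trans (cong (_* v) (*-recip a 0<a)) (ℚ.*-identityˡ v))
    (trans (solve 3 (λ b u v → (b :* u) :* v := (b :* v) :* u) refl b u v)
      (trans (cong (_* u) (*-recip b 0<b)) (ℚ.*-identityˡ u)))
    (*-monoʳ (ℚ.<⇒≤ (0<recip b 0<b)) (*-monoʳ (ℚ.<⇒≤ (0<recip a 0<a)) a≤b))
    where u = recip a 0<a
          v = recip b 0<b

  close-recip : ∀ {a b l e} (0<a : 0ℚ < a) (0<b : 0ℚ < b) (0<l : 0ℚ < l) → l ≤ a → l ≤ b →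
    ∣ a - b ∣ ≤ e → ∣ recip a 0<a - recip b 0<b ∣ ≤ (recip l 0<l * recip l 0<l) * e
  close-recip {a} {b} {l} {e} 0<a 0<b 0<l l≤a l≤b h =
    subst (_≤ (w * w) * e) (sym eq)
      (*-mono (0≤* 0≤u 0≤v) (ℚ.≤-trans (ℚ.0≤∣p∣ (a - b)) h)
        (*-mono 0≤u 0≤w (recip-anti 0<l 0<a l≤a) (recip-anti 0<l 0<b l≤b)) h)
    where
    u = recip a 0<a
    v = recip b 0<b
    w = recip l 0<l
    0≤u = ℚ.<⇒≤ (0<recip a 0<a)
    0≤v = ℚ.<⇒≤ (0<recip b 0<b)
    0≤w = ℚ.<⇒≤ (0<recip l 0<l)
    diff : u - v ≡ (u * v) * (b - a)
    diff = trans
      (cong₂ _-_ (sym (trans (cong (u *_) (*-recip b 0<b)) (ℚ.*-identityʳ u)))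
                 (sym (trans (cong (v *_) (*-recip a 0<a)) (ℚ.*-identityʳ v))))
      (solve 4 (λ a b u v → u :* (b :* v) :- v :* (a :* u) := (u :* v) :* (b :- a)) refl a b u v)
    eq : ∣ u - v ∣ ≡ (u * v) * ∣ a - b ∣
    eq = trans (cong ∣_∣ diff) (trans (ℚ.∣p*q∣≡∣p∣*∣q∣ (u * v) (b - a))
      (cong₂ _*_ (ℚ.0≤p⇒∣p∣≡p (0≤* 0≤u 0≤v)) (∣-∣-comm b a)))

  frac-≤ : ∀ a b c d → a ℕ.* suc d ℕ.≤ c ℕ.* suc b → + a / suc b ≤ + c / suc d
  frac-≤ a b c d h = ℚ.toℚᵘ-cancel-≤
    (ℚᵘ.≤-respˡ-≃ (ℚᵘ.≃-sym (ℚ.toℚᵘ-fromℚᵘ (ℚᵘ.mkℚᵘ (+ a) b)))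
    (ℚᵘ.≤-respʳ-≃ (ℚᵘ.≃-sym (ℚ.toℚᵘ-fromℚᵘ (ℚᵘ.mkℚᵘ (+ c) d)))
      (ℚᵘ.*≤* (subst₂ ℤ._≤_ (ℤ.pos-* a (suc d)) (ℤ.pos-* c (suc b)) (ℤ.+≤+ h)))))

  frac-* : ∀ a b c d → (+ a / suc b) * (+ c / suc d) ≡ (+ (a ℕ.* c)) / (suc b ℕ.* suc d)
  frac-* a b c d = ℚ.toℚᵘ-injective
    (ℚᵘ.≃-trans (ℚ.toℚᵘ-homo-* (+ a / suc b) (+ c / suc d))
    (ℚᵘ.≃-trans (ℚᵘ.*-cong (ℚ.toℚᵘ-fromℚᵘ (ℚᵘ.mkℚᵘ (+ a) b)) (ℚ.toℚᵘ-fromℚᵘ (ℚᵘ.mkℚᵘ (+ c) d)))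
    (ℚᵘ.≃-trans (ℚᵘ.*≡* (cong (ℤ._* (+ (suc b ℕ.* suc d))) (sym (ℤ.pos-* a c))))
      (ℚᵘ.≃-sym (ℚ.toℚᵘ-fromℚᵘ (ℚᵘ.mkℚᵘ (+ (a ℕ.* c)) (d ℕ.+ b ℕ.* suc d)))))))

  ι : ℕ → ℚ
  ι n = + n / 1

  ι-mono : ∀ {m n} → m ℕ.≤ n → ι m ≤ ι n
  ι-mono {m} {n} h = frac-≤ m 0 n 0 (ℕ.*-monoˡ-≤ 1 h)

  0≤ι : ∀ n → 0ℚ ≤ ι n
  0≤ι n = ι-mono {0} {n} z≤n

  0<ι : ∀ n → 0ℚ < ι (suc n)
  0<ι n = ℚ.<-≤-trans 0<1 (ι-mono (s≤s (z≤n {n})))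

  ι-suc : ∀ n → ι (suc n) ≡ 1ℚ + ι n
  ι-suc n = ℚ.toℚᵘ-injective
    (ℚᵘ.≃-trans (ℚ.toℚᵘ-fromℚᵘ (ℚᵘ.mkℚᵘ (+ suc n) 0))
    (ℚᵘ.≃-trans (ℚᵘ.*≡* (cong (ℤ._* (+ 1)) (sym (cong (λ z → + 1 ℤ.+ z) (ℤ.*-identityʳ (+ n))))))
    (ℚᵘ.≃-trans (ℚᵘ.+-congʳ (ℚ.toℚᵘ 1ℚ) (ℚᵘ.≃-sym (ℚ.toℚᵘ-fromℚᵘ (ℚᵘ.mkℚᵘ (+ n) 0))))
      (ℚᵘ.≃-sym (ℚ.toℚᵘ-homo-+ 1ℚ (ι n))))))

  archimedean : ∀ q → ∃ λ n → q ≤ ι n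
  archimedean q@(mkℚ (+ a) d _) = a , ℚ.toℚᵘ-cancel-≤
    (ℚᵘ.≤-respʳ-≃ (ℚᵘ.≃-sym (ℚ.toℚᵘ-fromℚᵘ (ℚᵘ.mkℚᵘ (+ a) 0)))
      (ℚᵘ.*≤* (subst₂ ℤ._≤_ (ℤ.pos-* a 1) (ℤ.pos-* a (suc d))
        (ℤ.+≤+ (ℕ.*-monoʳ-≤ a (s≤s z≤n))))))
  archimedean q@(mkℚ -[1+ a ] d _) = 0 , ℚ.nonPositive⁻¹ q

  ι-* : ∀ m n → ι m * ι n ≡ ι (m ℕ.* n)
  ι-* m n = frac-* m 0 n 0

  ι*frac : ∀ a n .{{_ : ℕ.NonZero n}} → ι n * (+ a / n) ≡ ι a
  ι*frac a n@(suc k) = trans (frac-* n 0 a k)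
    (ℚ.≤-antisym (frac-≤ (n ℕ.* a) (k ℕ.+ 0) a 0 (ℕ.≤-reflexive eq))
                 (frac-≤ a 0 (n ℕ.* a) (k ℕ.+ 0) (ℕ.≤-reflexive (sym eq))))
    where
    eq : n ℕ.* a ℕ.* 1 ≡ a ℕ.* suc (k ℕ.+ 0)
    eq = trans (ℕ.*-identityʳ (n ℕ.* a)) (trans (ℕ.*-comm n a)
           (cong (λ z → a ℕ.* suc z) (sym (ℕ.+-identityʳ k))))

  archimedean-recip : ∀ ε → 0ℚ < ε → ∃ λ N → ∀ n → N ℕ.≤ n → + 1 / suc n ≤ ε
  archimedean-recip ε 0<ε with archimedean (recip ε 0<ε)
  ... | N , h = N , λ n N≤n → *-cancelˡ (ι (suc n)) (0<ι n)
    (subst₂ _≤_ (trans (*-recip ε 0<ε) (sym (ι*frac 1 (suc n)))) (ℚ.*-comm ε (ι (suc n)))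
      (*-monoˡ (ℚ.<⇒≤ 0<ε) (ℚ.≤-trans h (ι-mono (ℕ.m≤n⇒m≤1+n N≤n)))))

  factorial-step : ∀ k →
    ι (suc k) * (+ 1 / (suc k !)) {{suc k ℕ.!≢0}} ≡ (+ 1 / (k !)) {{k ℕ.!≢0}}
  factorial-step k = ℚ.≤-antisym
    (*-cancelˡ f 0<f (ℚ.≤-reflexive eq)) (*-cancelˡ f 0<f (ℚ.≤-reflexive (sym eq)))
    where
    instance _ = k ℕ.!≢0
    instance _ = suc k ℕ.!≢0
    f = ι (k !)
    0<f : 0ℚ < f
    0<f = ℚ.<-≤-trans 0<1 (ι-mono (ℕ.1≤n! k))
    eq : f * (ι (suc k) * (+ 1 / (suc k !))) ≡ f * (+ 1 / (k !))
    eq = trans (solve 3 (λ f g c → f :* (g :* c) := (g :* f) :* c) refl f (ι (suc k)) (+ 1 / (suc k !)))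
      (trans (cong (_* (+ 1 / (suc k !))) (ι-* (suc k) (k !)))
      (trans (ι*frac 1 (suc k !)) (sym (ι*frac 1 (k !)))))

open ℚ-Lemmas
open +-*-Solver using (solve; _:=_; _:+_; _:*_; _:-_; :-_; con)

-- Real numbers: Cauchy sequences of rationals with a modulus of convergence,
-- compared up to _≃_.

IsCauchy : (ℕ → ℚ) → Set
IsCauchy a = ∀ ε → 0ℚ ℚ.< ε →
  ∃ λ N → ∀ m n → N ℕ.≤ m → N ℕ.≤ n → ℚ.∣ a m ℚ.- a n ∣ ℚ.≤ ε

record ℝ : Set where
  no-eta-equality
  constructor mkℝ
  field
    seq    : ℕ → ℚ
    cauchy : IsCauchy seq

open ℝ public

infix 4 _≤_ _<_ _≃_
infixl 6 _+_ _-_ _⊔_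
infixl 7 _*_
infix 8 -_
infixr 9 _^_

_≤_ : ℝ → ℝ → Set
x ≤ y = ∀ ε → 0ℚ ℚ.< ε → ∃ λ N → ∀ n → N ℕ.≤ n → seq x n ℚ.≤ seq y n ℚ.+ ε

_<_ : ℝ → ℝ → Set
x < y = ∃ λ ε → 0ℚ ℚ.< ε × ∃ λ N → ∀ n → N ℕ.≤ n → seq x n ℚ.+ ε ℚ.≤ seq y n

_≃_ : ℝ → ℝ → Set
x ≃ y = x ≤ y × y ≤ x

fromℚ : ℚ → ℝ
fromℚ q = mkℝ (λ _ → q) λ ε 0<ε → 0 , λ _ _ _ _ →
  ≤-close {q} {q} {ε} (q≤ ε 0<ε) (q≤ ε 0<ε)
  where
  q≤ : ∀ ε → 0ℚ ℚ.< ε → q ℚ.≤ q ℚ.+ ε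
  q≤ ε 0<ε = ≤-by ε (ℚ.<⇒≤ 0<ε) refl

fromℕ : ℕ → ℝ
fromℕ n = fromℚ (ι n)

0ℝ 1ℝ 2ℝ : ℝ
0ℝ = fromℚ 0ℚ
1ℝ = fromℚ 1ℚ
2ℝ = fromℕ 2

lub₂ : ∀ {m n k} → m ℕ.⊔ n ℕ.≤ k → m ℕ.≤ k × n ℕ.≤ k
lub₂ {m} {n} h = ℕ.≤-trans (ℕ.m≤m⊔n m n) h , ℕ.≤-trans (ℕ.m≤n⊔m m n) h

-- An upper bound for the absolute value of all terms from some index on.
bound : ∀ x → ∃ λ B → 0ℚ ℚ.< B × ∃ λ N → ∀ n → N ℕ.≤ n → ℚ.∣ seq x n ∣ ℚ.≤ B
bound x with cauchy x 1ℚ 0<1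
... | N , h = 1ℚ ℚ.+ ℚ.∣ seq x N ∣
  , ℚ.<-≤-trans 0<1 (≤-by ℚ.∣ seq x N ∣ (ℚ.0≤∣p∣ (seq x N)) refl)
  , N , λ n N≤n → subst (λ z → ℚ.∣ z ∣ ℚ.≤ 1ℚ ℚ.+ ℚ.∣ seq x N ∣)
      (solve 2 (λ a b → (a :- b) :+ b := a) refl (seq x n) (seq x N))
      (ℚ.≤-trans (ℚ.∣p+q∣≤∣p∣+∣q∣ (seq x n ℚ.- seq x N) (seq x N))
        (ℚ.+-monoˡ-≤ ℚ.∣ seq x N ∣ (h n N N≤n ℕ.≤-refl)))

_+_ : ℝ → ℝ → ℝ
x + y = mkℝ (λ n → seq x n ℚ.+ seq y n) λ ε 0<ε →
  let (M , h) = cauchy x (½ ℚ.* ε) (0<half 0<ε)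
      (N , k) = cauchy y (½ ℚ.* ε) (0<half 0<ε)
  in M ℕ.⊔ N , λ m n p q → subst (ℚ._≤_ _) (half+half ε)
       (close-+ {seq x m} {seq y m} {seq x n} {seq y n}
         (h m n (proj₁ (lub₂ p)) (proj₁ (lub₂ q)))
         (k m n (proj₂ (lub₂ {M} p)) (proj₂ (lub₂ {M} q))))

-_ : ℝ → ℝ
- x = mkℝ (λ n → ℚ.- seq x n) λ ε 0<ε →
  let (N , h) = cauchy x ε 0<ε
  in N , λ m n p q → close-neg {seq x m} {seq x n} (h m n p q)

_-_ : ℝ → ℝ → ℝ
x - y = x + (- y)

_*_ : ℝ → ℝ → ℝ
x * y = mkℝ (λ n → seq x n ℚ.* seq y n) λ ε 0<ε →
  let (A , 0<A , K , hA) = bound x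
      (D , 0<D , L , hD) = bound y
      a = recip A 0<A ; d = recip D 0<D
      (M , h) = cauchy x (d ℚ.* (½ ℚ.* ε)) (0<* (0<recip D 0<D) (0<half 0<ε))
      (N , k) = cauchy y (a ℚ.* (½ ℚ.* ε)) (0<* (0<recip A 0<A) (0<half 0<ε))
      eq = trans (cong₂ ℚ._+_ (undo A 0<A (½ ℚ.* ε)) (undo D 0<D (½ ℚ.* ε))) (half+half ε)
  in (K ℕ.⊔ L) ℕ.⊔ (M ℕ.⊔ N) , λ m n p q →
       let (p₁ , p₂) = lub₂ {K ℕ.⊔ L} {M ℕ.⊔ N} p
           (q₁ , q₂) = lub₂ {K ℕ.⊔ L} {M ℕ.⊔ N} q
       in subst (ℚ._≤_ _) eq
         (close-* {seq x m} {seq y m} {seq x n} {seq y n} {A} {D}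
           (hA m (proj₁ (lub₂ p₁))) (hD n (proj₂ (lub₂ {K} q₁)))
           (h m n (proj₁ (lub₂ p₂)) (proj₁ (lub₂ q₂)))
           (k m n (proj₂ (lub₂ {M} p₂)) (proj₂ (lub₂ {M} q₂))))
  where
  undo : ∀ A 0<A e → A ℚ.* (recip A 0<A ℚ.* e) ≡ e
  undo A 0<A e = trans (sym (ℚ.*-assoc A (recip A 0<A) e))
    (trans (cong (ℚ._* e) (*-recip A 0<A)) (ℚ.*-identityˡ e))

_⊔_ : ℝ → ℝ → ℝ
x ⊔ y = mkℝ (λ n → seq x n ℚ.⊔ seq y n) λ ε 0<ε →
  let (M , h) = cauchy x ε 0<ε
      (N , k) = cauchy y ε 0<ε
  in M ℕ.⊔ N , λ m n p q →
       close-⊔ {seq x m} {seq y m} {seq x n} {seq y n}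
         (h m n (proj₁ (lub₂ p)) (proj₁ (lub₂ q)))
         (k m n (proj₂ (lub₂ {M} p)) (proj₂ (lub₂ {M} q)))

_^_ : ℝ → ℕ → ℝ
x ^ zero  = 1ℝ
x ^ suc n = x * x ^ n

-- The witness l of 0 < y is a lower bound for the terms of y from some index
-- on; taking l ⊔ yₙ makes the finitely many earlier terms invertible as well.
inv : (y : ℝ) → 0ℝ < y → ℝ
inv y (l , 0<l , K , hK) = mkℝ (λ n → recip (l ℚ.⊔ seq y n) (pos n)) λ ε 0<ε →
  let (N , h) = cauchy y ((l ℚ.* l) ℚ.* ε) (0<* (0<* 0<l 0<l) 0<ε)
  in N , λ m n p q → subst (ℚ._≤_ _) (undo ε)
       (close-recip (pos m) (pos n) 0<l (ℚ.p≤p⊔q l (seq y m)) (ℚ.p≤p⊔q l (seq y n))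
         (close-⊔ {l} {seq y m} {l} {seq y n}
           (ℚ.≤-trans (ℚ.≤-reflexive (cong ℚ.∣_∣ (ℚ.+-inverseʳ l)))
             (ℚ.<⇒≤ (0<* (0<* 0<l 0<l) 0<ε)))
           (h m n p q)))
  where
  pos : ∀ n → 0ℚ ℚ.< l ℚ.⊔ seq y n
  pos n = ℚ.<-≤-trans 0<l (ℚ.p≤p⊔q l (seq y n))
  w = recip l 0<l
  undo : ∀ ε → (w ℚ.* w) ℚ.* ((l ℚ.* l) ℚ.* ε) ≡ ε
  undo ε = trans (solve 3 (λ w l e → (w :* w) :* ((l :* l) :* e) := (l :* w) :* ((l :* w) :* e)) refl w l ε)
    (trans (cong (λ z → z ℚ.* (z ℚ.* ε)) (*-recip l 0<l))
      (solve 1 (λ e → con 1ℚ :* (con 1ℚ :* e) := e) refl ε))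

infixl 7 _/_⟨_⟩
_/_⟨_⟩ : ℝ → (y : ℝ) → 0ℝ < y → ℝ
x / y ⟨ 0<y ⟩ = x * inv y 0<y

-- The limit of a Cauchy sequence of reals, by a diagonal sequence.
IsCauchyℝ : (ℕ → ℝ) → Set
IsCauchyℝ s = ∀ ε → 0ℚ ℚ.< ε → ∃ λ N → ∀ m n → N ℕ.≤ m → N ℕ.≤ n →
  ∃ λ I → ∀ i → I ℕ.≤ i → ℚ.∣ seq (s m) i ℚ.- seq (s n) i ∣ ℚ.≤ ε

module _ (s : ℕ → ℝ) where
  modulus : ∀ n → ∃ λ N → ∀ i j → N ℕ.≤ i → N ℕ.≤ j →
            ℚ.∣ seq (s n) i ℚ.- seq (s n) j ∣ ℚ.≤ + 1 ℚ./ suc n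
  modulus n = cauchy (s n) (+ 1 ℚ./ suc n) (ℚ.positive⁻¹ _ {{ℚ.normalize-pos 1 (suc n)}})

  diag : ℕ → ℕ
  diag n = proj₁ (modulus n)

lim : (s : ℕ → ℝ) → IsCauchyℝ s → ℝ
lim s s-cauchy = mkℝ (λ n → seq (s n) (diag s n)) λ ε 0<ε →
  let δ = ½ ℚ.* (½ ℚ.* ε)
      0<δ = 0<half (0<half 0<ε)
      (N , h) = s-cauchy δ 0<δ
      (M , k) = archimedean-recip δ 0<δ
  in N ℕ.⊔ M , λ m n p q →
       let (I , g) = h m n (proj₁ (lub₂ p)) (proj₁ (lub₂ q))
           i = I ℕ.⊔ (diag s m ℕ.⊔ diag s n)
           I≤ , d≤ = lub₂ {I} {diag s m ℕ.⊔ diag s n} {i} ℕ.≤-refl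
           m≤ , n≤ = lub₂ d≤
           u = seq (s m) (diag s m) ; v = seq (s m) i ; w = seq (s n) i ; z = seq (s n) (diag s n)
           uv = ℚ.≤-trans (proj₂ (modulus s m) (diag s m) i ℕ.≤-refl m≤) (k m (proj₂ (lub₂ {N} p)))
           wz = ℚ.≤-trans (proj₂ (modulus s n) i (diag s n) n≤ ℕ.≤-refl) (k n (proj₂ (lub₂ {N} q)))
       in ℚ.≤-trans (triangle u v z)
            (ℚ.≤-trans (ℚ.+-mono-≤ uv (ℚ.≤-trans (triangle v w z) (ℚ.+-mono-≤ (g i I≤) wz)))
              (≤-by δ (ℚ.<⇒≤ 0<δ) (quarters ε)))
  where
  quarters : ∀ ε → let δ = ½ ℚ.* (½ ℚ.* ε) in ε ≡ (δ ℚ.+ (δ ℚ.+ δ)) ℚ.+ δ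
  quarters = solve 1 (λ e → let d = con ½ :* (con ½ :* e) in e := (d :+ (d :+ d)) :+ d) refl

partialSum : (ℕ → ℝ) → ℕ → ℝ
partialSum t zero    = 0ℝ
partialSum t (suc n) = partialSum t n + t n

module RatioTest (t : ℕ → ℝ) (s : ℚ) (0<s : 0ℚ ℚ.< s) (K I : ℕ)
  (ratio : ∀ k i → K ℕ.≤ k → I ℕ.≤ i →
           ℚ.∣ seq (t (suc k)) i ∣ ℚ.≤ (1ℚ ℚ.- s) ℚ.* ℚ.∣ seq (t k) i ∣) where

  private
    a : ℕ → ℕ → ℚ
    a k i = ℚ.∣ seq (t k) i ∣
    S : ℕ → ℕ → ℚ
    S n i = seq (partialSum t n) i
    0≤s = ℚ.<⇒≤ 0<s

  tail : ∀ n j i → K ℕ.≤ n → I ℕ.≤ i →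
         s ℚ.* ℚ.∣ S (j ℕ.+ n) i ℚ.- S n i ∣ ℚ.≤ a n i ℚ.- a (j ℕ.+ n) i
  tail n zero i K≤n I≤i = ℚ.≤-reflexive
    (trans (cong (λ z → s ℚ.* ℚ.∣ z ∣) (ℚ.+-inverseʳ (S n i)))
      (trans (ℚ.*-zeroʳ s) (sym (ℚ.+-inverseʳ (a n i)))))
  tail n (suc j) i K≤n I≤i = ℚ.≤-trans
    (*-monoˡ {b = ℚ.∣ T ℚ.- S n i ∣ ℚ.+ u} 0≤s
      (subst (λ z → ℚ.∣ z ∣ ℚ.≤ ℚ.∣ T ℚ.- S n i ∣ ℚ.+ u)
        (solve 3 (λ T t S → (T :- S) :+ t := (T :+ t) :- S) refl T (seq (t (j ℕ.+ n)) i) (S n i))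
        (ℚ.∣p+q∣≤∣p∣+∣q∣ (T ℚ.- S n i) (seq (t (j ℕ.+ n)) i))))
    (ℚ.≤-trans (ℚ.≤-reflexive (ℚ.*-distribˡ-+ s ℚ.∣ T ℚ.- S n i ∣ u))
    (ℚ.≤-trans (ℚ.+-mono-≤ (tail n j i K≤n I≤i) step)
      (ℚ.≤-reflexive (solve 3 (λ x u v → (x :- u) :+ (u :- v) := x :- v) refl (a n i) u v))))
    where
    T = S (j ℕ.+ n) i
    u = a (j ℕ.+ n) i
    v = a (suc (j ℕ.+ n)) i
    step : s ℚ.* u ℚ.≤ u ℚ.- v
    step = ≤-by ((1ℚ ℚ.- s) ℚ.* u ℚ.- v)
      (0≤-diff (ratio (j ℕ.+ n) i (ℕ.≤-trans K≤n (ℕ.m≤n+m n j)) I≤i))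
      (solve 3 (λ s u v → u :- v := s :* u :+ ((con 1ℚ :- s) :* u :- v)) refl s u v)

  decay : ∀ j i → I ℕ.≤ i → a (j ℕ.+ K) i ℚ.* (1ℚ ℚ.+ ι j ℚ.* s) ℚ.≤ a K i
  decay zero i I≤i = ℚ.≤-reflexive
    (solve 2 (λ x s → x :* (con 1ℚ :+ con 0ℚ :* s) := x) refl (a K i) s)
  decay (suc j) i I≤i = ℚ.≤-trans
    (*-monoʳ 0≤f (ratio (j ℕ.+ K) i (ℕ.m≤n+m K j) I≤i))
    (ℚ.≤-trans (≤-by (u ℚ.* ((s ℚ.* s) ℚ.* (1ℚ ℚ.+ ι j)))
      (0≤* (ℚ.0≤∣p∣ (seq (t (j ℕ.+ K)) i)) (0≤* (0≤* 0≤s 0≤s) (subst (0ℚ ℚ.≤_) (ι-suc j) (0≤ι (suc j)))))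
      (trans (solve 3 (λ u s j → u :* (con 1ℚ :+ j :* s) :=
               ((con 1ℚ :- s) :* u) :* (con 1ℚ :+ (con 1ℚ :+ j) :* s) :+ u :* ((s :* s) :* (con 1ℚ :+ j)))
               refl u s (ι j))
        (cong (λ z → ((1ℚ ℚ.- s) ℚ.* u) ℚ.* (1ℚ ℚ.+ z ℚ.* s) ℚ.+ u ℚ.* ((s ℚ.* s) ℚ.* (1ℚ ℚ.+ ι j)))
          (sym (ι-suc j)))))
      (decay j i I≤i))
    where
    u = a (j ℕ.+ K) i
    0≤f : 0ℚ ℚ.≤ 1ℚ ℚ.+ ι (suc j) ℚ.* s
    0≤f = ℚ.+-mono-≤ (ℚ.<⇒≤ 0<1) (0≤* (0≤ι (suc j)) 0≤s)

  partialSum-cauchy : IsCauchyℝ (partialSum t)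
  partialSum-cauchy ε 0<ε = J ℕ.+ K , λ m n p q → I ℕ.⊔ L , λ i r → both m n p q i (lub₂ r)
    where
    C = proj₁ (bound (t K))
    L = proj₁ (proj₂ (proj₂ (bound (t K))))
    hC = proj₂ (proj₂ (proj₂ (bound (t K))))
    se = s ℚ.* ε
    0<sse : 0ℚ ℚ.< s ℚ.* se
    0<sse = 0<* 0<s (0<* 0<s 0<ε)
    q = recip (s ℚ.* se) 0<sse
    J' = proj₁ (archimedean (C ℚ.* q))
    hJ = proj₂ (archimedean (C ℚ.* q))
    J = suc J'
    Js = ι J ℚ.* s
    0<Js : 0ℚ ℚ.< Js
    0<Js = 0<* (0<ι J') 0<s


    C≤ : C ℚ.≤ Js ℚ.* se
    C≤ = subst₂ ℚ._≤_ eq (sym (ℚ.*-assoc (ι J) s se))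
      (*-monoʳ {C ℚ.* q} {ι J} {s ℚ.* se} (ℚ.<⇒≤ 0<sse)
        (ℚ.≤-trans hJ (ι-mono {J'} {J} (ℕ.n≤1+n J'))))
      where
      eq : (C ℚ.* q) ℚ.* (s ℚ.* se) ≡ C
      eq = trans (solve 3 (λ c q x → (c :* q) :* x := c :* (x :* q)) refl C q (s ℚ.* se))
        (trans (cong (C ℚ.*_) (*-recip (s ℚ.* se) 0<sse)) (ℚ.*-identityʳ C))

    small : ∀ n i → J ℕ.+ K ℕ.≤ n → I ℕ.≤ i → L ℕ.≤ i → a n i ℚ.≤ se
    small n i q I≤i L≤i = *-cancelˡ Js 0<Js (ℚ.≤-trans (ℚ.≤-reflexive (ℚ.*-comm Js (a n i)))
      (ℚ.≤-trans (*-monoˡ {Js} {1ℚ ℚ.+ ι j ℚ.* s} {a n i} (ℚ.0≤∣p∣ (seq (t n) i))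
        (ℚ.≤-trans (*-monoʳ {ι J} {ι j} {s} 0≤s (ι-mono {J} {j} J≤j))
          (≤-by 1ℚ (ℚ.<⇒≤ 0<1) (ℚ.+-comm 1ℚ (ι j ℚ.* s)))))
      (ℚ.≤-trans (subst (λ k → a k i ℚ.* (1ℚ ℚ.+ ι j ℚ.* s) ℚ.≤ a K i) n≡ (decay j i I≤i))
      (ℚ.≤-trans (hC i L≤i) C≤))))
      where
      j = n ℕ.∸ K
      n≡ : j ℕ.+ K ≡ n
      n≡ = ℕ.m∸n+n≡m (ℕ.≤-trans (ℕ.m≤n+m K J) q)
      J≤j : J ℕ.≤ j
      J≤j = subst (ℕ._≤ j) (ℕ.m+n∸n≡m J K) (ℕ.∸-monoˡ-≤ K q)

    ordered : ∀ m n i → J ℕ.+ K ℕ.≤ n → n ℕ.≤ m → I ℕ.≤ i → L ℕ.≤ i →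
              ℚ.∣ S m i ℚ.- S n i ∣ ℚ.≤ ε
    ordered m n i q n≤m I≤i L≤i = *-cancelˡ s 0<s (ℚ.≤-trans
      (subst (λ k → s ℚ.* ℚ.∣ S k i ℚ.- S n i ∣ ℚ.≤ a n i ℚ.- a k i) (ℕ.m∸n+n≡m n≤m)
        (tail n (m ℕ.∸ n) i (ℕ.≤-trans (ℕ.m≤n+m K J) q) I≤i))
      (ℚ.≤-trans (≤-by (a m i) (ℚ.0≤∣p∣ (seq (t m) i))
          (solve 2 (λ x y → x := (x :- y) :+ y) refl (a n i) (a m i)))
        (small n i q I≤i L≤i)))

    both : ∀ m n → J ℕ.+ K ℕ.≤ m → J ℕ.+ K ℕ.≤ n → ∀ i → I ℕ.≤ i × L ℕ.≤ i →
           ℚ.∣ S m i ℚ.- S n i ∣ ℚ.≤ ε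
    both m n p q i (I≤i , L≤i) with ℕ.≤-total n m
    ... | inj₁ n≤m = ordered m n i q n≤m I≤i L≤i
    ... | inj₂ m≤n = subst (ℚ._≤ ε) (∣-∣-comm (S n i) (S m i)) (ordered n m i p m≤n I≤i L≤i)

expTerm : ℝ → ℕ → ℝ
expTerm x k = x ^ k * fromℚ ((+ 1 ℚ./ (k !)) {{k ℕ.!≢0}})

expTerm-cauchy : ∀ x → IsCauchyℝ (partialSum (expTerm x))
expTerm-cauchy x = RatioTest.partialSum-cauchy (expTerm x) ½ 0<½ K I ratio
  where
  B = proj₁ (bound x)
  I = proj₁ (proj₂ (proj₂ (bound x)))
  hB = proj₂ (proj₂ (proj₂ (bound x)))
  K = proj₁ (archimedean (B ℚ.+ B))
  hK = proj₂ (archimedean (B ℚ.+ B))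
  c : ℕ → ℚ
  c k = (+ 1 ℚ./ (k !)) {{k ℕ.!≢0}}
  0≤c : ∀ k → 0ℚ ℚ.≤ c k
  0≤c k = ℚ.nonNegative⁻¹ _ {{ℚ.normalize-nonNeg 1 (k !) {{k ℕ.!≢0}}}}
  ∣term∣ : ∀ b k → ℚ.∣ b ℚ.* c k ∣ ≡ ℚ.∣ b ∣ ℚ.* c k
  ∣term∣ b k = trans (ℚ.∣p*q∣≡∣p∣*∣q∣ b (c k)) (cong (ℚ.∣ b ∣ ℚ.*_) (ℚ.0≤p⇒∣p∣≡p (0≤c k)))
  ratio : ∀ k i → K ℕ.≤ k → I ℕ.≤ i →
    ℚ.∣ seq (expTerm x (suc k)) i ∣ ℚ.≤ (1ℚ ℚ.- ½) ℚ.* ℚ.∣ seq (expTerm x k) i ∣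
  ratio k i K≤k I≤i = subst₂ ℚ._≤_
    (trans (solve 3 (λ a b c → (b :* c) :* a := (a :* b) :* c) refl ℚ.∣ u ∣ ℚ.∣ w ∣ c')
      (trans (cong (ℚ._* c') (sym (ℚ.∣p*q∣≡∣p∣*∣q∣ u w))) (sym (∣term∣ (u ℚ.* w) (suc k)))))
    (trans (solve 3 (λ w c n → (w :* c) :* (con ½ :* n) := con ½ :* (w :* (n :* c))) refl ℚ.∣ w ∣ c' (ι (suc k)))
      (cong (½ ℚ.*_) (trans (cong (ℚ.∣ w ∣ ℚ.*_) (factorial-step k)) (sym (∣term∣ w k)))))
    (*-monoˡ {ℚ.∣ u ∣} {½ ℚ.* ι (suc k)} {ℚ.∣ w ∣ ℚ.* c'} (0≤* (ℚ.0≤∣p∣ w) (0≤c (suc k)))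
      (ℚ.≤-trans (hB i I≤i)
        (subst (ℚ._≤ ½ ℚ.* ι (suc k)) (solve 1 (λ b → con ½ :* (b :+ b) := b) refl B)
          (*-monoˡ {B ℚ.+ B} {ι (suc k)} {½} (ℚ.<⇒≤ 0<½) (ℚ.≤-trans hK (ι-mono {K} {suc k} (ℕ.m≤n⇒m≤1+n K≤k)))))))
    where
    u = seq x i
    w = seq (x ^ k) i
    c' = c (suc k)

exp : ℝ → ℝ
exp x = lim (partialSum (expTerm x)) (expTerm-cauchy x)

odd-power-ratio : ∀ v w d d' r → 0ℚ ℚ.≤ d → 0ℚ ℚ.≤ d' → d' ℚ.≤ d → ℚ.∣ v ℚ.* v ∣ ℚ.≤ r →
  ℚ.∣ (v ℚ.* ((v ℚ.* v) ℚ.* w)) ℚ.* d' ∣ ℚ.≤ r ℚ.* ℚ.∣ (v ℚ.* w) ℚ.* d ∣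
odd-power-ratio v w d d' r 0≤d 0≤d' d'≤d vv≤r = subst₂ ℚ._≤_
  (trans (cong (ℚ.∣ v ℚ.* v ∣ ℚ.*_) (sym (∣term∣ d' 0≤d')))
    (trans (sym (ℚ.∣p*q∣≡∣p∣*∣q∣ (v ℚ.* v) ((v ℚ.* w) ℚ.* d')))
      (cong ℚ.∣_∣ (solve 3 (λ v w d → (v :* v) :* ((v :* w) :* d) := (v :* ((v :* v) :* w)) :* d) refl v w d'))))
  (cong (r ℚ.*_) (sym (∣term∣ d 0≤d)))
  (*-mono {ℚ.∣ v ℚ.* v ∣} {r} {ℚ.∣ v ℚ.* w ∣ ℚ.* d'} {ℚ.∣ v ℚ.* w ∣ ℚ.* d}
    (ℚ.0≤∣p∣ (v ℚ.* v)) (0≤* (ℚ.0≤∣p∣ (v ℚ.* w)) 0≤d) vv≤r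
    (*-monoˡ {d'} {d} {ℚ.∣ v ℚ.* w ∣} (ℚ.0≤∣p∣ (v ℚ.* w)) d'≤d))
  where
  ∣term∣ : ∀ c → 0ℚ ℚ.≤ c → ℚ.∣ (v ℚ.* w) ℚ.* c ∣ ≡ ℚ.∣ v ℚ.* w ∣ ℚ.* c
  ∣term∣ c 0≤c = trans (ℚ.∣p*q∣≡∣p∣*∣q∣ (v ℚ.* w) c) (cong (ℚ.∣ v ℚ.* w ∣ ℚ.*_) (ℚ.0≤p⇒∣p∣≡p 0≤c))

-- |z| < 1, in the form that bounds the terms of z from some index on.
∣_∣<1 : ℝ → Set
∣ z ∣<1 = ∃ λ s → 0ℚ ℚ.< s × ∃ λ N → ∀ n → N ℕ.≤ n → ℚ.∣ seq z n ∣ ℚ.≤ 1ℚ ℚ.- s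

-- z²ᵏ⁺¹ / (2k+1)
artanhTerm : ℝ → ℕ → ℝ
artanhTerm z k = z * (z * z) ^ k * fromℚ (+ 1 ℚ./ suc (2 ℕ.* k))

artanhTerm-cauchy : ∀ z → ∣ z ∣<1 → IsCauchyℝ (partialSum (artanhTerm z))
artanhTerm-cauchy z (s , 0<s , N , h) =
  RatioTest.partialSum-cauchy (artanhTerm z) s 0<s 0 N (λ k i _ → ratio k i)
  where
  d : ℕ → ℚ
  d k = + 1 ℚ./ suc (2 ℕ.* k)
  0≤d : ∀ k → 0ℚ ℚ.≤ d k
  0≤d k = ℚ.nonNegative⁻¹ (d k) {{ℚ.normalize-nonNeg 1 (suc (2 ℕ.* k))}}
  d-decreasing : ∀ k → d (suc k) ℚ.≤ d k
  d-decreasing k = frac-≤ 1 (2 ℕ.* suc k) 1 (2 ℕ.* k)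
    (ℕ.*-monoʳ-≤ 1 (s≤s (ℕ.*-monoʳ-≤ 2 (ℕ.n≤1+n k))))
  zz≤ : ∀ i → N ℕ.≤ i → ℚ.∣ seq z i ℚ.* seq z i ∣ ℚ.≤ 1ℚ ℚ.- s
  zz≤ i N≤i = subst₂ ℚ._≤_ (sym (ℚ.∣p*q∣≡∣p∣*∣q∣ (seq z i) (seq z i))) (ℚ.*-identityʳ (1ℚ ℚ.- s))
    (*-mono {ℚ.∣ seq z i ∣} {1ℚ ℚ.- s} {ℚ.∣ seq z i ∣} {1ℚ} (ℚ.0≤∣p∣ (seq z i)) (ℚ.<⇒≤ 0<1) (h i N≤i)
      (ℚ.≤-trans (h i N≤i) (≤-by s (ℚ.<⇒≤ 0<s) (solve 1 (λ g → con 1ℚ := (con 1ℚ :- g) :+ g) refl s))))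
  ratio : ∀ k i → N ℕ.≤ i →
    ℚ.∣ seq (artanhTerm z (suc k)) i ∣ ℚ.≤ (1ℚ ℚ.- s) ℚ.* ℚ.∣ seq (artanhTerm z k) i ∣
  ratio k i N≤i = odd-power-ratio (seq z i) (seq ((z * z) ^ k) i) (d k) (d (suc k)) (1ℚ ℚ.- s)
    (0≤d k) (0≤d (suc k)) (d-decreasing k) (zz≤ i N≤i)

artanh : (z : ℝ) → ∣ z ∣<1 → ℝ
artanh z ∣z∣<1 = lim (partialSum (artanhTerm z)) (artanhTerm-cauchy z ∣z∣<1)

0<1+ : ∀ {x} → 0ℝ < x → 0ℝ < 1ℝ + x
0<1+ {x} (l , 0<l , N , h) = l , 0<l , N , λ n N≤n →
  ℚ.≤-trans (h n N≤n) (≤-by 1ℚ (ℚ.<⇒≤ 0<1) (ℚ.+-comm 1ℚ (seq x n)))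

-- For l ≤ x ≤ B the rational Cayley transform is at most 1 - gap in absolute value.
module Cayley (l B : ℚ) (0<l : 0ℚ ℚ.< l) (0<B : 0ℚ ℚ.< B) where

  0<1+B : 0ℚ ℚ.< 1ℚ ℚ.+ B
  0<1+B = 0<+ 0<1 0<B

  μ gap : ℚ
  μ = 1ℚ ℚ.⊓ l
  gap = recip (1ℚ ℚ.+ B) 0<1+B ℚ.* μ

  0<μ : 0ℚ ℚ.< μ
  0<μ with ℚ.≤-total 1ℚ l
  ... | inj₁ p = subst (0ℚ ℚ.<_) (sym (ℚ.p≤q⇒p⊓q≡p p)) 0<1
  ... | inj₂ p = subst (0ℚ ℚ.<_) (sym (ℚ.p≥q⇒p⊓q≡q p)) 0<l

  0<gap : 0ℚ ℚ.< gap
  0<gap = 0<* {recip (1ℚ ℚ.+ B) 0<1+B} {μ} (0<recip (1ℚ ℚ.+ B) 0<1+B) 0<μ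

  contract : ∀ x y (0<y : 0ℚ ℚ.< y) → y ≡ 1ℚ ℚ.+ x → l ℚ.≤ x → x ℚ.≤ B →
             ℚ.∣ (x ℚ.- 1ℚ) ℚ.* recip y 0<y ∣ ℚ.≤ 1ℚ ℚ.- gap
  contract x y 0<y y≡ l≤x x≤B = subst₂ ℚ._≤_
    (trans (cong (ℚ.∣ x ℚ.- 1ℚ ∣ ℚ.*_) (sym (ℚ.0≤p⇒∣p∣≡p 0≤u))) (sym (ℚ.∣p*q∣≡∣p∣*∣q∣ (x ℚ.- 1ℚ) u)))
    (trans (ℚ.*-assoc r y u) (trans (cong (r ℚ.*_) (*-recip y 0<y)) (ℚ.*-identityʳ r)))
    (*-monoʳ {ℚ.∣ x ℚ.- 1ℚ ∣} {r ℚ.* y} {u} 0≤u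
      (subst (λ w → ℚ.∣ x ℚ.- 1ℚ ∣ ℚ.≤ r ℚ.* w) (sym y≡) (∣∣-≤ {x ℚ.- 1ℚ} {r ℚ.* (1ℚ ℚ.+ x)} lower upper)))
    where
    u = recip y 0<y
    0≤u = ℚ.<⇒≤ (0<recip y 0<y)
    r = 1ℚ ℚ.- gap
    g = gap ℚ.* (1ℚ ℚ.+ x)
    g≤μ : g ℚ.≤ μ
    g≤μ = ℚ.≤-trans
      (*-monoˡ {1ℚ ℚ.+ x} {1ℚ ℚ.+ B} {gap} (ℚ.<⇒≤ 0<gap) (ℚ.+-monoʳ-≤ 1ℚ x≤B))
      (ℚ.≤-reflexive (trans
        (solve 3 (λ v m b → (v :* m) :* b := (b :* v) :* m) refl (recip (1ℚ ℚ.+ B) 0<1+B) μ (1ℚ ℚ.+ B))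
        (trans (cong (ℚ._* μ) (*-recip (1ℚ ℚ.+ B) 0<1+B)) (ℚ.*-identityˡ μ))))
    g≤1 : g ℚ.≤ 1ℚ
    g≤1 = ℚ.≤-trans g≤μ (ℚ.p⊓q≤p 1ℚ l)
    g≤x : g ℚ.≤ x
    g≤x = ℚ.≤-trans g≤μ (ℚ.≤-trans (ℚ.p⊓q≤q 1ℚ l) l≤x)
    0≤x = ℚ.≤-trans (ℚ.<⇒≤ 0<l) l≤x
    upper : x ℚ.- 1ℚ ℚ.≤ r ℚ.* (1ℚ ℚ.+ x)
    upper = ≤-by ((1ℚ ℚ.- g) ℚ.+ 1ℚ) (ℚ.+-mono-≤ (0≤-diff g≤1) (ℚ.<⇒≤ 0<1))
      (solve 2 (λ x p → (con 1ℚ :- p) :* (con 1ℚ :+ x) :=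
        (x :- con 1ℚ) :+ ((con 1ℚ :- p :* (con 1ℚ :+ x)) :+ con 1ℚ)) refl x gap)
    lower : ℚ.- (r ℚ.* (1ℚ ℚ.+ x)) ℚ.≤ x ℚ.- 1ℚ
    lower = ≤-by ((x ℚ.- g) ℚ.+ x) (ℚ.+-mono-≤ (0≤-diff g≤x) 0≤x)
      (solve 2 (λ x p → x :- con 1ℚ :=
        (:- ((con 1ℚ :- p) :* (con 1ℚ :+ x))) :+ ((x :- p :* (con 1ℚ :+ x)) :+ x)) refl x gap)

cayley : (x : ℝ) → 0ℝ < x → ℝ
cayley x 0<x = (x - 1ℝ) / (1ℝ + x) ⟨ 0<1+ {x} 0<x ⟩

∣cayley∣<1 : ∀ x (0<x : 0ℝ < x) → ∣ cayley x 0<x ∣<1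
∣cayley∣<1 x 0<x@(l , 0<l , M , hM) =
  gap , 0<gap , M ℕ.⊔ N , λ i r → ∣z∣≤ i (proj₁ (lub₂ r)) (proj₂ (lub₂ {M} r))
  where
  B = proj₁ (bound x)
  0<B = proj₁ (proj₂ (bound x))
  N = proj₁ (proj₂ (proj₂ (bound x)))
  hB = proj₂ (proj₂ (proj₂ (bound x)))
  open Cayley l B 0<l 0<B
  ∣z∣≤ : ∀ i → M ℕ.≤ i → N ℕ.≤ i → ℚ.∣ seq (cayley x 0<x) i ∣ ℚ.≤ 1ℚ ℚ.- gap
  ∣z∣≤ i M≤i N≤i = contract (seq x i) (l ℚ.⊔ (1ℚ ℚ.+ seq x i)) (ℚ.<-≤-trans 0<l (ℚ.p≤p⊔q l (1ℚ ℚ.+ seq x i)))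
    (ℚ.p≤q⇒p⊔q≡q (ℚ.≤-trans l≤x (≤-by 1ℚ (ℚ.<⇒≤ 0<1) (ℚ.+-comm 1ℚ (seq x i)))))
    l≤x (ℚ.≤-trans (≤∣∣ (seq x i)) (hB i N≤i))
    where
    l≤x : l ℚ.≤ seq x i
    l≤x = subst (ℚ._≤ seq x i) (ℚ.+-identityˡ l) (hM i M≤i)

-- The natural logarithm, by log x = 2 artanh ((x - 1) / (x + 1)).
log : (x : ℝ) → 0ℝ < x → ℝ
log x 0<x = 2ℝ * artanh (cayley x 0<x) (∣cayley∣<1 x 0<x)

0<fromℚ : ∀ {q} → 0ℚ ℚ.< q → 0ℝ < fromℚ q
0<fromℚ {q} 0<q = q , 0<q , 0 , λ _ _ → ℚ.≤-reflexive (ℚ.+-identityˡ q)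

0<fromℕ : ∀ n .{{_ : ℕ.NonZero n}} → 0ℝ < fromℕ n
0<fromℕ (suc n) = 0<fromℚ {ι (suc n)} (0<ι n)

0<*ℝ : ∀ {x y} → 0ℝ < x → 0ℝ < y → 0ℝ < x * y
0<*ℝ {x} {y} (l , 0<l , M , h) (m , 0<m , N , k) = l ℚ.* m , 0<* 0<l 0<m , M ℕ.⊔ N , λ n r →
  subst (ℚ._≤ seq x n ℚ.* seq y n) (sym (ℚ.+-identityˡ (l ℚ.* m)))
    (*-mono {l} {seq x n} {m} {seq y n} (ℚ.<⇒≤ 0<l)
      (ℚ.≤-trans (ℚ.<⇒≤ 0<m) (m≤ n (proj₂ (lub₂ {M} r)))) (l≤ n (proj₁ (lub₂ r))) (m≤ n (proj₂ (lub₂ {M} r))))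
  where
  l≤ : ∀ n → M ℕ.≤ n → l ℚ.≤ seq x n
  l≤ n r = subst (ℚ._≤ seq x n) (ℚ.+-identityˡ l) (h n r)
  m≤ : ∀ n → N ℕ.≤ n → m ℚ.≤ seq y n
  m≤ n r = subst (ℚ._≤ seq y n) (ℚ.+-identityˡ m) (k n r)

0<inv : ∀ y (0<y : 0ℝ < y) → 0ℝ < inv y 0<y
0<inv y 0<y@(l , 0<l , _) = recip b 0<b , 0<recip b 0<b , N , λ n N≤n →
  subst (ℚ._≤ seq (inv y 0<y) n) (sym (ℚ.+-identityˡ (recip b 0<b)))
    (recip-anti (ℚ.<-≤-trans 0<l (ℚ.p≤p⊔q l (seq y n))) 0<b
      (ℚ.⊔-lub (ℚ.p≤p⊔q l B) (ℚ.≤-trans (ℚ.≤-trans (≤∣∣ (seq y n)) (hB n N≤n)) (ℚ.p≤q⊔p l B))))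
  where
  B = proj₁ (bound y)
  N = proj₁ (proj₂ (proj₂ (bound y)))
  hB = proj₂ (proj₂ (proj₂ (bound y)))
  b = l ℚ.⊔ B
  0<b : 0ℚ ℚ.< b
  0<b = ℚ.<-≤-trans 0<l (ℚ.p≤p⊔q l B)

0</ : ∀ {x y} → 0ℝ < x → (0<y : 0ℝ < y) → 0ℝ < x / y ⟨ 0<y ⟩
0</ {x} {y} 0<x 0<y = 0<*ℝ {x} {inv y 0<y} 0<x (0<inv y 0<y)

0<1/ : ∀ x (0<x : 0ℝ < x) → 0ℝ < 1ℝ / x ⟨ 0<x ⟩
0<1/ x 0<x = 0</ {1ℝ} {x} (0<fromℚ {1ℚ} 0<1) 0<x

<⇒0<- : ∀ {x y} → x < y → 0ℝ < y - x
<⇒0<- {x} {y} (ε , 0<ε , N , h) = ε , 0<ε , N , λ n N≤n →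
  subst (ℚ._≤ seq y n ℚ.- seq x n)
    (solve 2 (λ x e → (x :+ e) :- x := con 0ℚ :+ e) refl (seq x n) ε)
    (ℚ.+-monoˡ-≤ (ℚ.- seq x n) (h n N≤n))

1<y/x : ∀ {x y} (0<x : 0ℝ < x) → x < y → 1ℝ < y / x ⟨ 0<x ⟩
1<y/x {x} {y} 0<x@(l , 0<l , K , hl) (ε , 0<ε , N , h) = ε ℚ.* m , 0<* 0<ε 0<m , K ℕ.⊔ (N ℕ.⊔ L) , λ n r →
  let (K≤n , r') = lub₂ {K} {N ℕ.⊔ L} r
      (N≤n , L≤n) = lub₂ {N} {L} r'
  in step n K≤n N≤n L≤n
  where
  pos : ∀ n → 0ℚ ℚ.< l ℚ.⊔ seq x n
  pos n = ℚ.<-≤-trans 0<l (ℚ.p≤p⊔q l (seq x n))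
  m = proj₁ (0<inv x 0<x)
  0<m = proj₁ (proj₂ (0<inv x 0<x))
  L = proj₁ (proj₂ (proj₂ (0<inv x 0<x)))
  hm = proj₂ (proj₂ (proj₂ (0<inv x 0<x)))
  step : ∀ n → K ℕ.≤ n → N ℕ.≤ n → L ℕ.≤ n →
         1ℚ ℚ.+ ε ℚ.* m ℚ.≤ seq y n ℚ.* recip (l ℚ.⊔ seq x n) (pos n)
  step n K≤n N≤n L≤n = ℚ.≤-trans
    (ℚ.+-monoʳ-≤ 1ℚ (*-monoˡ {m} {u} {ε} (ℚ.<⇒≤ 0<ε) (subst (ℚ._≤ u) (ℚ.+-identityˡ m) (hm n L≤n))))
    (subst (ℚ._≤ seq y n ℚ.* u)
      (trans (ℚ.*-distribʳ-+ u (seq x n) ε) (cong (ℚ._+ ε ℚ.* u) xu≡1))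
      (*-monoʳ {seq x n ℚ.+ ε} {seq y n} {u} (ℚ.<⇒≤ (0<recip (l ℚ.⊔ seq x n) (pos n))) (h n N≤n)))
    where
    u = recip (l ℚ.⊔ seq x n) (pos n)
    xu≡1 : seq x n ℚ.* u ≡ 1ℚ
    xu≡1 = trans (cong (ℚ._* u) (sym (ℚ.p≤q⇒p⊔q≡q (subst (ℚ._≤ seq x n) (ℚ.+-identityˡ l) (hl n K≤n)))))
      (*-recip (l ℚ.⊔ seq x n) (pos n))

0<lim : ∀ s (s-cauchy : IsCauchyℝ s) e → 0ℚ ℚ.< e → (N : ℕ) →
  (∀ n → N ℕ.≤ n → ∃ λ I → ∀ i → I ℕ.≤ i → e ℚ.≤ seq (s n) i) → 0ℝ < lim s s-cauchy
0<lim s s-cauchy e 0<e N h = ½ ℚ.* e , 0<half 0<e , N ℕ.⊔ M , λ n r →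
  let (I , g) = h n (proj₁ (lub₂ r))
      i = I ℕ.⊔ diag s n
      (I≤ , d≤) = lub₂ {I} {diag s n} {i} ℕ.≤-refl
      near = ℚ.≤-trans (proj₂ (modulus s n) (diag s n) i ℕ.≤-refl d≤) (k n (proj₂ (lub₂ {N} r)))
  in step (seq (s n) (diag s n)) (seq (s n) i) near (g i I≤)
  where
  M = proj₁ (archimedean-recip (½ ℚ.* e) (0<half 0<e))
  k = proj₂ (archimedean-recip (½ ℚ.* e) (0<half 0<e))
  step : ∀ a b → ℚ.∣ a ℚ.- b ∣ ℚ.≤ ½ ℚ.* e → e ℚ.≤ b → 0ℚ ℚ.+ ½ ℚ.* e ℚ.≤ a
  step a b near e≤b = subst₂ ℚ._≤_
    (solve 1 (λ e → e :- con ½ :* e := con 0ℚ :+ con ½ :* e) refl e)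
    (solve 2 (λ a h → (a :+ h) :- h := a) refl a (½ ℚ.* e))
    (ℚ.+-monoˡ-≤ (ℚ.- (½ ℚ.* e)) (ℚ.≤-trans e≤b (close-≥ {a} {b} near)))

0<artanh : ∀ z (∣z∣<1 : ∣ z ∣<1) → 0ℝ < z → 0ℝ < artanh z ∣z∣<1
0<artanh z ∣z∣<1 (e , 0<e , N , h) =
  0<lim (partialSum (artanhTerm z)) (artanhTerm-cauchy z ∣z∣<1) e 0<e 1
    λ { (suc n) _ → N , λ i N≤i → partial≥ i N≤i n }
  where
  module _ (i : ℕ) (N≤i : N ℕ.≤ i) where
    e≤z : e ℚ.≤ seq z i
    e≤z = subst (ℚ._≤ seq z i) (ℚ.+-identityˡ e) (h i N≤i)
    0≤z = ℚ.≤-trans (ℚ.<⇒≤ 0<e) e≤z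
    0≤pow : ∀ k → 0ℚ ℚ.≤ seq ((z * z) ^ k) i
    0≤pow zero = ℚ.<⇒≤ 0<1
    0≤pow (suc k) = 0≤* {seq z i ℚ.* seq z i} {seq ((z * z) ^ k) i} (0≤* 0≤z 0≤z) (0≤pow k)
    0≤term : ∀ k → 0ℚ ℚ.≤ seq (artanhTerm z k) i
    0≤term k = 0≤* {seq z i ℚ.* seq ((z * z) ^ k) i} {+ 1 ℚ./ suc (2 ℕ.* k)}
      (0≤* {seq z i} {seq ((z * z) ^ k) i} 0≤z (0≤pow k))
      (ℚ.nonNegative⁻¹ _ {{ℚ.normalize-nonNeg 1 (suc (2 ℕ.* k))}})
    partial≥ : ∀ n → e ℚ.≤ seq (partialSum (artanhTerm z) (suc n)) i
    partial≥ zero = ℚ.≤-trans e≤z (ℚ.≤-reflexive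
      (solve 1 (λ z → z := con 0ℚ :+ (z :* con 1ℚ) :* con 1ℚ) refl (seq z i)))
    partial≥ (suc n) = ℚ.≤-trans (partial≥ n)
      (≤-by (seq (artanhTerm z (suc n)) i) (0≤term (suc n)) refl)

0<2 : 0ℝ < 2ℝ
0<2 = 0<fromℕ 2

0<cayley : ∀ {x} (0<x : 0ℝ < x) → 1ℝ < x → 0ℝ < cayley x 0<x
0<cayley {x} 0<x 1<x = 0</ {x - 1ℝ} {1ℝ + x} (<⇒0<- {1ℝ} {x} 1<x) (0<1+ {x} 0<x)

0<log : ∀ {x} (0<x : 0ℝ < x) → 1ℝ < x → 0ℝ < log x 0<x
0<log {x} 0<x 1<x = 0<*ℝ {2ℝ} {artanh (cayley x 0<x) (∣cayley∣<1 x 0<x)} 0<2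
  (0<artanh (cayley x 0<x) (∣cayley∣<1 x 0<x) (0<cayley {x} 0<x 1<x))

0<log2 : 0ℝ < log 2ℝ 0<2
0<log2 = 0<log {2ℝ} 0<2 (1ℚ , 0<1 , 0 , λ _ _ → ℚ.≤-refl)

log₂ : (x : ℝ) → 0ℝ < x → ℝ
log₂ x 0<x = log x 0<x / log 2ℝ 0<2 ⟨ 0<log2 ⟩

½ℝ : ℝ
½ℝ = fromℚ ½

module _ {p : ℝ} (p<½ : p < ½ℝ) where

  private
    ε = proj₁ p<½
    0≤ε = ℚ.<⇒≤ (proj₁ (proj₂ p<½))
    gap≥ : ∀ n → proj₁ (proj₂ (proj₂ p<½)) ℕ.≤ n → ε ℚ.≤ ½ ℚ.- seq p n
    gap≥ n N≤n = subst (ℚ._≤ ½ ℚ.- seq p n)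
      (solve 2 (λ x e → (x :+ e) :- x := e) refl (seq p n) ε)
      (ℚ.+-monoˡ-≤ (ℚ.- seq p n) (proj₂ (proj₂ (proj₂ p<½)) n N≤n))

  p<1-p : p < 1ℝ - p
  p<1-p = ε , proj₁ (proj₂ p<½) , proj₁ (proj₂ (proj₂ p<½)) , λ n N≤n →
    ≤-by ((½ ℚ.- seq p n ℚ.- ε) ℚ.+ (½ ℚ.- seq p n))
      (ℚ.+-mono-≤ (0≤-diff (gap≥ n N≤n)) (ℚ.≤-trans 0≤ε (gap≥ n N≤n)))
      (solve 2 (λ p e → con 1ℚ :- p := (p :+ e) :+ ((con ½ :- p :- e) :+ (con ½ :- p))) refl (seq p n) ε)

  0<1-p : 0ℝ < 1ℝ - p
  0<1-p = ε , proj₁ (proj₂ p<½) , proj₁ (proj₂ (proj₂ p<½)) , λ n N≤n →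
    ≤-by ((½ ℚ.- seq p n ℚ.- ε) ℚ.+ ½)
      (ℚ.+-mono-≤ (0≤-diff (gap≥ n N≤n)) (ℚ.<⇒≤ 0<½))
      (solve 2 (λ p e → con 1ℚ :- p := (con 0ℚ :+ e) :+ ((con ½ :- p :- e) :+ con ½)) refl (seq p n) ε)

  0<1-2p : 0ℝ < 1ℝ - 2ℝ * p
  0<1-2p = ε , proj₁ (proj₂ p<½) , proj₁ (proj₂ (proj₂ p<½)) , λ n N≤n →
    ≤-by ((½ ℚ.- seq p n ℚ.- ε) ℚ.+ (½ ℚ.- seq p n))
      (ℚ.+-mono-≤ (0≤-diff (gap≥ n N≤n)) (ℚ.≤-trans 0≤ε (gap≥ n N≤n)))
      (solve 2 (λ p e → con 1ℚ :- con (ι 2) :* p := (con 0ℚ :+ e) :+ ((con ½ :- p :- e) :+ (con ½ :- p))) refl (seq p n) ε)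

-- Binary entropy in bits.
H : (p : ℝ) → 0ℝ < p → p < ½ℝ → ℝ
H p 0<p p<½ = - (p * log₂ p 0<p) - (1ℝ - p) * log₂ (1ℝ - p) (0<1-p {p} p<½)

odds : (p : ℝ) → 0ℝ < p → ℝ
odds p 0<p = (1ℝ - p) / p ⟨ 0<p ⟩

0<odds : ∀ p 0<p → p < ½ℝ → 0ℝ < odds p 0<p
0<odds p 0<p p<½ = 0</ {1ℝ - p} {p} (0<1-p {p} p<½) 0<p

1<odds : ∀ p 0<p → p < ½ℝ → 1ℝ < odds p 0<p
1<odds p 0<p p<½ = 1<y/x {p} {1ℝ - p} 0<p (p<1-p {p} p<½)

-- The Kullback–Leibler divergence, in nats, between Bernoulli(p) and Bernoulli(1-p).
D-KL : (p : ℝ) → 0ℝ < p → p < ½ℝ → ℝ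
D-KL p 0<p p<½ = (1ℝ - 2ℝ * p) * log (odds p 0<p) (0<odds p 0<p p<½)

0<D-KL : ∀ p 0<p p<½ → 0ℝ < D-KL p 0<p p<½
0<D-KL p 0<p p<½ = 0<*ℝ {1ℝ - 2ℝ * p} {log (odds p 0<p) (0<odds p 0<p p<½)} (0<1-2p {p} p<½)
  (0<log {odds p 0<p} (0<odds p 0<p p<½) (1<odds p 0<p p<½))

∑Fin : ∀ {n} → (Fin n → ℝ) → ℝ
∑Fin = Functional.foldr _+_ 0ℝ

∑Bool : (Bool → ℝ) → ℝ
∑Bool f = f false + f true

record Distribution {A : Set} (∑ : (A → ℝ) → ℝ) : Set where
  field
    prob     : A → ℝ
    prob-≥0  : ∀ a → 0ℝ ≤ prob a
    prob-sum : ∑ prob ≃ 1ℝ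

open Distribution public

-- An algorithm with T queries, as a decision tree: the node reached after some
-- rounds is determined by the past queries and observations, and carries the
-- conditional distribution, given that history, of the next index queried or,
-- after T rounds, of the output.
Algorithm : ℕ → ℕ → Set
Algorithm K zero    = Distribution ∑Bool
Algorithm K (suc T) = Distribution (∑Fin {K}) × (Fin K → Bool → Algorithm K T)

OR : ∀ {K} → Vec Bool K → Bool
OR = foldr′ _∨_ false

-- Probability that the binary symmetric channel with flip probability p outputs y on input x.
bsc : ℝ → Bool → Bool → ℝ
bsc p x y = if does (x Bool.≟ y) then 1ℝ - p else p

-- Probability that the output is b when the truth is θ.
outputProb : ∀ {K} T → ℝ → Vec Bool K → Algorithm K T → Bool → ℝ
outputProb zero    p θ output         b = prob output b
outputProb (suc T) p θ (query , next) b =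
  ∑Fin λ k → prob query k * ∑Bool λ y → bsc p (lookup θ k) y * outputProb T p θ (next k y) b

errorProb : ∀ {K} T → ℝ → Algorithm K T → Vec Bool K → ℝ
errorProb T p μ θ = ∑Bool λ b → if does (b Bool.≟ OR θ) then 0ℝ else outputProb T p θ μ b

-- The supremum over the finite set {0,1}ᴷ.
supBits : ∀ {K} → (Vec Bool K → ℝ) → ℝ
supBits {zero}  f = f []
supBits {suc K} f = supBits (λ θ → f (false ∷ θ)) ⊔ supBits (λ θ → f (true ∷ θ))

{-# OPTIONS --safe #-}
-- Compare the all-zero sequence with the sequences having a single one at index k.
-- Along the decision tree the two error probabilities, the second weighted by the
-- likelihood ratio eˣ, dominate any potential φ ≤ min(1, eˣ) that an informative query
-- lowers by at most d on average, up to d times the expected number of queries of k under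
-- the all-zero sequence; these numbers add up to T over k.  Linearising the
-- Bretagnolle–Huber inequality gives a potential with d = ½ exp (− T D / K) D, hence the
-- minimax bound.  A second potential, of Vincze–Le Cam type, has d = 50 (1 − 2p)² and
-- forces T ≥ K / (5000 (1 − 2p)²) as soon as the error is below 0.49.  The rest follows
-- from (1 − 2p)² ≤ 8 (1 − H), (1 − 2p)² ≤ D and log (1/δ) ≤ T D / K + 3.
-- Analysis enters only through exp (x + y) = exp x exp y, exp x ≥ 1 + x and
-- exp (log x) = x, each obtained from second-order increment bounds on power series.

module Submission where

open import Algebra.Bundles using (CommutativeRing)
open import Algebra.Solver.Ring.AlmostCommutativeRing
  using (_-Raw-AlmostCommutative⟶_; fromCommutativeRing)
import Algebra.Solver.Ring as RingSolver
open import Data.Bool.Base using (Bool; true; false; not; if_then_else_)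
import Data.Bool.Properties as Bool
open import Data.Fin.Base using (Fin; zero; suc)
import Data.Fin.Properties as Fin
open import Data.Vec.Base using (Vec; _∷_; []; lookup; replicate; _[_]≔_)
import Data.Vec.Properties as Vec
open import Data.Maybe.Base using (Maybe; just; nothing)
open import Data.Nat.Base as ℕ using (ℕ; zero; suc; NonZero)
import Data.Nat.Properties as ℕ
open import Data.Integer.Base as ℤ using (+_)
open import Data.Rational.Base as ℚ using (ℚ; 0ℚ; 1ℚ; ½; _/_)
import Data.Rational.Properties as ℚ
open import Data.Rational.Solver using (module +-*-Solver)
open import Data.Product.Base using (∃; _×_; _,_; proj₁; proj₂; Σ-syntax; ∃-syntax)
open import Data.Sum.Base using (_⊎_; inj₁; inj₂)
open import Level using (0ℓ)
open import Relation.Binary.Bundles using (Poset)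
open import Relation.Binary.PropositionalEquality
  using (_≡_; refl; sym; trans; cong; cong₂; subst; subst₂)
open import Relation.Nullary.Decidable.Core using (Dec; yes; no; does)
open import Relation.Nullary.Decidable using (dec-true; dec-false)
open import Defs
open ℚ-Lemmas

-- Two regimes force two potentials. As p → 0 the divergence D grows without bound while 1 - H tends
-- to 1, so the exponential bound cannot show that T is at least of order K; it is also vacuous for
-- δ ≥ 1/4. The second potential charges an informative query only a multiple of (1 - 2p)², bounded
-- in p, and starts at 0.99, just above 2 · 0.49. Working with potentials removes distributions on
-- transcripts: the chain rule for the divergence, the convexity step and the search for a rarely
-- queried index shrink to an induction over the tree and a sum over k, because the charge is linear
-- in the expected number of queries. The reals are constructive, so there is no case distinction on
-- eˣ ≤ 1 or on a sign. Hence the smooth minorants of min(1, eˣ), and inequalities proved by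
-- exhibiting their slack as an explicitly nonnegative expression. Calculus is treated alike: a
-- vanishing derivative means an increment bounded by a constant times the square of the step.

infix 4 _≼_ _≈_
infixl 6 _⊕_ _⊝_
infixl 7 _⊛_
infix 8 ⊖_

-- The operations of Defs unfold to Cauchy sequences, which defeats unification;
-- these opaque copies do not.
opaque
  _⊕_ _⊛_ : ℝ → ℝ → ℝ
  _⊕_ = _+_
  _⊛_ = _*_

  ⊖_ ∣_∣ : ℝ → ℝ
  ⊖_ = -_
  ∣ x ∣ = x ⊔ (- x)

  ⌜_⌝ : ℚ → ℝ
  ⌜_⌝ = fromℚ

  _≼_ _≈_ : ℝ → ℝ → Set
  _≼_ = _≤_
  _≈_ = _≃_

-- Order and ring structure of the reals

_⊝_ : ℝ → ℝ → ℝ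
x ⊝ y = x ⊕ ⊖ y

opaque
  unfolding _≼_

  pointwise-≼ : ∀ {x y} → (∀ n → seq x n ℚ.≤ seq y n) → x ≼ y
  pointwise-≼ h ε 0<ε = 0 , λ n _ → ℚ.≤-trans (h n) (≤-by ε (ℚ.<⇒≤ 0<ε) refl)

  pointwise-≈ : ∀ {x y} → (∀ n → seq x n ≡ seq y n) → x ≈ y
  pointwise-≈ {x} {y} h =
    pointwise-≼ {x} {y} (λ n → ℚ.≤-reflexive (h n)) , pointwise-≼ {y} {x} (λ n → ℚ.≤-reflexive (sym (h n)))

  ≼-antisym : ∀ {x y} → x ≼ y → y ≼ x → x ≈ y
  ≼-antisym p q = p , q

  ≈⇒≼ : ∀ {x y} → x ≈ y → x ≼ y
  ≈⇒≼ = proj₁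

  ≈-sym : ∀ {x y} → x ≈ y → y ≈ x
  ≈-sym (p , q) = q , p

  ≼-trans : ∀ {x y z} → x ≼ y → y ≼ z → x ≼ z
  ≼-trans {x} {y} {z} p q ε 0<ε =
    let (M , h) = p (½ ℚ.* ε) (0<half 0<ε)
        (N , k) = q (½ ℚ.* ε) (0<half 0<ε)
    in M ℕ.⊔ N , λ n r → ℚ.≤-trans (h n (proj₁ (lub₂ r)))
         (ℚ.≤-trans (ℚ.+-monoˡ-≤ (½ ℚ.* ε) (k n (proj₂ (lub₂ {M} r))))
           (ℚ.≤-reflexive (trans (ℚ.+-assoc (seq z n) (½ ℚ.* ε) (½ ℚ.* ε))
             (cong (seq z n ℚ.+_) (half+half ε)))))

≈-refl : ∀ {x} → x ≈ x
≈-refl {x} = pointwise-≈ {x} (λ _ → refl)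

≼-refl : ∀ {x} → x ≼ x
≼-refl = ≈⇒≼ ≈-refl

≈-trans : ∀ {x y z} → x ≈ y → y ≈ z → x ≈ z
≈-trans p q = ≼-antisym (≼-trans (≈⇒≼ p) (≈⇒≼ q)) (≼-trans (≈⇒≼ (≈-sym q)) (≈⇒≼ (≈-sym p)))

≡⇒≈ : ∀ {x y} → x ≡ y → x ≈ y
≡⇒≈ refl = ≈-refl

≼-respʳ : ∀ {x y z} → y ≈ z → x ≼ y → x ≼ z
≼-respʳ e p = ≼-trans p (≈⇒≼ e)

≼-respˡ : ∀ {x y z} → x ≈ z → x ≼ y → z ≼ y
≼-respˡ e p = ≼-trans (≈⇒≼ (≈-sym e)) p

≼-poset : Poset 0ℓ 0ℓ 0ℓ
≼-poset = record
  { Carrier = ℝ ; _≈_ = _≈_ ; _≤_ = _≼_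
  ; isPartialOrder = record
    { isPreorder = record
      { isEquivalence = record { refl = ≈-refl ; sym = ≈-sym ; trans = ≈-trans }
      ; reflexive = ≈⇒≼
      ; trans = ≼-trans }
    ; antisym = ≼-antisym } }

open import Relation.Binary.Reasoning.PartialOrder ≼-poset

opaque
  unfolding _⊕_

  ⊕-mono : ∀ {x y u v} → x ≼ y → u ≼ v → x ⊕ u ≼ y ⊕ v
  ⊕-mono {x} {y} {u} {v} p q ε 0<ε =
    let (M , h) = p (½ ℚ.* ε) (0<half 0<ε)
        (N , k) = q (½ ℚ.* ε) (0<half 0<ε)
    in M ℕ.⊔ N , λ n r → ℚ.≤-trans (ℚ.+-mono-≤ (h n (proj₁ (lub₂ r))) (k n (proj₂ (lub₂ {M} r))))
         (ℚ.≤-reflexive (trans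
           (solve 3 (λ y v e → (y :+ e) :+ (v :+ e) := (y :+ v) :+ (e :+ e)) refl (seq y n) (seq v n) (½ ℚ.* ε))
           (cong ((seq y n ℚ.+ seq v n) ℚ.+_) (half+half ε))))
    where open +-*-Solver

  ⊖-anti : ∀ {x y} → x ≼ y → ⊖ y ≼ ⊖ x
  ⊖-anti {x} {y} p ε 0<ε = let (M , h) = p ε 0<ε in M , λ n r →
    subst₂ ℚ._≤_
      (solve 3 (λ x y e → x :+ (:- x :- y) := :- y) refl (seq x n) (seq y n) ε)
      (solve 3 (λ x y e → (y :+ e) :+ (:- x :- y) := :- x :+ e) refl (seq x n) (seq y n) ε)
      (ℚ.+-monoˡ-≤ (ℚ.- seq x n ℚ.- seq y n) (h n r))
    where open +-*-Solver

  ⌜⌝-mono : ∀ {p q} → p ℚ.≤ q → ⌜ p ⌝ ≼ ⌜ q ⌝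
  ⌜⌝-mono {p} {q} h = pointwise-≼ {⌜ p ⌝} {⌜ q ⌝} (λ _ → h)

  -- Terms a and b of nonnegative reals are only known to be at least -d. From (a + d)(b + d) ≥ 0
  -- follows ab ≥ -d(a + b + d) ≥ -d(A + B + 1) when d ≤ 1, so d is the smaller of ε / (1 + A + B)
  -- and 1.
  ⊛-nonneg : ∀ {x y} → ⌜ 0ℚ ⌝ ≼ x → ⌜ 0ℚ ⌝ ≼ y → ⌜ 0ℚ ⌝ ≼ x ⊛ y
  ⊛-nonneg {x} {y} p q ε 0<ε =
    let (A , 0<A , K , hA) = bound x
        (B , 0<B , L , hB) = bound y
        C = (1ℚ ℚ.+ A) ℚ.+ B
        0<C = 0<+ (0<+ 0<1 0<A) 0<B
        w = recip C 0<C
        0<w = 0<recip C 0<C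
        d = (w ℚ.* ε) ℚ.⊓ 1ℚ
        0<d = pos⊓ (0<* 0<w 0<ε)
        (M , h) = p d 0<d
        (N , k) = q d 0<d
    in (K ℕ.⊔ L) ℕ.⊔ (M ℕ.⊔ N) , λ n r →
      let (r₁ , r₂) = lub₂ {K ℕ.⊔ L} {M ℕ.⊔ N} r
          a = seq x n ; b = seq y n
          a≤A = ℚ.≤-trans (≤∣∣ a) (hA n (proj₁ (lub₂ r₁)))
          b≤B = ℚ.≤-trans (≤∣∣ b) (hB n (proj₂ (lub₂ {K} r₁)))
          Cd≤ε : C ℚ.* d ℚ.≤ ε
          Cd≤ε = ℚ.≤-trans (*-monoˡ {d} {w ℚ.* ε} {C} (ℚ.<⇒≤ 0<C) (ℚ.p⊓q≤p (w ℚ.* ε) 1ℚ))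
            (ℚ.≤-reflexive (trans (sym (ℚ.*-assoc C w ε))
              (trans (cong (ℚ._* ε) (*-recip C 0<C)) (ℚ.*-identityˡ ε))))
          0≤d = ℚ.<⇒≤ 0<d
      in ≤-by ((a ℚ.+ d) ℚ.* (b ℚ.+ d) ℚ.+ (d ℚ.* (A ℚ.- a) ℚ.+ (d ℚ.* (B ℚ.- b)
              ℚ.+ (d ℚ.* (1ℚ ℚ.- d) ℚ.+ (ε ℚ.- C ℚ.* d)))))
        (ℚ.+-mono-≤ (0≤* (h n (proj₁ (lub₂ r₂))) (k n (proj₂ (lub₂ {M} r₂))))
          (ℚ.+-mono-≤ (0≤* 0≤d (0≤-diff a≤A)) (ℚ.+-mono-≤ (0≤* 0≤d (0≤-diff b≤B))
            (ℚ.+-mono-≤ (0≤* 0≤d (0≤-diff (ℚ.p⊓q≤q (w ℚ.* ε) 1ℚ))) (0≤-diff Cd≤ε)))))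
        (solve 6 (λ a b A B d e → a :* b :+ e := con 0ℚ :+ ((a :+ d) :* (b :+ d) :+ (d :* (A :- a)
           :+ (d :* (B :- b) :+ (d :* (con 1ℚ :- d) :+ (e :- ((con 1ℚ :+ A) :+ B) :* d))))))
          refl a b A B d ε)
    where
    open +-*-Solver
    pos⊓ : ∀ {a} → 0ℚ ℚ.< a → 0ℚ ℚ.< a ℚ.⊓ 1ℚ
    pos⊓ {a} 0<a with ℚ.≤-total a 1ℚ
    ... | inj₁ p = subst (0ℚ ℚ.<_) (sym (ℚ.p≤q⇒p⊓q≡p p)) 0<a
    ... | inj₂ p = subst (0ℚ ℚ.<_) (sym (ℚ.p≥q⇒p⊓q≡q p)) 0<1

⊕-cong : ∀ {x y u v} → x ≈ y → u ≈ v → x ⊕ u ≈ y ⊕ v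
⊕-cong p q = ≼-antisym (⊕-mono (≈⇒≼ p) (≈⇒≼ q)) (⊕-mono (≈⇒≼ (≈-sym p)) (≈⇒≼ (≈-sym q)))

⊖-cong : ∀ {x y} → x ≈ y → ⊖ x ≈ ⊖ y
⊖-cong p = ≼-antisym (⊖-anti (≈⇒≼ (≈-sym p))) (⊖-anti (≈⇒≼ p))

opaque
  unfolding _⊕_

  private
    eventual-bound : ∀ y → ∃ λ B → ⌜ 0ℚ ⌝ ≼ ⌜ B ⌝ × ⌜ 0ℚ ⌝ ≼ y ⊕ ⌜ B ⌝
    eventual-bound y = let (B , 0<B , N , h) = bound y in
      B , ⌜⌝-mono (ℚ.<⇒≤ 0<B) , λ ε 0<ε → N , λ n r →
        ≤-by ((B ℚ.- ℚ.- seq y n) ℚ.+ ε)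
          (ℚ.+-mono-≤ (0≤-diff (ℚ.≤-trans (≤∣∣ (ℚ.- seq y n)) (ℚ.≤-trans (ℚ.≤-reflexive (ℚ.∣-p∣≡∣p∣ (seq y n))) (h n r)))) (ℚ.<⇒≤ 0<ε))
          (solve 3 (λ y b e → (y :+ b) :+ e := con 0ℚ :+ ((b :- :- y) :+ e)) refl (seq y n) B ε)
      where open +-*-Solver

    ⊕-identityˡ : ∀ x → ⌜ 0ℚ ⌝ ⊕ x ≈ x
    ⊕-identityˡ x = pointwise-≈ {⌜ 0ℚ ⌝ ⊕ x} {x} (λ n → ℚ.+-identityˡ (seq x n))

    ⊛-comm : ∀ x y → x ⊛ y ≈ y ⊛ x
    ⊛-comm x y = pointwise-≈ {x ⊛ y} {y ⊛ x} (λ n → ℚ.*-comm (seq x n) (seq y n))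

    ⊛-≼-split : ∀ x x' y z → (x' ⊕ ⊖ x) ⊛ (y ⊕ z) ⊕ (x ⊛ y ⊕ x ⊛ z) ≈ x' ⊛ y ⊕ x' ⊛ z
    ⊛-≼-split x x' y z = pointwise-≈ {(x' ⊕ ⊖ x) ⊛ (y ⊕ z) ⊕ (x ⊛ y ⊕ x ⊛ z)} {x' ⊛ y ⊕ x' ⊛ z} λ n →
      solve 4 (λ x x' y z → (x' :- x) :* (y :+ z) :+ (x :* y :+ x :* z) := x' :* y :+ x' :* z) refl
        (seq x n) (seq x' n) (seq y n) (seq z n)
      where open +-*-Solver

    ⊕-assoc : ∀ x y z → (x ⊕ y) ⊕ z ≈ x ⊕ (y ⊕ z)
    ⊕-assoc x y z = pointwise-≈ {(x ⊕ y) ⊕ z} {x ⊕ (y ⊕ z)} (λ n → ℚ.+-assoc (seq x n) (seq y n) (seq z n))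

    ⊕-comm : ∀ x y → x ⊕ y ≈ y ⊕ x
    ⊕-comm x y = pointwise-≈ {x ⊕ y} {y ⊕ x} (λ n → ℚ.+-comm (seq x n) (seq y n))

    ⊕-inverseˡ : ∀ x → ⊖ x ⊕ x ≈ ⌜ 0ℚ ⌝
    ⊕-inverseˡ x = pointwise-≈ {⊖ x ⊕ x} {⌜ 0ℚ ⌝} (λ n → ℚ.+-inverseˡ (seq x n))

    ⊛-assoc : ∀ x y z → (x ⊛ y) ⊛ z ≈ x ⊛ (y ⊛ z)
    ⊛-assoc x y z = pointwise-≈ {(x ⊛ y) ⊛ z} {x ⊛ (y ⊛ z)} (λ n → ℚ.*-assoc (seq x n) (seq y n) (seq z n))

    ⊛-identityˡ : ∀ x → ⌜ 1ℚ ⌝ ⊛ x ≈ x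
    ⊛-identityˡ x = pointwise-≈ {⌜ 1ℚ ⌝ ⊛ x} {x} (λ n → ℚ.*-identityˡ (seq x n))

    ⊛-distribˡ : ∀ x y z → x ⊛ (y ⊕ z) ≈ x ⊛ y ⊕ x ⊛ z
    ⊛-distribˡ x y z = pointwise-≈ {x ⊛ (y ⊕ z)} {x ⊛ y ⊕ x ⊛ z} (λ n → ℚ.*-distribˡ-+ (seq x n) (seq y n) (seq z n))

  ⌜⌝-+ : ∀ p q → ⌜ p ℚ.+ q ⌝ ≈ ⌜ p ⌝ ⊕ ⌜ q ⌝
  ⌜⌝-+ p q = pointwise-≈ {⌜ p ℚ.+ q ⌝} {⌜ p ⌝ ⊕ ⌜ q ⌝} (λ _ → refl)

  ⌜⌝-* : ∀ p q → ⌜ p ℚ.* q ⌝ ≈ ⌜ p ⌝ ⊛ ⌜ q ⌝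
  ⌜⌝-* p q = pointwise-≈ {⌜ p ℚ.* q ⌝} {⌜ p ⌝ ⊛ ⌜ q ⌝} (λ _ → refl)

  ⌜⌝-neg : ∀ p → ⌜ ℚ.- p ⌝ ≈ ⊖ ⌜ p ⌝
  ⌜⌝-neg p = pointwise-≈ {⌜ ℚ.- p ⌝} {⊖ ⌜ p ⌝} (λ _ → refl)

private
  ⊕-identityʳ : ∀ x → x ⊕ ⌜ 0ℚ ⌝ ≈ x
  ⊕-identityʳ x = ≈-trans (⊕-comm x ⌜ 0ℚ ⌝) (⊕-identityˡ x)

  ⊕-inverseʳ : ∀ x → x ⊕ ⊖ x ≈ ⌜ 0ℚ ⌝
  ⊕-inverseʳ x = ≈-trans (⊕-comm x (⊖ x)) (⊕-inverseˡ x)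

  ⊕-cancelʳ-≼ : ∀ {x y} z → x ⊕ z ≼ y ⊕ z → x ≼ y
  ⊕-cancelʳ-≼ {x} {y} z h = begin
    x            ≈⟨ ⊕-identityʳ x ⟨
    x ⊕ ⌜ 0ℚ ⌝    ≈⟨ ⊕-cong ≈-refl (⊕-inverseʳ z) ⟨
    x ⊕ (z ⊕ ⊖ z) ≈⟨ ⊕-assoc x z (⊖ z) ⟨
    (x ⊕ z) ⊕ ⊖ z ≤⟨ ⊕-mono h ≼-refl ⟩
    (y ⊕ z) ⊕ ⊖ z ≈⟨ ⊕-assoc y z (⊖ z) ⟩
    y ⊕ (z ⊕ ⊖ z) ≈⟨ ⊕-cong ≈-refl (⊕-inverseʳ z) ⟩
    y ⊕ ⌜ 0ℚ ⌝    ≈⟨ ⊕-identityʳ y ⟩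
    y            ∎

  -- Both sides stay expanded: rewriting inside a factor would use the congruence of `_⊛_`, which
  -- this inequality serves to prove.
  ⊛-sum-mono : ∀ {x x' y z} → x ≼ x' → ⌜ 0ℚ ⌝ ≼ y ⊕ z → x ⊛ y ⊕ x ⊛ z ≼ x' ⊛ y ⊕ x' ⊛ z
  ⊛-sum-mono {x} {x'} {y} {z} p q = begin
    x ⊛ y ⊕ x ⊛ z                               ≈⟨ ⊕-identityˡ _ ⟨
    ⌜ 0ℚ ⌝ ⊕ (x ⊛ y ⊕ x ⊛ z)                    ≤⟨ ⊕-mono (⊛-nonneg (≼-respˡ (⊕-inverseʳ x) (⊕-mono p ≼-refl)) q) ≼-refl ⟩
    (x' ⊕ ⊖ x) ⊛ (y ⊕ z) ⊕ (x ⊛ y ⊕ x ⊛ z)       ≈⟨ ⊛-≼-split x x' y z ⟩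
    x' ⊛ y ⊕ x' ⊛ z                             ∎

  -- Monotonicity in a factor y ⊕ ⌜ B ⌝ ≽ 0 and in the factor ⌜ B ⌝ gives the congruence for y.
  ⊛-congʳ : ∀ {x x'} y → x ≈ x' → x ⊛ y ≼ x' ⊛ y
  ⊛-congʳ {x} {x'} y e with eventual-bound y
  ... | B , 0≼B , 0≼y+B = ⊕-cancelʳ-≼ (x' ⊛ ⌜ B ⌝) (begin
    x ⊛ y ⊕ x' ⊛ ⌜ B ⌝  ≤⟨ ⊕-mono ≼-refl x'B≼xB ⟩
    x ⊛ y ⊕ x ⊛ ⌜ B ⌝   ≤⟨ ⊛-sum-mono (≈⇒≼ e) 0≼y+B ⟩
    x' ⊛ y ⊕ x' ⊛ ⌜ B ⌝ ∎)
    where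
    x'B≼xB : x' ⊛ ⌜ B ⌝ ≼ x ⊛ ⌜ B ⌝
    x'B≼xB = begin
      x' ⊛ ⌜ B ⌝               ≈⟨ zeroed x' ⟨
      x' ⊛ ⌜ B ⌝ ⊕ x' ⊛ ⌜ 0ℚ ⌝ ≤⟨ ⊛-sum-mono (≈⇒≼ (≈-sym e)) (≼-respʳ (≈-sym (⊕-identityʳ ⌜ B ⌝)) 0≼B) ⟩
      x ⊛ ⌜ B ⌝ ⊕ x ⊛ ⌜ 0ℚ ⌝   ≈⟨ zeroed x ⟩
      x ⊛ ⌜ B ⌝                ∎
      where
      opaque
        unfolding _⊕_
        zeroed : ∀ x → x ⊛ ⌜ B ⌝ ⊕ x ⊛ ⌜ 0ℚ ⌝ ≈ x ⊛ ⌜ B ⌝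
        zeroed x = pointwise-≈ {x ⊛ ⌜ B ⌝ ⊕ x ⊛ ⌜ 0ℚ ⌝} {x ⊛ ⌜ B ⌝} λ n →
          solve 2 (λ x b → x :* b :+ x :* con 0ℚ := x :* b) refl (seq x n) B
          where open +-*-Solver

⊛-cong : ∀ {x y u v} → x ≈ y → u ≈ v → x ⊛ u ≈ y ⊛ v
⊛-cong {x} {y} {u} {v} p q = ≈-trans
  (≼-antisym (⊛-congʳ u p) (⊛-congʳ u (≈-sym p)))
  (≈-trans (⊛-comm y u) (≈-trans (≼-antisym (⊛-congʳ y q) (⊛-congʳ y (≈-sym q))) (⊛-comm v y)))

ℝ-commutativeRing : CommutativeRing 0ℓ 0ℓ
ℝ-commutativeRing = record
  { Carrier = ℝ ; _≈_ = _≈_ ; _+_ = _⊕_ ; _*_ = _⊛_ ; -_ = ⊖_ ; 0# = ⌜ 0ℚ ⌝ ; 1# = ⌜ 1ℚ ⌝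
  ; isCommutativeRing = record
    { isRing = record
      { +-isAbelianGroup = record
        { isGroup = record
          { isMonoid = record
            { isSemigroup = record
              { isMagma = record
                { isEquivalence = record { refl = ≈-refl ; sym = ≈-sym ; trans = ≈-trans }
                ; ∙-cong = ⊕-cong }
              ; assoc = ⊕-assoc }
            ; identity = ⊕-identityˡ , ⊕-identityʳ }
          ; inverse = ⊕-inverseˡ , ⊕-inverseʳ
          ; ⁻¹-cong = ⊖-cong }
        ; comm = ⊕-comm }
      ; *-cong = ⊛-cong
      ; *-assoc = ⊛-assoc
      ; *-identity = ⊛-identityˡ , λ x → ≈-trans (⊛-comm x ⌜ 1ℚ ⌝) (⊛-identityˡ x)
      ; distrib = ⊛-distribˡ , λ x y z → ≈-trans (⊛-comm (y ⊕ z) x)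
          (≈-trans (⊛-distribˡ x y z) (⊕-cong (⊛-comm x y) (⊛-comm x z))) }
    ; *-comm = ⊛-comm } }

ℚ→ℝ : CommutativeRing.rawRing ℚ.+-*-commutativeRing -Raw-AlmostCommutative⟶ fromCommutativeRing ℝ-commutativeRing
ℚ→ℝ = record
  { ⟦_⟧ = ⌜_⌝ ; +-homo = ⌜⌝-+ ; *-homo = ⌜⌝-* ; -‿homo = ⌜⌝-neg ; 0-homo = ≈-refl ; 1-homo = ≈-refl }

private
  ⌜⌝-≈? : ∀ p q → Maybe (⌜ p ⌝ ≈ ⌜ q ⌝)
  ⌜⌝-≈? p q with p ℚ.≟ q
  ... | yes e = just (≡⇒≈ (cong ⌜_⌝ e))
  ... | no _ = nothing

module ℝ-Solver = RingSolver (CommutativeRing.rawRing ℚ.+-*-commutativeRing)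
  (fromCommutativeRing ℝ-commutativeRing) ℚ→ℝ ⌜⌝-≈?

open ℝ-Solver

-- Absolute value, limits of inequalities, positivity

opaque
  unfolding _⊕_ ∣_∣

  x≼∣x∣ : ∀ x → x ≼ ∣ x ∣
  x≼∣x∣ x = pointwise-≼ {x} {∣ x ∣} (λ n → ℚ.p≤p⊔q (seq x n) (ℚ.- seq x n))

  ⊖x≼∣x∣ : ∀ x → ⊖ x ≼ ∣ x ∣
  ⊖x≼∣x∣ x = pointwise-≼ {⊖ x} {∣ x ∣} (λ n → ℚ.p≤q⊔p (seq x n) (ℚ.- seq x n))

  ∣∣-lub : ∀ {x y} → x ≼ y → ⊖ x ≼ y → ∣ x ∣ ≼ y
  ∣∣-lub {x} {y} p q ε 0<ε =
    let (M , h) = p ε 0<ε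
        (N , k) = q ε 0<ε
    in M ℕ.⊔ N , λ n r → ℚ.⊔-lub (h n (proj₁ (lub₂ r))) (k n (proj₂ (lub₂ {M} r)))

  ≼-limit : ∀ {x y} → (∀ ε → 0ℚ ℚ.< ε → x ≼ y ⊕ ⌜ ε ⌝) → x ≼ y
  ≼-limit {x} {y} h ε 0<ε =
    let (N , k) = h (½ ℚ.* ε) (0<half 0<ε) (½ ℚ.* ε) (0<half 0<ε)
    in N , λ n r → ℚ.≤-trans (k n r) (ℚ.≤-reflexive
      (trans (ℚ.+-assoc (seq y n) (½ ℚ.* ε) (½ ℚ.* ε)) (cong (seq y n ℚ.+_) (half+half ε))))

  rational-bound : ∀ x → ∃ λ B → 0ℚ ℚ.< B × ∣ x ∣ ≼ ⌜ B ⌝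
  rational-bound x = let (B , 0<B , N , h) = bound x in B , 0<B , ∣∣-lub {x} {⌜ B ⌝}
    (λ ε 0<ε → N , λ n r → ≤-by+ 0<ε (ℚ.≤-trans (≤∣∣ (seq x n)) (h n r)))
    (λ ε 0<ε → N , λ n r → ≤-by+ 0<ε (ℚ.≤-trans (≤∣∣ (ℚ.- seq x n))
      (ℚ.≤-trans (ℚ.≤-reflexive (ℚ.∣-p∣≡∣p∣ (seq x n))) (h n r))))
    where
    ≤-by+ : ∀ {ε a b} → 0ℚ ℚ.< ε → a ℚ.≤ b → a ℚ.≤ b ℚ.+ ε
    ≤-by+ {ε} 0<ε p = ℚ.≤-trans p (≤-by ε (ℚ.<⇒≤ 0<ε) refl)

  0<⇒0≼ : ∀ {x} → 0ℝ < x → ⌜ 0ℚ ⌝ ≼ x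
  0<⇒0≼ {x} (l , 0<l , N , h) ε 0<ε = N , λ n r →
    ℚ.≤-trans (ℚ.<⇒≤ 0<l) (ℚ.≤-trans (subst (ℚ._≤ seq x n) (ℚ.+-identityˡ l) (h n r))
      (≤-by ε (ℚ.<⇒≤ 0<ε) refl))

  <⇒≼ : ∀ {x y} → x < y → x ≼ y
  <⇒≼ {x} {y} (l , 0<l , N , h) ε 0<ε = N , λ n r →
    ℚ.≤-trans (≤-by l (ℚ.<⇒≤ 0<l) refl) (ℚ.≤-trans (h n r) (≤-by ε (ℚ.<⇒≤ 0<ε) refl))

  0<-≼-trans : ∀ {x y} → 0ℝ < x → x ≼ y → 0ℝ < y
  0<-≼-trans {x} {y} (l , 0<l , M , h) p =
    let (N , k) = p (½ ℚ.* l) (0<half 0<l)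
    in ½ ℚ.* l , 0<half 0<l , M ℕ.⊔ N , λ n r →
      subst₂ ℚ._≤_ (solve' (½ ℚ.* l) l (half+half l)) (solve'' (seq y n) (½ ℚ.* l))
        (ℚ.+-monoˡ-≤ (ℚ.- (½ ℚ.* l)) (ℚ.≤-trans (h n (proj₁ (lub₂ r))) (k n (proj₂ (lub₂ {M} r)))))
    where
    solve' : ∀ k l → k ℚ.+ k ≡ l → (0ℚ ℚ.+ l) ℚ.- k ≡ 0ℚ ℚ.+ k
    solve' k _ refl = Q.solve 1 (λ k → (Q.con 0ℚ Q.:+ (k Q.:+ k)) Q.:- k Q.:= Q.con 0ℚ Q.:+ k) refl k
      where module Q = +-*-Solver
    solve'' : ∀ y k → (y ℚ.+ k) ℚ.- k ≡ y
    solve'' = Q.solve 2 (λ y k → (y Q.:+ k) Q.:- k Q.:= y) refl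
      where module Q = +-*-Solver

  -- `inv` inverts `l ⊔ yₙ`, which agrees with `yₙ` only from the index in the positivity witness
  -- on; so the equation holds eventually, not at every term.
  inv-inverseʳ : ∀ y (0<y : 0ℝ < y) → y ⊛ inv y 0<y ≈ ⌜ 1ℚ ⌝
  inv-inverseʳ y 0<y@(l , 0<l , N , h) =
    (λ ε 0<ε → N , λ n r → ℚ.≤-trans (ℚ.≤-reflexive (eq n r)) (≤-by ε (ℚ.<⇒≤ 0<ε) refl)) ,
    (λ ε 0<ε → N , λ n r → ℚ.≤-trans (ℚ.≤-reflexive (sym (eq n r))) (≤-by ε (ℚ.<⇒≤ 0<ε) refl))
    where
    eq : ∀ n → N ℕ.≤ n → seq (y ⊛ inv y 0<y) n ≡ 1ℚ
    eq n r = trans (cong (ℚ._* recip (l ℚ.⊔ seq y n) pos)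
        (sym (ℚ.p≤q⇒p⊔q≡q (subst (ℚ._≤ seq y n) (ℚ.+-identityˡ l) (h n r)))))
      (*-recip (l ℚ.⊔ seq y n) pos)
      where
      pos : 0ℚ ℚ.< l ℚ.⊔ seq y n
      pos = ℚ.<-≤-trans 0<l (ℚ.p≤p⊔q l (seq y n))

inv-nonneg : ∀ y (0<y : 0ℝ < y) → ⌜ 0ℚ ⌝ ≼ inv y 0<y
inv-nonneg y 0<y = 0<⇒0≼ {inv y 0<y} (0<inv y 0<y)

≼-by : ∀ {x y} d → ⌜ 0ℚ ⌝ ≼ d → y ≈ x ⊕ d → x ≼ y
≼-by {x} {y} d 0≼d e = begin
  x          ≈⟨ solve 1 (λ x → x := x :+ con 0ℚ) ≈-refl x ⟩
  x ⊕ ⌜ 0ℚ ⌝ ≤⟨ ⊕-mono ≼-refl 0≼d ⟩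
  x ⊕ d      ≈⟨ e ⟨
  y          ∎

0≼⊝ : ∀ {x y} → x ≼ y → ⌜ 0ℚ ⌝ ≼ y ⊝ x
0≼⊝ {x} {y} h = begin
  ⌜ 0ℚ ⌝ ≈⟨ solve 1 (λ x → con 0ℚ := x :- x) ≈-refl x ⟩
  x ⊝ x  ≤⟨ ⊕-mono h ≼-refl ⟩
  y ⊝ x  ∎

0≼1 : ⌜ 0ℚ ⌝ ≼ ⌜ 1ℚ ⌝
0≼1 = ⌜⌝-mono (ℚ.<⇒≤ 0<1)

0≼⊕ : ∀ {x y} → ⌜ 0ℚ ⌝ ≼ x → ⌜ 0ℚ ⌝ ≼ y → ⌜ 0ℚ ⌝ ≼ x ⊕ y
0≼⊕ p q = ≼-respˡ (solve 0 (con 0ℚ :+ con 0ℚ := con 0ℚ) ≈-refl) (⊕-mono p q)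

⊛-monoˡ : ∀ {x y} z → ⌜ 0ℚ ⌝ ≼ z → x ≼ y → z ⊛ x ≼ z ⊛ y
⊛-monoˡ {x} {y} z 0≼z h = ≼-by (z ⊛ (y ⊝ x)) (⊛-nonneg 0≼z (0≼⊝ h))
  (solve 3 (λ x y z → z :* y := z :* x :+ z :* (y :- x)) ≈-refl x y z)

⊛-monoʳ : ∀ {x y} z → ⌜ 0ℚ ⌝ ≼ z → x ≼ y → x ⊛ z ≼ y ⊛ z
⊛-monoʳ {x} {y} z 0≼z h = ≼-by ((y ⊝ x) ⊛ z) (⊛-nonneg (0≼⊝ h) 0≼z)
  (solve 3 (λ x y z → y :* z := x :* z :+ (y :- x) :* z) ≈-refl x y z)

⊛-mono : ∀ {x y u v} → ⌜ 0ℚ ⌝ ≼ x → ⌜ 0ℚ ⌝ ≼ v → x ≼ y → u ≼ v → x ⊛ u ≼ y ⊛ v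
⊛-mono {x} {y} {u} {v} p q h k = ≼-trans (⊛-monoˡ x p k) (⊛-monoʳ v q h)

opaque
  unfolding _⊕_

  0≼-square : ∀ x → ⌜ 0ℚ ⌝ ≼ x ⊛ x
  0≼-square x = pointwise-≼ {⌜ 0ℚ ⌝} {x ⊛ x} λ n →
    subst (0ℚ ℚ.≤_) (trans (sym (ℚ.∣p*q∣≡∣p∣*∣q∣ (seq x n) (seq x n))) (square (seq x n) (ℚ.≤-total 0ℚ (seq x n))))
      (0≤* (ℚ.0≤∣p∣ (seq x n)) (ℚ.0≤∣p∣ (seq x n)))
    where
    square : ∀ q → 0ℚ ℚ.≤ q ⊎ q ℚ.≤ 0ℚ → ℚ.∣ q ℚ.* q ∣ ≡ q ℚ.* q
    square q (inj₁ p) = ℚ.0≤p⇒∣p∣≡p (0≤* p p)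
    square q (inj₂ p) = ℚ.0≤p⇒∣p∣≡p (subst (0ℚ ℚ.≤_) (Q.solve 1 (λ q → (Q.:- q) Q.:* (Q.:- q) Q.:= q Q.:* q) refl q)
      (0≤* (ℚ.neg-antimono-≤ p) (ℚ.neg-antimono-≤ p)))
      where module Q = +-*-Solver

⊛-cancelˡ-≼ : ∀ {x y z} u → ⌜ 0ℚ ⌝ ≼ u → z ⊛ u ≈ ⌜ 1ℚ ⌝ → z ⊛ x ≼ z ⊛ y → x ≼ y
⊛-cancelˡ-≼ {x} {y} {z} u 0≼u e h = begin
  x           ≈⟨ cancel x ⟨
  u ⊛ (z ⊛ x) ≤⟨ ⊛-monoˡ u 0≼u h ⟩
  u ⊛ (z ⊛ y) ≈⟨ cancel y ⟩
  y           ∎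
  where
  cancel : ∀ x → u ⊛ (z ⊛ x) ≈ x
  cancel x = begin-equality
    u ⊛ (z ⊛ x)  ≈⟨ solve 3 (λ u z x → u :* (z :* x) := (z :* u) :* x) ≈-refl u z x ⟩
    (z ⊛ u) ⊛ x  ≈⟨ ⊛-cong e ≈-refl ⟩
    ⌜ 1ℚ ⌝ ⊛ x   ≈⟨ solve 1 (λ x → con 1ℚ :* x := x) ≈-refl x ⟩
    x            ∎

⌜⌝-cancelˡ-≼ : ∀ {x y} q → 0ℚ ℚ.< q → ⌜ q ⌝ ⊛ x ≼ ⌜ q ⌝ ⊛ y → x ≼ y
⌜⌝-cancelˡ-≼ q 0<q = ⊛-cancelˡ-≼ ⌜ recip q 0<q ⌝ (⌜⌝-mono (ℚ.<⇒≤ (0<recip q 0<q)))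
  (≈-trans (≈-sym (⌜⌝-* q (recip q 0<q))) (≡⇒≈ (cong ⌜_⌝ (*-recip q 0<q))))

∣∣-nonneg : ∀ x → ⌜ 0ℚ ⌝ ≼ ∣ x ∣
∣∣-nonneg x = ⌜⌝-cancelˡ-≼ (ι 2) (0<ι 1) (begin
  ⌜ ι 2 ⌝ ⊛ ⌜ 0ℚ ⌝ ≈⟨ solve 1 (λ x → con (ι 2) :* con 0ℚ := x :+ :- x) ≈-refl x ⟩
  x ⊕ ⊖ x          ≤⟨ ⊕-mono (x≼∣x∣ x) (⊖x≼∣x∣ x) ⟩
  ∣ x ∣ ⊕ ∣ x ∣    ≈⟨ solve 1 (λ x → x :+ x := con (ι 2) :* x) ≈-refl (∣ x ∣) ⟩
  ⌜ ι 2 ⌝ ⊛ ∣ x ∣  ∎)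

∣∣-cong : ∀ {x y} → x ≈ y → ∣ x ∣ ≈ ∣ y ∣
∣∣-cong p = ≼-antisym (mono p) (mono (≈-sym p))
  where
  mono : ∀ {x y} → x ≈ y → ∣ x ∣ ≼ ∣ y ∣
  mono {x} {y} p = ∣∣-lub (≼-respˡ (≈-sym p) (x≼∣x∣ y)) (≼-respˡ (⊖-cong (≈-sym p)) (⊖x≼∣x∣ y))

∣∣-resp : ∀ {x y z} → x ≈ y → ∣ x ∣ ≼ z → ∣ y ∣ ≼ z
∣∣-resp e h = ≼-respˡ (∣∣-cong e) h

∣⊖∣ : ∀ x → ∣ ⊖ x ∣ ≼ ∣ x ∣
∣⊖∣ x = ∣∣-lub (⊖x≼∣x∣ x) (≼-respˡ (solve 1 (λ x → x := :- :- x) ≈-refl x) (x≼∣x∣ x))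

nonneg⇒∣∣≼ : ∀ {x} → ⌜ 0ℚ ⌝ ≼ x → ∣ x ∣ ≼ x
nonneg⇒∣∣≼ {x} p = ∣∣-lub ≼-refl (≼-by (x ⊕ x) (0≼⊕ p p) (solve 1 (λ x → x := :- x :+ (x :+ x)) ≈-refl x))

∣⌜⌝∣ : ∀ {q} → 0ℚ ℚ.≤ q → ∣ ⌜ q ⌝ ∣ ≼ ⌜ q ⌝
∣⌜⌝∣ 0≤q = nonneg⇒∣∣≼ (⌜⌝-mono 0≤q)

∣⊕∣ : ∀ {x y u v} → ∣ x ∣ ≼ u → ∣ y ∣ ≼ v → ∣ x ⊕ y ∣ ≼ u ⊕ v
∣⊕∣ {x} {y} p q = ∣∣-lub (⊕-mono (≼-trans (x≼∣x∣ x) p) (≼-trans (x≼∣x∣ y) q))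
  (≼-respˡ (solve 2 (λ x y → :- x :+ :- y := :- (x :+ y)) ≈-refl x y)
    (⊕-mono (≼-trans (⊖x≼∣x∣ x) p) (≼-trans (⊖x≼∣x∣ y) q)))

∣⊝∣ : ∀ {x y u v} → ∣ x ∣ ≼ u → ∣ y ∣ ≼ v → ∣ x ⊝ y ∣ ≼ u ⊕ v
∣⊝∣ {x} {y} p q = ∣⊕∣ p (≼-trans (∣⊖∣ y) q)

-- No signs are decided: |x||y| - xy and |x||y| + xy are each half a sum of two products of the
-- nonnegative numbers |x| ± x and |y| ± y.
∣⊛∣ : ∀ {x y u v} → ∣ x ∣ ≼ u → ∣ y ∣ ≼ v → ∣ x ⊛ y ∣ ≼ u ⊛ v
∣⊛∣ {x} {y} {u} {v} p q = ≼-trans (∣∣-lub upper lower)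
  (⊛-mono (∣∣-nonneg x) (≼-trans (∣∣-nonneg y) q) p q)
  where
  a = ∣ x ∣
  b = ∣ y ∣
  0≼a+ : ⌜ 0ℚ ⌝ ≼ a ⊕ x
  0≼a+ = ≼-respʳ (solve 2 (λ a x → a :- (:- x) := a :+ x) ≈-refl a x) (0≼⊝ (⊖x≼∣x∣ x))
  0≼b+ : ⌜ 0ℚ ⌝ ≼ b ⊕ y
  0≼b+ = ≼-respʳ (solve 2 (λ a x → a :- (:- x) := a :+ x) ≈-refl b y) (0≼⊝ (⊖x≼∣x∣ y))
  0≼a- : ⌜ 0ℚ ⌝ ≼ a ⊝ x
  0≼a- = 0≼⊝ (x≼∣x∣ x)
  0≼b- : ⌜ 0ℚ ⌝ ≼ b ⊝ y
  0≼b- = 0≼⊝ (x≼∣x∣ y)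
  0≼½ : ⌜ 0ℚ ⌝ ≼ ⌜ ½ ⌝
  0≼½ = ⌜⌝-mono (ℚ.<⇒≤ 0<½)
  upper : x ⊛ y ≼ a ⊛ b
  upper = ≼-by (⌜ ½ ⌝ ⊛ ((a ⊕ x) ⊛ (b ⊝ y) ⊕ (a ⊝ x) ⊛ (b ⊕ y)))
    (⊛-nonneg 0≼½ (0≼⊕ (⊛-nonneg 0≼a+ 0≼b-) (⊛-nonneg 0≼a- 0≼b+)))
    (solve 4 (λ a b x y → a :* b := x :* y :+ con ½ :* ((a :+ x) :* (b :- y) :+ (a :- x) :* (b :+ y))) ≈-refl a b x y)
  lower : ⊖ (x ⊛ y) ≼ a ⊛ b
  lower = ≼-by (⌜ ½ ⌝ ⊛ ((a ⊕ x) ⊛ (b ⊕ y) ⊕ (a ⊝ x) ⊛ (b ⊝ y)))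
    (⊛-nonneg 0≼½ (0≼⊕ (⊛-nonneg 0≼a+ 0≼b+) (⊛-nonneg 0≼a- 0≼b-)))
    (solve 4 (λ a b x y → a :* b := :- (x :* y) :+ con ½ :* ((a :+ x) :* (b :+ y) :+ (a :- x) :* (b :- y))) ≈-refl a b x y)

∣∣≼⇒≼ : ∀ {x y e} → ∣ x ⊝ y ∣ ≼ e → x ≼ y ⊕ e
∣∣≼⇒≼ {x} {y} {e} h = begin
  x             ≈⟨ solve 2 (λ x y → x := y :+ (x :- y)) ≈-refl x y ⟩
  y ⊕ (x ⊝ y)   ≤⟨ ⊕-mono ≼-refl (≼-trans (x≼∣x∣ (x ⊝ y)) h) ⟩
  y ⊕ e         ∎

∣∣-swap : ∀ {x y e} → ∣ x ⊝ y ∣ ≼ e → ∣ y ⊝ x ∣ ≼ e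
∣∣-swap {x} {y} h = ∣∣-resp (solve 2 (λ x y → :- (x :- y) := y :- x) ≈-refl x y) (≼-trans (∣⊖∣ (x ⊝ y)) h)

≼⇒∣∣≼ : ∀ {x y e} → x ≼ y ⊕ e → y ≼ x ⊕ e → ∣ x ⊝ y ∣ ≼ e
≼⇒∣∣≼ {x} {y} {e} p q = ∣∣-lub
  (≼-respʳ (solve 2 (λ y e → (y :+ e) :- y := e) ≈-refl y e) (⊕-mono p (≼-refl {⊖ y})))
  (≼-respˡ (solve 2 (λ x y → y :- x := :- (x :- y)) ≈-refl x y)
    (≼-respʳ (solve 2 (λ y e → (y :+ e) :- y := e) ≈-refl x e) (⊕-mono q (≼-refl {⊖ x}))))

-- Limits and power series

infix 4 _⟶_
infixr 9 _↑_

_⟶_ : (ℕ → ℝ) → ℝ → Set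
s ⟶ x = ∀ ε → 0ℚ ℚ.< ε → ∃ λ N → ∀ n → N ℕ.≤ n → ∣ x ⊝ s n ∣ ≼ ⌜ ε ⌝

halves : ∀ ε → ⌜ ½ ℚ.* ε ⌝ ⊕ ⌜ ½ ℚ.* ε ⌝ ≈ ⌜ ε ⌝
halves ε = ≈-trans (≈-sym (⌜⌝-+ (½ ℚ.* ε) (½ ℚ.* ε))) (≡⇒≈ (cong ⌜_⌝ (half+half ε)))

⟶-≼ : ∀ {s t x y} → s ⟶ x → t ⟶ y → (∀ n → s n ≼ t n) → x ≼ y
⟶-≼ {s} {t} {x} {y} p q h = ≼-limit λ ε 0<ε →
  let (M , hs) = p (½ ℚ.* ε) (0<half 0<ε)
      (N , ht) = q (½ ℚ.* ε) (0<half 0<ε)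
      n = M ℕ.⊔ N
      (M≤n , N≤n) = lub₂ {M} {N} {n} ℕ.≤-refl
      e = ⌜ ½ ℚ.* ε ⌝
  in begin
    x           ≤⟨ ∣∣≼⇒≼ (hs n M≤n) ⟩
    s n ⊕ e     ≤⟨ ⊕-mono (h n) ≼-refl ⟩
    t n ⊕ e     ≤⟨ ⊕-mono (∣∣≼⇒≼ (∣∣-swap (ht n N≤n))) ≼-refl ⟩
    (y ⊕ e) ⊕ e ≈⟨ solve 2 (λ y e → (y :+ e) :+ e := y :+ (e :+ e)) ≈-refl y e ⟩
    y ⊕ (e ⊕ e) ≈⟨ ⊕-cong ≈-refl (halves ε) ⟩
    y ⊕ ⌜ ε ⌝   ∎

⟶-unique : ∀ {s t x y} → s ⟶ x → t ⟶ y → (∀ n → s n ≈ t n) → x ≈ y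
⟶-unique p q h = ≼-antisym (⟶-≼ p q λ n → ≈⇒≼ (h n)) (⟶-≼ q p λ n → ≈⇒≼ (≈-sym (h n)))

⟶-const : ∀ x → (λ _ → x) ⟶ x
⟶-const x ε 0<ε = 0 , λ _ _ → ≼-trans
  (≼-trans (≈⇒≼ (∣∣-cong (solve 1 (λ x → x :- x := con 0ℚ) ≈-refl x))) (∣⌜⌝∣ ℚ.≤-refl)) (⌜⌝-mono (ℚ.<⇒≤ 0<ε))

⟶-suc : ∀ {s x} → s ⟶ x → (λ n → s (suc n)) ⟶ x
⟶-suc p ε 0<ε = let (N , h) = p ε 0<ε in N , λ n N≤n → h (suc n) (ℕ.m≤n⇒m≤1+n N≤n)

⟶-⊕ : ∀ {s t x y} → s ⟶ x → t ⟶ y → (λ n → s n ⊕ t n) ⟶ x ⊕ y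
⟶-⊕ {s} {t} {x} {y} p q ε 0<ε =
  let (M , hs) = p (½ ℚ.* ε) (0<half 0<ε)
      (N , ht) = q (½ ℚ.* ε) (0<half 0<ε)
  in M ℕ.⊔ N , λ n r → ∣∣-resp
    (solve 4 (λ x y s t → (x :- s) :+ (y :- t) := (x :+ y) :- (s :+ t)) ≈-refl x y (s n) (t n))
    (≼-respʳ (halves ε) (∣⊕∣ (hs n (proj₁ (lub₂ r))) (ht n (proj₂ (lub₂ {M} r)))))

⟶-⊛ : ∀ {s x} c → s ⟶ x → (λ n → c ⊛ s n) ⟶ c ⊛ x
⟶-⊛ {s} {x} c p ε 0<ε =
  let (B , 0<B , c≼B) = rational-bound c
      w = recip B 0<B
      (N , h) = p (w ℚ.* ε) (0<* (0<recip B 0<B) 0<ε)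
  in N , λ n r → ∣∣-resp (solve 3 (λ c x s → c :* (x :- s) := c :* x :- c :* s) ≈-refl c x (s n))
    (≼-respʳ (≈-trans (≈-sym (⌜⌝-* B (w ℚ.* ε))) (≡⇒≈ (cong ⌜_⌝
      (trans (sym (ℚ.*-assoc B w ε)) (trans (cong (ℚ._* ε) (*-recip B 0<B)) (ℚ.*-identityˡ ε))))))
      (∣⊛∣ c≼B (h n r)))

⟶-⊖ : ∀ {s x} → s ⟶ x → (λ n → ⊖ s n) ⟶ ⊖ x
⟶-⊖ {s} {x} p ε 0<ε = let (N , h) = p ε 0<ε in N , λ n r →
  ∣∣-resp (solve 2 (λ x s → s :- x := :- x :- :- s) ≈-refl x (s n)) (∣∣-swap (h n r))

⟶-∣∣ : ∀ {s t x y} → s ⟶ x → t ⟶ y → (∀ n → ∣ s n ∣ ≼ t n) → ∣ x ∣ ≼ y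
⟶-∣∣ {s} p q h = ∣∣-lub (⟶-≼ p q λ n → ≼-trans (x≼∣x∣ (s n)) (h n))
  (⟶-≼ (⟶-⊖ p) q λ n → ≼-trans (⊖x≼∣x∣ (s n)) (h n))

∑< : (ℕ → ℝ) → ℕ → ℝ
∑< t zero    = ⌜ 0ℚ ⌝
∑< t (suc n) = ∑< t n ⊕ t n

∑<-cong : ∀ {s t} → (∀ k → s k ≈ t k) → ∀ n → ∑< s n ≈ ∑< t n
∑<-cong h zero    = ≈-refl
∑<-cong h (suc n) = ⊕-cong (∑<-cong h n) (h n)

_↑_ : ℝ → ℕ → ℝ
x ↑ zero  = ⌜ 1ℚ ⌝
x ↑ suc n = x ⊛ x ↑ n

↑-cong : ∀ {x y} → x ≈ y → ∀ n → x ↑ n ≈ y ↑ n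
↑-cong e zero    = ≈-refl
↑-cong e (suc n) = ⊛-cong e (↑-cong e n)

1/_! 1/odd : ℕ → ℚ
1/ k ! = (+ 1 / (k ℕ.!)) {{k ℕ.!≢0}}
1/odd k = + 1 / suc (2 ℕ.* k)

0≤1/! : ∀ k → 0ℚ ℚ.≤ 1/ k !
0≤1/! k = ℚ.nonNegative⁻¹ _ {{ℚ.normalize-nonNeg 1 (k ℕ.!) {{k ℕ.!≢0}}}}

0≤1/odd : ∀ k → 0ℚ ℚ.≤ 1/odd k
0≤1/odd k = ℚ.nonNegative⁻¹ _ {{ℚ.normalize-nonNeg 1 (suc (2 ℕ.* k))}}

exp-terms artanh-terms : ℝ → ℕ → ℝ
exp-terms x k = x ↑ k ⊛ ⌜ 1/ k ! ⌝
artanh-terms z k = z ⊛ (z ⊛ z) ↑ k ⊛ ⌜ 1/odd k ⌝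

opaque
  unfolding _⊕_ ∣_∣

  -- Term i of the limit is joined to term i of `s n` through term m of the limit, term j of `s m`
  -- and term j of `s n`, with m and j far out. The four distances are at most ½η, δ, δ and ½η,
  -- where 2δ = ε.
  lim-⟶ : ∀ s s-cauchy → s ⟶ lim s s-cauchy
  lim-⟶ s s-cauchy ε 0<ε =
    let δ = ½ ℚ.* ε
        0<δ = 0<half 0<ε
        (N , h) = s-cauchy δ 0<δ
        (M , k) = archimedean-recip δ 0<δ
        x = lim s s-cauchy
    in N ℕ.⊔ M , λ n r → near n (lub₂ {N} {M} r) δ (half+half ε) h k
    where
    near : ∀ n {N M} → N ℕ.≤ n × M ℕ.≤ n → ∀ δ → δ ℚ.+ δ ≡ ε →
      (∀ m n → N ℕ.≤ m → N ℕ.≤ n → ∃ λ I → ∀ i → I ℕ.≤ i → ℚ.∣ seq (s m) i ℚ.- seq (s n) i ∣ ℚ.≤ δ) →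
      (∀ n → M ℕ.≤ n → + 1 / suc n ℚ.≤ δ) → ∣ lim s s-cauchy ⊝ s n ∣ ≼ ⌜ ε ⌝
    near n {N} {M} (N≤n , M≤n) δ δδ h k = ≼⇒∣∣≼ {lim s s-cauchy} {s n} {⌜ ε ⌝}
      (λ η 0<η → let (I , g) = at η 0<η in I , λ i r →
        ℚ.≤-trans (close-≤ {seq (lim s s-cauchy) i} {seq (s n) i} (g i r)) (slack η 0<η (seq (s n) i)))
      (λ η 0<η → let (I , g) = at η 0<η in I , λ i r →
        ℚ.≤-trans (close-≥ {seq (lim s s-cauchy) i} {seq (s n) i} (g i r)) (slack η 0<η (seq (lim s s-cauchy) i)))
      where
      slack : ∀ η → 0ℚ ℚ.< η → ∀ a → a ℚ.+ (ε ℚ.+ η) ℚ.≤ (a ℚ.+ ε) ℚ.+ η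
      slack η _ a = ℚ.≤-reflexive (sym (ℚ.+-assoc a ε η))
      at : ∀ η → 0ℚ ℚ.< η → ∃ λ I → ∀ i → I ℕ.≤ i → ℚ.∣ seq (lim s s-cauchy) i ℚ.- seq (s n) i ∣ ℚ.≤ ε ℚ.+ η
      at η 0<η =
        let (J , c) = cauchy (lim s s-cauchy) (½ ℚ.* η) (0<half 0<η)
            (L , d) = cauchy (s n) (½ ℚ.* η) (0<half 0<η)
            m = J ℕ.⊔ (N ℕ.⊔ M)
            (J≤m , NM≤m) = lub₂ {J} {N ℕ.⊔ M} {m} ℕ.≤-refl
            (N≤m , M≤m) = lub₂ {N} {M} NM≤m
            (I , g) = h m n N≤m N≤n
            j = I ℕ.⊔ (diag s m ℕ.⊔ L)
            (I≤j , dL≤j) = lub₂ {I} {diag s m ℕ.⊔ L} {j} ℕ.≤-refl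
            (d≤j , L≤j) = lub₂ {diag s m} {L} dL≤j
            x = seq (lim s s-cauchy)
            p₁ = ℚ.≤-trans (proj₂ (modulus s m) (diag s m) j ℕ.≤-refl d≤j) (k m M≤m)
        in J ℕ.⊔ L , λ i r → ℚ.≤-trans (triangle (x i) (x m) (seq (s n) i))
          (ℚ.≤-trans (ℚ.+-mono-≤ (c i m (proj₁ (lub₂ r)) J≤m)
            (ℚ.≤-trans (triangle (x m) (seq (s m) j) (seq (s n) i))
              (ℚ.+-mono-≤ p₁ (ℚ.≤-trans (triangle (seq (s m) j) (seq (s n) j) (seq (s n) i))
                (ℚ.+-mono-≤ (g j I≤j) (d j i L≤j (proj₂ (lub₂ {J} r))))))))
            (ℚ.≤-reflexive (trans (arrange (½ ℚ.* η) δ) (cong₂ ℚ._+_ δδ (half+half η)))))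
        where
        arrange : ∀ h d → h ℚ.+ (d ℚ.+ (d ℚ.+ h)) ≡ (d ℚ.+ d) ℚ.+ (h ℚ.+ h)
        arrange = Q.solve 2 (λ h d → h Q.:+ (d Q.:+ (d Q.:+ h)) Q.:= (d Q.:+ d) Q.:+ (h Q.:+ h)) refl
          where module Q = +-*-Solver

⟶-cong : ∀ {s t x} → (∀ n → s n ≈ t n) → s ⟶ x → t ⟶ x
⟶-cong e p ε 0<ε = let (N , h) = p ε 0<ε in N , λ n r → ∣∣-resp (⊕-cong ≈-refl (⊖-cong (e n))) (h n r)

opaque
  Exp : ℝ → ℝ
  Exp = exp

opaque
  unfolding _⊕_ Exp

  private
    ↑≡^ : ∀ x n i → seq (x ↑ n) i ≡ seq (x ^ n) i
    ↑≡^ x zero    i = refl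
    ↑≡^ x (suc n) i = cong (seq x i ℚ.*_) (↑≡^ x n i)

    ∑<≡partialSum : ∀ {s t i} → (∀ k → seq (s k) i ≡ seq (t k) i) → ∀ n → seq (∑< s n) i ≡ seq (partialSum t n) i
    ∑<≡partialSum h zero    = refl
    ∑<≡partialSum h (suc n) = cong₂ ℚ._+_ (∑<≡partialSum h n) (h n)

  Exp-⟶ : ∀ x → ∑< (exp-terms x) ⟶ Exp x
  Exp-⟶ x = ⟶-cong {partialSum (expTerm x)} {∑< (exp-terms x)} {exp x}
    (λ n → pointwise-≈ {partialSum (expTerm x) n} {∑< (exp-terms x) n} λ i → sym (∑<≡partialSum (λ k → cong (ℚ._* 1/ k !) (↑≡^ x k i)) n))
    (lim-⟶ (partialSum (expTerm x)) (expTerm-cauchy x))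

  artanh-⟶ : ∀ z z<1 → ∑< (artanh-terms z) ⟶ artanh z z<1
  artanh-⟶ z z<1 = ⟶-cong {partialSum (artanhTerm z)} {∑< (artanh-terms z)} {artanh z z<1}
    (λ n → pointwise-≈ {partialSum (artanhTerm z) n} {∑< (artanh-terms z) n} λ i →
      sym (∑<≡partialSum (λ k → cong (λ q → seq z i ℚ.* q ℚ.* 1/odd k) (↑≡^ (z * z) k i)) n))
    (lim-⟶ (partialSum (artanhTerm z)) (artanhTerm-cauchy z z<1))

-- The exponential function

-- The derivative m tᵐ⁻¹ of tᵐ and half its second derivative, by recursions that avoid m ∸ 1.
↑′ ↑″ : ℝ → ℕ → ℝ
↑′ t zero    = ⌜ 0ℚ ⌝
↑′ t (suc m) = t ⊛ ↑′ t m ⊕ t ↑ m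
↑″ t zero    = ⌜ 0ℚ ⌝
↑″ t (suc m) = t ⊛ ↑″ t m ⊕ ↑′ t m

0≼↑ : ∀ {r} → ⌜ 0ℚ ⌝ ≼ r → ∀ m → ⌜ 0ℚ ⌝ ≼ r ↑ m
0≼↑ p zero    = 0≼1
0≼↑ p (suc m) = ⊛-nonneg p (0≼↑ p m)

0≼↑′ : ∀ {r} → ⌜ 0ℚ ⌝ ≼ r → ∀ m → ⌜ 0ℚ ⌝ ≼ ↑′ r m
0≼↑′ p zero    = ≼-refl
0≼↑′ p (suc m) = 0≼⊕ (⊛-nonneg p (0≼↑′ p m)) (0≼↑ p m)

∣↑∣ : ∀ {t r} → ∣ t ∣ ≼ r → ∀ m → ∣ t ↑ m ∣ ≼ r ↑ m
∣↑∣ p zero    = ∣⌜⌝∣ (ℚ.<⇒≤ 0<1)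
∣↑∣ p (suc m) = ∣⊛∣ p (∣↑∣ p m)

∣↑′∣ : ∀ {t r} → ∣ t ∣ ≼ r → ∀ m → ∣ ↑′ t m ∣ ≼ ↑′ r m
∣↑′∣ p zero    = ∣⌜⌝∣ ℚ.≤-refl
∣↑′∣ p (suc m) = ∣⊕∣ (∣⊛∣ p (∣↑′∣ p m)) (∣↑∣ p m)

-- The remainders satisfy Δ(m+1) = (t+h) Δ(m) + h² (tᵐ)′.
↑-increment : ∀ {t h r} → ∣ t ∣ ≼ r → ∣ t ⊕ h ∣ ≼ r → ∀ m →
  ∣ ((t ⊕ h) ↑ m ⊝ t ↑ m) ⊝ h ⊛ ↑′ t m ∣ ≼ h ⊛ h ⊛ ↑″ r m
↑-increment {t} {h} {r} p q zero = ∣∣-resp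
  (solve 1 (λ h → con 0ℚ := (con 1ℚ :- con 1ℚ) :- h :* con 0ℚ) ≈-refl h)
  (≼-respʳ (solve 1 (λ h → con 0ℚ := h :* h :* con 0ℚ) ≈-refl h) (∣⌜⌝∣ ℚ.≤-refl))
↑-increment {t} {h} {r} p q (suc m) = ∣∣-resp
  (solve 5 (λ t h a b d → (t :+ h) :* ((a :- b) :- h :* d) :+ h :* h :* d :=
      ((t :+ h) :* a :- t :* b) :- h :* (t :* d :+ b))
    ≈-refl t h ((t ⊕ h) ↑ m) (t ↑ m) (↑′ t m))
  (≼-respʳ (solve 4 (λ h r e d → r :* (h :* h :* e) :+ h :* h :* d := h :* h :* (r :* e :+ d))
      ≈-refl h r (↑″ r m) (↑′ r m))
    (∣⊕∣ (∣⊛∣ q (↑-increment p q m)) (∣⊛∣ (nonneg⇒∣∣≼ (0≼-square h)) (∣↑′∣ p m))))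

↑′-suc : ∀ t m → ↑′ t (suc m) ≈ ⌜ ι (suc m) ⌝ ⊛ t ↑ m
↑′-suc t zero = solve 1 (λ t → t :* con 0ℚ :+ con 1ℚ := con 1ℚ :* con 1ℚ) ≈-refl t
↑′-suc t (suc m) = begin-equality
  t ⊛ ↑′ t (suc m) ⊕ t ⊛ t ↑ m                   ≈⟨ ⊕-cong (⊛-cong ≈-refl (↑′-suc t m)) ≈-refl ⟩
  t ⊛ (⌜ ι (suc m) ⌝ ⊛ t ↑ m) ⊕ t ⊛ t ↑ m        ≈⟨ solve 3 (λ t c a → t :* (c :* a) :+ t :* a := (con 1ℚ :+ c) :* (t :* a)) ≈-refl t ⌜ ι (suc m) ⌝ (t ↑ m) ⟩
  (⌜ 1ℚ ⌝ ⊕ ⌜ ι (suc m) ⌝) ⊛ (t ⊛ t ↑ m)         ≈⟨ ⊛-cong (≈-trans (≈-sym (⌜⌝-+ 1ℚ (ι (suc m)))) (≡⇒≈ (cong ⌜_⌝ (sym (ι-suc (suc m)))))) ≈-refl ⟩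
  ⌜ ι (suc (suc m)) ⌝ ⊛ (t ⊛ t ↑ m)              ∎

-- For r ≥ 0, half the second derivative of rᵐ⁺¹ is at most the whole, which is the derivative of (m
-- + 1) rᵐ. The lost factor 2 only affects constants.
↑″-suc : ∀ {r} → ⌜ 0ℚ ⌝ ≼ r → ∀ m → ↑″ r (suc m) ≼ ⌜ ι (suc m) ⌝ ⊛ ↑′ r m
↑″-suc {r} p zero = ≈⇒≼ (solve 1 (λ r → r :* con 0ℚ :+ con 0ℚ := con 1ℚ :* con 0ℚ) ≈-refl r)
↑″-suc {r} p (suc m) = begin
  r ⊛ ↑″ r (suc m) ⊕ ↑′ r (suc m)             ≤⟨ ⊕-mono (⊛-monoˡ r p (↑″-suc p m)) ≼-refl ⟩
  r ⊛ (c ⊛ ↑′ r m) ⊕ ↑′ r (suc m)             ≤⟨ ≼-by (c ⊛ r ↑ m) (⊛-nonneg (⌜⌝-mono (0≤ι (suc m))) (0≼↑ p m))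
    (solve 4 (λ r c d a → (con 1ℚ :+ c) :* (r :* d :+ a) := (r :* (c :* d) :+ (r :* d :+ a)) :+ c :* a) ≈-refl r c (↑′ r m) (r ↑ m)) ⟩
  (⌜ 1ℚ ⌝ ⊕ c) ⊛ ↑′ r (suc m)                 ≈⟨ ⊛-cong (≈-trans (≈-sym (⌜⌝-+ 1ℚ (ι (suc m)))) (≡⇒≈ (cong ⌜_⌝ (sym (ι-suc (suc m)))))) ≈-refl ⟩
  ⌜ ι (suc (suc m)) ⌝ ⊛ ↑′ r (suc m)          ∎
  where c = ⌜ ι (suc m) ⌝

∣⌜⌝⊛∣ : ∀ {x y q} → 0ℚ ℚ.≤ q → ∣ x ∣ ≼ y → ∣ x ⊛ ⌜ q ⌝ ∣ ≼ y ⊛ ⌜ q ⌝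
∣⌜⌝⊛∣ 0≤q p = ∣⊛∣ p (∣⌜⌝∣ 0≤q)

ι⊛1/! : ∀ k x → ⌜ ι (suc k) ⌝ ⊛ x ⊛ ⌜ 1/ suc k ! ⌝ ≈ x ⊛ ⌜ 1/ k ! ⌝
ι⊛1/! k x = begin-equality
  ⌜ ι (suc k) ⌝ ⊛ x ⊛ ⌜ 1/ suc k ! ⌝    ≈⟨ solve 3 (λ n x c → n :* x :* c := x :* (n :* c)) ≈-refl ⌜ ι (suc k) ⌝ x ⌜ 1/ suc k ! ⌝ ⟩
  x ⊛ (⌜ ι (suc k) ⌝ ⊛ ⌜ 1/ suc k ! ⌝)  ≈⟨ ⊛-cong ≈-refl (≈-trans (≈-sym (⌜⌝-* (ι (suc k)) (1/ suc k !))) (≡⇒≈ (cong ⌜_⌝ (factorial-step k)))) ⟩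
  x ⊛ ⌜ 1/ k ! ⌝                        ∎

module _ {t h r : ℝ} (∣t∣≼r : ∣ t ∣ ≼ r) (∣t+h∣≼r : ∣ t ⊕ h ∣ ≼ r) where

  private
    0≼r : ⌜ 0ℚ ⌝ ≼ r
    0≼r = ≼-trans (∣∣-nonneg t) ∣t∣≼r

    exp-term-increment : ∀ k →
      ∣ (exp-terms (t ⊕ h) (suc (suc k)) ⊝ exp-terms t (suc (suc k))) ⊝ h ⊛ exp-terms t (suc k) ∣
        ≼ h ⊛ h ⊛ exp-terms r k
    exp-term-increment k = ∣∣-resp eq (≼-trans (∣⌜⌝⊛∣ (0≤1/! (suc (suc k))) (↑-increment ∣t∣≼r ∣t+h∣≼r (suc (suc k)))) le)
      where
      a = (t ⊕ h) ↑ suc (suc k)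
      b = t ↑ suc (suc k)
      c = ⌜ 1/ suc (suc k) ! ⌝
      eq : ((a ⊝ b) ⊝ h ⊛ ↑′ t (suc (suc k))) ⊛ c ≈ (a ⊛ c ⊝ b ⊛ c) ⊝ h ⊛ exp-terms t (suc k)
      eq = begin-equality
        ((a ⊝ b) ⊝ h ⊛ ↑′ t (suc (suc k))) ⊛ c           ≈⟨ solve 5 (λ a b h d c → ((a :- b) :- h :* d) :* c := (a :* c :- b :* c) :- h :* (d :* c)) ≈-refl a b h (↑′ t (suc (suc k))) c ⟩
        (a ⊛ c ⊝ b ⊛ c) ⊝ h ⊛ (↑′ t (suc (suc k)) ⊛ c)   ≈⟨ ⊕-cong ≈-refl (⊖-cong (⊛-cong ≈-refl (≈-trans (⊛-cong (↑′-suc t (suc k)) ≈-refl) (ι⊛1/! (suc k) (t ↑ suc k))))) ⟩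
        (a ⊛ c ⊝ b ⊛ c) ⊝ h ⊛ exp-terms t (suc k)        ∎
      le : h ⊛ h ⊛ ↑″ r (suc (suc k)) ⊛ c ≼ h ⊛ h ⊛ exp-terms r k
      le = begin
        h ⊛ h ⊛ ↑″ r (suc (suc k)) ⊛ c                   ≈⟨ solve 3 (λ h e c → h :* h :* e :* c := h :* h :* (e :* c)) ≈-refl h (↑″ r (suc (suc k))) c ⟩
        h ⊛ h ⊛ (↑″ r (suc (suc k)) ⊛ c)                 ≤⟨ ⊛-monoˡ (h ⊛ h) (0≼-square h) (⊛-monoʳ c (⌜⌝-mono (0≤1/! (suc (suc k)))) (↑″-suc 0≼r (suc k))) ⟩
        h ⊛ h ⊛ (⌜ ι (suc (suc k)) ⌝ ⊛ ↑′ r (suc k) ⊛ c) ≈⟨ ⊛-cong ≈-refl (ι⊛1/! (suc k) (↑′ r (suc k))) ⟩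
        h ⊛ h ⊛ (↑′ r (suc k) ⊛ ⌜ 1/ suc k ! ⌝)          ≈⟨ ⊛-cong ≈-refl (⊛-cong (↑′-suc r k) ≈-refl) ⟩
        h ⊛ h ⊛ (⌜ ι (suc k) ⌝ ⊛ r ↑ k ⊛ ⌜ 1/ suc k ! ⌝) ≈⟨ ⊛-cong ≈-refl (ι⊛1/! k (r ↑ k)) ⟩
        h ⊛ h ⊛ exp-terms r k                            ∎

    -- The sums stop at n + 2, n + 1 and n because each differentiation lowers the degree by one;
    -- the terms of degree 0 and 1 leave no remainder.
    exp-sum-increment : ∀ n →
      ∣ (∑< (exp-terms (t ⊕ h)) (suc (suc n)) ⊝ ∑< (exp-terms t) (suc (suc n))) ⊝ h ⊛ ∑< (exp-terms t) (suc n) ∣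
        ≼ h ⊛ h ⊛ ∑< (exp-terms r) n
    exp-sum-increment zero = ∣∣-resp
      (solve 2 (λ t h → con 0ℚ := (((con 0ℚ :+ con 1ℚ :* con 1ℚ) :+ ((t :+ h) :* con 1ℚ) :* con 1ℚ) :-
          ((con 0ℚ :+ con 1ℚ :* con 1ℚ) :+ (t :* con 1ℚ) :* con 1ℚ)) :- h :* (con 0ℚ :+ con 1ℚ :* con 1ℚ)) ≈-refl t h)
      (≼-respʳ (solve 1 (λ h → con 0ℚ := h :* h :* con 0ℚ) ≈-refl h) (∣⌜⌝∣ ℚ.≤-refl))
    exp-sum-increment (suc n) = ∣∣-resp
      (solve 7 (λ a b c x y z h → ((a :- b) :- h :* c) :+ ((x :- y) :- h :* z) := ((a :+ x) :- (b :+ y)) :- h :* (c :+ z)) ≈-refl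
        (∑< (exp-terms (t ⊕ h)) (suc (suc n))) (∑< (exp-terms t) (suc (suc n))) (∑< (exp-terms t) (suc n))
        (exp-terms (t ⊕ h) (suc (suc n))) (exp-terms t (suc (suc n))) (exp-terms t (suc n)) h)
      (≼-respʳ (solve 3 (λ h a x → h :* h :* a :+ h :* h :* x := h :* h :* (a :+ x)) ≈-refl h (∑< (exp-terms r) n) (exp-terms r n))
        (∣⊕∣ (exp-sum-increment n) (exp-term-increment n)))

  Exp-increment : ∣ (Exp (t ⊕ h) ⊝ Exp t) ⊝ h ⊛ Exp t ∣ ≼ h ⊛ h ⊛ Exp r
  Exp-increment = ⟶-∣∣
    (⟶-⊕ (⟶-⊕ (⟶-suc (⟶-suc (Exp-⟶ (t ⊕ h)))) (⟶-⊖ (⟶-suc (⟶-suc (Exp-⟶ t)))))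
      (⟶-⊖ (⟶-⊛ h (⟶-suc (Exp-⟶ t)))))
    (⟶-⊛ (h ⊛ h) (Exp-⟶ r)) exp-sum-increment

∣∑<∣ : ∀ {s t} → (∀ k → ∣ s k ∣ ≼ t k) → ∀ n → ∣ ∑< s n ∣ ≼ ∑< t n
∣∑<∣ h zero    = ∣⌜⌝∣ ℚ.≤-refl
∣∑<∣ h (suc n) = ∣⊕∣ (∣∑<∣ h n) (h n)

∣Exp∣ : ∀ {x r} → ∣ x ∣ ≼ r → ∣ Exp x ∣ ≼ Exp r
∣Exp∣ {x} {r} p = ⟶-∣∣ (Exp-⟶ x) (Exp-⟶ r) (∣∑<∣ λ k → ∣⌜⌝⊛∣ (0≤1/! k) (∣↑∣ p k))

Exp-cong : ∀ {x y} → x ≈ y → Exp x ≈ Exp y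
Exp-cong {x} {y} e = ⟶-unique (Exp-⟶ x) (Exp-⟶ y) (∑<-cong λ k → ⊛-cong (↑-cong e k) ≈-refl)

Exp-0 : Exp ⌜ 0ℚ ⌝ ≈ ⌜ 1ℚ ⌝
Exp-0 = ⟶-unique (⟶-suc (Exp-⟶ ⌜ 0ℚ ⌝)) (⟶-const ⌜ 1ℚ ⌝) sums
  where
  sums : ∀ n → ∑< (exp-terms ⌜ 0ℚ ⌝) (suc n) ≈ ⌜ 1ℚ ⌝
  sums zero    = solve 0 (con 0ℚ :+ con 1ℚ :* con 1ℚ := con 1ℚ) ≈-refl
  sums (suc n) = ≈-trans (⊕-cong (sums n) ≈-refl)
    (solve 2 (λ a c → con 1ℚ :+ con 0ℚ :* a :* c := con 1ℚ) ≈-refl (⌜ 0ℚ ⌝ ↑ n) ⌜ 1/ suc n ! ⌝)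

2⁻_ : ℕ → ℚ
2⁻ zero  = 1ℚ
2⁻ suc n = ½ ℚ.* 2⁻ n

2⁻≤ : ∀ n → 2⁻ n ℚ.≤ + 1 / suc n
2⁻≤ n = *-cancelˡ (ι (suc n)) (0<ι n) (ℚ.≤-trans (proj₂ (both n)) (ℚ.≤-reflexive (sym (ι*frac 1 (suc n)))))
  where
  -- The second quantity satisfies a(n + 1) = ½ a(n) + ½ 2⁻ⁿ, so the two bounds by 1 are carried
  -- together.
  both : ∀ n → 2⁻ n ℚ.≤ 1ℚ × ι (suc n) ℚ.* 2⁻ n ℚ.≤ 1ℚ
  both zero = ℚ.≤-refl , ℚ.≤-refl
  both (suc n) = let (p , q) = both n in
    ≤-by (½ ℚ.* (1ℚ ℚ.- 2⁻ n) ℚ.+ ½) (ℚ.+-mono-≤ (0≤* (ℚ.<⇒≤ 0<½) (0≤-diff p)) (ℚ.<⇒≤ 0<½))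
      (Q.solve 1 (λ a → Q.con 1ℚ Q.:= Q.con ½ Q.:* a Q.:+ (Q.con ½ Q.:* (Q.con 1ℚ Q.:- a) Q.:+ Q.con ½)) refl (2⁻ n)) ,
    ≤-by (½ ℚ.* (1ℚ ℚ.- 2⁻ n) ℚ.+ ½ ℚ.* (1ℚ ℚ.- ι (suc n) ℚ.* 2⁻ n))
      (ℚ.+-mono-≤ (0≤* (ℚ.<⇒≤ 0<½) (0≤-diff p)) (0≤* (ℚ.<⇒≤ 0<½) (0≤-diff q)))
      (trans (Q.solve 2 (λ a i → Q.con 1ℚ Q.:= (Q.con 1ℚ Q.:+ i) Q.:* (Q.con ½ Q.:* a) Q.:+ (Q.con ½ Q.:* (Q.con 1ℚ Q.:- a) Q.:+ Q.con ½ Q.:* (Q.con 1ℚ Q.:- i Q.:* a))) refl (2⁻ n) (ι (suc n)))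
        (cong (λ i → i ℚ.* (½ ℚ.* 2⁻ n) ℚ.+ (½ ℚ.* (1ℚ ℚ.- 2⁻ n) ℚ.+ ½ ℚ.* (1ℚ ℚ.- ι (suc n) ℚ.* 2⁻ n))) (sym (ι-suc (suc n)))))
    where module Q = +-*-Solver

0≤2⁻ : ∀ n → 0ℚ ℚ.≤ 2⁻ n
0≤2⁻ zero    = ℚ.<⇒≤ 0<1
0≤2⁻ (suc n) = 0≤* (ℚ.<⇒≤ 0<½) (0≤2⁻ n)

≼-2⁻-limit : ∀ {x y} C → (∀ n → x ≼ y ⊕ ⌜ 2⁻ n ⌝ ⊛ C) → x ≼ y
≼-2⁻-limit {x} {y} C h = ≼-limit λ ε 0<ε →
  let (B , 0<B , C≼B) = rational-bound C
      w = recip B 0<B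
      (n , k) = archimedean-recip (w ℚ.* ε) (0<* (0<recip B 0<B) 0<ε)
  in begin
    x                       ≤⟨ h n ⟩
    y ⊕ ⌜ 2⁻ n ⌝ ⊛ C        ≤⟨ ⊕-mono ≼-refl (⊛-mono (⌜⌝-mono (0≤2⁻ n)) (≼-trans (∣∣-nonneg C) C≼B)
                                 (⌜⌝-mono (ℚ.≤-trans (2⁻≤ n) (k n ℕ.≤-refl))) (≼-trans (x≼∣x∣ C) C≼B)) ⟩
    y ⊕ ⌜ w ℚ.* ε ⌝ ⊛ ⌜ B ⌝ ≈⟨ ⊕-cong ≈-refl (≈-sym (⌜⌝-* (w ℚ.* ε) B)) ⟩
    y ⊕ ⌜ w ℚ.* ε ℚ.* B ⌝   ≈⟨ ⊕-cong ≈-refl (≡⇒≈ (cong ⌜_⌝ (cancel B 0<B ε))) ⟩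
    y ⊕ ⌜ ε ⌝               ∎
  where
  cancel : ∀ B 0<B ε → recip B 0<B ℚ.* ε ℚ.* B ≡ ε
  cancel B 0<B ε = trans (ℚ.*-comm (recip B 0<B ℚ.* ε) B) (trans (sym (ℚ.*-assoc B (recip B 0<B) ε))
    (trans (cong (ℚ._* ε) (*-recip B 0<B)) (ℚ.*-identityˡ ε)))

-- A function on [0,1] ∩ ℚ with derivative 0, uniformly to second order: halving
-- the step n times divides the bound on the total increment by 2ⁿ.
module ZeroDerivative (f : ℚ → ℝ) (C : ℝ)
  (increment : ∀ c η → 0ℚ ℚ.≤ c → 0ℚ ℚ.≤ η → c ℚ.+ η ℚ.≤ 1ℚ → ∣ f (c ℚ.+ η) ⊝ f c ∣ ≼ ⌜ η ℚ.* η ⌝ ⊛ C) where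

  private
    bisected : ∀ n c η → 0ℚ ℚ.≤ c → 0ℚ ℚ.≤ η → c ℚ.+ η ℚ.≤ 1ℚ →
      ∣ f (c ℚ.+ η) ⊝ f c ∣ ≼ ⌜ 2⁻ n ⌝ ⊛ (⌜ η ℚ.* η ⌝ ⊛ C)
    bisected zero c η p q r = ≼-respʳ (solve 1 (λ a → a := con 1ℚ :* a) ≈-refl (⌜ η ℚ.* η ⌝ ⊛ C)) (increment c η p q r)
    bisected (suc n) c η p q r = ∣∣-resp
      (≈-trans (solve 3 (λ a b d → (a :- b) :+ (b :- d) := a :- d) ≈-refl (f ((c ℚ.+ k) ℚ.+ k)) (f (c ℚ.+ k)) (f c))
        (⊕-cong (≡⇒≈ (cong f (trans (ℚ.+-assoc c k k) (cong (c ℚ.+_) (half+half η))))) ≈-refl))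
      (≼-respʳ bounds (∣⊕∣
        (bisected n (c ℚ.+ k) k (ℚ.+-mono-≤ p 0≤k) 0≤k
          (ℚ.≤-trans (ℚ.≤-reflexive (trans (ℚ.+-assoc c k k) (cong (c ℚ.+_) (half+half η)))) r))
        (bisected n c k p 0≤k (ℚ.≤-trans (ℚ.+-monoʳ-≤ c k≤η) r))))
      where
      k = ½ ℚ.* η
      0≤k : 0ℚ ℚ.≤ k
      0≤k = 0≤* (ℚ.<⇒≤ 0<½) q
      k≤η : k ℚ.≤ η
      k≤η = ≤-by k 0≤k (sym (half+half η))
      bounds : ⌜ 2⁻ n ⌝ ⊛ (⌜ k ℚ.* k ⌝ ⊛ C) ⊕ ⌜ 2⁻ n ⌝ ⊛ (⌜ k ℚ.* k ⌝ ⊛ C) ≈ ⌜ 2⁻ suc n ⌝ ⊛ (⌜ η ℚ.* η ⌝ ⊛ C)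
      bounds = begin-equality
        ⌜ 2⁻ n ⌝ ⊛ (⌜ k ℚ.* k ⌝ ⊛ C) ⊕ ⌜ 2⁻ n ⌝ ⊛ (⌜ k ℚ.* k ⌝ ⊛ C) ≈⟨ solve 3 (λ a b c → a :* (b :* c) :+ a :* (b :* c) := (a :* (con (ι 2) :* b)) :* c) ≈-refl ⌜ 2⁻ n ⌝ ⌜ k ℚ.* k ⌝ C ⟩
        (⌜ 2⁻ n ⌝ ⊛ (⌜ ι 2 ⌝ ⊛ ⌜ k ℚ.* k ⌝)) ⊛ C              ≈⟨ ⊛-cong (⊛-cong ≈-refl (⌜⌝-* (ι 2) (k ℚ.* k))) ≈-refl ⟨
        (⌜ 2⁻ n ⌝ ⊛ ⌜ ι 2 ℚ.* (k ℚ.* k) ⌝) ⊛ C                ≈⟨ ⊛-cong (⌜⌝-* (2⁻ n) (ι 2 ℚ.* (k ℚ.* k))) ≈-refl ⟨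
        ⌜ 2⁻ n ℚ.* (ι 2 ℚ.* (k ℚ.* k)) ⌝ ⊛ C                  ≈⟨ ⊛-cong (≡⇒≈ (cong ⌜_⌝ (Q.solve 2 (λ a e → a Q.:* (Q.con (ι 2) Q.:* ((Q.con ½ Q.:* e) Q.:* (Q.con ½ Q.:* e))) Q.:= (Q.con ½ Q.:* a) Q.:* (e Q.:* e)) refl (2⁻ n) η))) ≈-refl ⟩
        ⌜ 2⁻ suc n ℚ.* (η ℚ.* η) ⌝ ⊛ C                        ≈⟨ ⊛-cong (⌜⌝-* (2⁻ suc n) (η ℚ.* η)) ≈-refl ⟩
        (⌜ 2⁻ suc n ⌝ ⊛ ⌜ η ℚ.* η ⌝) ⊛ C                      ≈⟨ solve 3 (λ a b c → (a :* b) :* c := a :* (b :* c)) ≈-refl ⌜ 2⁻ suc n ⌝ ⌜ η ℚ.* η ⌝ C ⟩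
        ⌜ 2⁻ suc n ⌝ ⊛ (⌜ η ℚ.* η ⌝ ⊛ C)                      ∎
        where module Q = +-*-Solver

    ends : ∀ n → ∣ f 1ℚ ⊝ f 0ℚ ∣ ≼ ⌜ 2⁻ n ⌝ ⊛ (⌜ 1ℚ ⌝ ⊛ C)
    ends n = bisected n 0ℚ 1ℚ ℚ.≤-refl (ℚ.<⇒≤ 0<1) ℚ.≤-refl

  constant : f 1ℚ ≈ f 0ℚ
  constant = ≼-antisym (≼-2⁻-limit (⌜ 1ℚ ⌝ ⊛ C) λ n → ∣∣≼⇒≼ (ends n))
    (≼-2⁻-limit (⌜ 1ℚ ⌝ ⊛ C) λ n → ∣∣≼⇒≼ (∣∣-swap (ends n)))

-- If f′ = k f and g′ = − k g to second order in η, then f g is constant to second order.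
product-increment : ∀ {f f′ g g′ k A B M N d} η → 0ℚ ℚ.≤ η → η ℚ.≤ 1ℚ →
  ∣ (f′ ⊝ f) ⊝ k ⊛ f ∣ ≼ ⌜ η ℚ.* η ⌝ ⊛ A → ∣ (g′ ⊝ g) ⊕ k ⊛ g ∣ ≼ ⌜ η ℚ.* η ⌝ ⊛ B →
  ∣ f ∣ ≼ M → ∣ g ∣ ≼ N → ∣ g′ ∣ ≼ N → ∣ k ∣ ≼ ⌜ η ⌝ ⊛ d → ⌜ 0ℚ ⌝ ≼ d →
  ∣ f′ ⊛ g′ ⊝ f ⊛ g ∣ ≼ ⌜ η ℚ.* η ⌝ ⊛ (A ⊛ N ⊕ (M ⊕ d ⊛ M) ⊛ B ⊕ d ⊛ d ⊛ (M ⊛ N))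
product-increment {f} {f′} {g} {g′} {k} {A} {B} {M} {N} {d} η 0≤η η≤1 hf hg ∣f∣ ∣g∣ ∣g′∣ ∣k∣ 0≼d = ∣∣-resp
  -- Up to the remainders, f′ = (1 + k) f and g′ = (1 - k) g. The linear terms cancel in (1 + k)(1 -
  -- k) = 1 - k², leaving the two remainders and k² f g.
  (solve 5 (λ f f′ g g′ k → (((f′ :- f) :- k :* f) :* g′ :+ (f :+ k :* f) :* ((g′ :- g) :+ k :* g)) :- (k :* k) :* (f :* g) := f′ :* g′ :- f :* g)
    ≈-refl f f′ g g′ k)
  (≼-respʳ eq (∣⊝∣ (∣⊕∣ (∣⊛∣ hf ∣g′∣) (∣⊛∣ (∣⊕∣ ∣f∣ (∣⊛∣ (≼-trans ∣k∣ ηd≼d) ∣f∣)) hg)) (∣⊛∣ (∣⊛∣ ∣k∣ ∣k∣) (∣⊛∣ ∣f∣ ∣g∣))))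
  where
  ηd≼d : ⌜ η ⌝ ⊛ d ≼ d
  ηd≼d = ≼-respʳ (solve 1 (λ d → con 1ℚ :* d := d) ≈-refl d) (⊛-monoʳ d 0≼d (⌜⌝-mono η≤1))
  e = ⌜ η ℚ.* η ⌝
  eq : e ⊛ A ⊛ N ⊕ (M ⊕ d ⊛ M) ⊛ (e ⊛ B) ⊕ (⌜ η ⌝ ⊛ d) ⊛ (⌜ η ⌝ ⊛ d) ⊛ (M ⊛ N) ≈
    e ⊛ (A ⊛ N ⊕ (M ⊕ d ⊛ M) ⊛ B ⊕ d ⊛ d ⊛ (M ⊛ N))
  eq = ≈-trans (⊕-cong ≈-refl (≈-trans (solve 4 (λ η d M N → (η :* d) :* (η :* d) :* (M :* N) := (η :* η) :* (d :* d :* (M :* N))) ≈-refl ⌜ η ⌝ d M N)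
      (⊛-cong (≈-sym (⌜⌝-* η η)) ≈-refl)))
    (solve 6 (λ e A B M N d → e :* A :* N :+ (M :+ d :* M) :* (e :* B) :+ e :* (d :* d :* (M :* N))
       := e :* (A :* N :+ (M :+ d :* M) :* B :+ d :* d :* (M :* N))) ≈-refl e A B M N d)

∣⌜⌝⊛∣≼ : ∀ {c x r} → 0ℚ ℚ.≤ c → c ℚ.≤ 1ℚ → ∣ x ∣ ≼ r → ∣ ⌜ c ⌝ ⊛ x ∣ ≼ r
∣⌜⌝⊛∣≼ {c} {x} {r} 0≤c c≤1 h = ≼-respʳ (solve 1 (λ r → con 1ℚ :* r := r) ≈-refl r)
  (∣⊛∣ (≼-trans (∣⌜⌝∣ 0≤c) (⌜⌝-mono c≤1)) h)

square-scaled : ∀ η y → (⌜ η ⌝ ⊛ y) ⊛ (⌜ η ⌝ ⊛ y) ≈ ⌜ η ℚ.* η ⌝ ⊛ (y ⊛ y)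
square-scaled η y = ≈-trans (solve 2 (λ η y → (η :* y) :* (η :* y) := (η :* η) :* (y :* y)) ≈-refl ⌜ η ⌝ y)
  (⊛-cong (≈-sym (⌜⌝-* η η)) ≈-refl)

c≤c+η : ∀ {c η} → 0ℚ ℚ.≤ η → c ℚ.≤ c ℚ.+ η
c≤c+η {η = η} p = ≤-by η p refl

η≤c+η : ∀ {c η} → 0ℚ ℚ.≤ c → η ℚ.≤ c ℚ.+ η
η≤c+η {c} {η} p = ≤-by c p (ℚ.+-comm c η)

module _ (x y : ℝ) where
  private
    r = ∣ x ∣ ⊕ ∣ y ∣
    E = Exp r
    f g : ℚ → ℝ
    f c = Exp (x ⊕ ⌜ c ⌝ ⊛ y)
    g c = Exp (⊖ (⌜ c ⌝ ⊛ y))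
    A = y ⊛ y ⊛ E

    ∣y∣≼r : ∣ y ∣ ≼ r
    ∣y∣≼r = ≼-by (∣ x ∣) (∣∣-nonneg x) (solve 2 (λ a b → a :+ b := b :+ a) ≈-refl (∣ x ∣) (∣ y ∣))

    module _ (c : ℚ) (0≤c : 0ℚ ℚ.≤ c) (c≤1 : c ℚ.≤ 1ℚ) where
      ∣f-arg∣ : ∣ x ⊕ ⌜ c ⌝ ⊛ y ∣ ≼ r
      ∣f-arg∣ = ∣⊕∣ ≼-refl (∣⌜⌝⊛∣≼ 0≤c c≤1 ≼-refl)
      ∣g-arg∣ : ∣ ⊖ (⌜ c ⌝ ⊛ y) ∣ ≼ r
      ∣g-arg∣ = ≼-trans (∣⊖∣ (⌜ c ⌝ ⊛ y)) (∣⌜⌝⊛∣≼ 0≤c c≤1 ∣y∣≼r)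

    module _ (c η : ℚ) (0≤c : 0ℚ ℚ.≤ c) (0≤η : 0ℚ ℚ.≤ η) (c+η≤1 : c ℚ.+ η ℚ.≤ 1ℚ) where
      c≤1 = ℚ.≤-trans (c≤c+η {c} {η} 0≤η) c+η≤1
      0≤c+η = ℚ.+-mono-≤ 0≤c 0≤η
      k = ⌜ η ⌝ ⊛ y
      e = ⌜ η ℚ.* η ⌝

      f-arg : x ⊕ ⌜ c ℚ.+ η ⌝ ⊛ y ≈ (x ⊕ ⌜ c ⌝ ⊛ y) ⊕ k
      f-arg = ≈-trans (⊕-cong ≈-refl (⊛-cong (⌜⌝-+ c η) ≈-refl))
        (solve 4 (λ x y c η → x :+ (c :+ η) :* y := (x :+ c :* y) :+ η :* y) ≈-refl x y ⌜ c ⌝ ⌜ η ⌝)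
      g-arg : ⊖ (⌜ c ℚ.+ η ⌝ ⊛ y) ≈ ⊖ (⌜ c ⌝ ⊛ y) ⊕ ⊖ k
      g-arg = ≈-trans (⊖-cong (⊛-cong (⌜⌝-+ c η) ≈-refl))
        (solve 3 (λ y c η → :- ((c :+ η) :* y) := :- (c :* y) :+ :- (η :* y)) ≈-refl y ⌜ c ⌝ ⌜ η ⌝)

      f-increment : ∣ (f (c ℚ.+ η) ⊝ f c) ⊝ k ⊛ f c ∣ ≼ e ⊛ A
      f-increment = ∣∣-resp (⊕-cong (⊕-cong (Exp-cong (≈-sym f-arg)) ≈-refl) ≈-refl)
        (≼-respʳ (≈-trans (⊛-cong (square-scaled η y) ≈-refl) (solve 3 (λ e y E → e :* y :* E := e :* (y :* E)) ≈-refl e (y ⊛ y) E))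
          (Exp-increment (∣f-arg∣ c 0≤c c≤1) (∣∣-resp f-arg (∣f-arg∣ (c ℚ.+ η) 0≤c+η c+η≤1))))

      g-increment : ∣ (g (c ℚ.+ η) ⊝ g c) ⊕ k ⊛ g c ∣ ≼ e ⊛ A
      g-increment = ∣∣-resp
        (≈-trans (⊕-cong (⊕-cong (Exp-cong (≈-sym g-arg)) ≈-refl) ≈-refl)
          (solve 3 (λ a k g → a :- (:- k) :* g := a :+ k :* g) ≈-refl (g (c ℚ.+ η) ⊝ g c) k (g c)))
        (≼-respʳ (≈-trans (⊛-cong (≈-trans (solve 1 (λ k → (:- k) :* (:- k) := k :* k) ≈-refl k) (square-scaled η y)) ≈-refl)
            (solve 3 (λ e y E → e :* y :* E := e :* (y :* E)) ≈-refl e (y ⊛ y) E))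
          (Exp-increment (∣g-arg∣ c 0≤c c≤1) (∣∣-resp g-arg (∣g-arg∣ (c ℚ.+ η) 0≤c+η c+η≤1))))

      fg-increment : ∣ f (c ℚ.+ η) ⊛ g (c ℚ.+ η) ⊝ f c ⊛ g c ∣ ≼ e ⊛ (A ⊛ E ⊕ (E ⊕ ∣ y ∣ ⊛ E) ⊛ A ⊕ ∣ y ∣ ⊛ ∣ y ∣ ⊛ (E ⊛ E))
      fg-increment = product-increment η 0≤η (ℚ.≤-trans (η≤c+η {c} {η} 0≤c) c+η≤1) f-increment g-increment
        (∣Exp∣ (∣f-arg∣ c 0≤c c≤1)) (∣Exp∣ (∣g-arg∣ c 0≤c c≤1)) (∣Exp∣ (∣g-arg∣ (c ℚ.+ η) 0≤c+η c+η≤1))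
        (∣⊛∣ (∣⌜⌝∣ 0≤η) ≼-refl) (∣∣-nonneg y)

  -- The product exp (x + c y) exp (- c y) has derivative zero for c in [0, 1], and its values at
  -- the ends are compared. The case x = 0 gives the inverse of exp y, which then turns this into
  -- the addition formula without the double sums of a Cauchy product.
  Exp-shift : Exp (x ⊕ y) ⊛ Exp (⊖ y) ≈ Exp x
  Exp-shift = begin-equality
    Exp (x ⊕ y) ⊛ Exp (⊖ y) ≈⟨ ⊛-cong (Exp-cong (solve 2 (λ x y → x :+ y := x :+ con 1ℚ :* y) ≈-refl x y))
                                 (Exp-cong (solve 1 (λ y → :- y := :- (con 1ℚ :* y)) ≈-refl y)) ⟩
    f 1ℚ ⊛ g 1ℚ             ≈⟨ ZeroDerivative.constant (λ c → f c ⊛ g c) _ fg-increment ⟩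
    f 0ℚ ⊛ g 0ℚ             ≈⟨ ⊛-cong (Exp-cong (solve 2 (λ x y → x :+ con 0ℚ :* y := x) ≈-refl x y))
                                 (≈-trans (Exp-cong (solve 1 (λ y → :- (con 0ℚ :* y) := con 0ℚ) ≈-refl y)) Exp-0) ⟩
    Exp x ⊛ ⌜ 1ℚ ⌝          ≈⟨ solve 1 (λ a → a :* con 1ℚ := a) ≈-refl (Exp x) ⟩
    Exp x                   ∎

Exp-inverse : ∀ y → Exp y ⊛ Exp (⊖ y) ≈ ⌜ 1ℚ ⌝
Exp-inverse y = begin-equality
  Exp y ⊛ Exp (⊖ y)            ≈⟨ ⊛-cong (Exp-cong (solve 1 (λ y → y := con 0ℚ :+ y) ≈-refl y)) ≈-refl ⟩
  Exp (⌜ 0ℚ ⌝ ⊕ y) ⊛ Exp (⊖ y) ≈⟨ Exp-shift ⌜ 0ℚ ⌝ y ⟩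
  Exp ⌜ 0ℚ ⌝                   ≈⟨ Exp-0 ⟩
  ⌜ 1ℚ ⌝                       ∎

Exp-⊕ : ∀ x y → Exp (x ⊕ y) ≈ Exp x ⊛ Exp y
Exp-⊕ x y = begin-equality
  Exp (x ⊕ y)                         ≈⟨ solve 1 (λ a → a := a :* con 1ℚ) ≈-refl (Exp (x ⊕ y)) ⟩
  Exp (x ⊕ y) ⊛ ⌜ 1ℚ ⌝                ≈⟨ ⊛-cong ≈-refl (Exp-inverse y) ⟨
  Exp (x ⊕ y) ⊛ (Exp y ⊛ Exp (⊖ y))   ≈⟨ solve 3 (λ a b c → a :* (b :* c) := (a :* c) :* b) ≈-refl (Exp (x ⊕ y)) (Exp y) (Exp (⊖ y)) ⟩
  (Exp (x ⊕ y) ⊛ Exp (⊖ y)) ⊛ Exp y   ≈⟨ ⊛-cong (Exp-shift x y) ≈-refl ⟩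
  Exp x ⊛ Exp y                       ∎

Exp-half : ∀ x → Exp x ≈ Exp (⌜ ½ ⌝ ⊛ x) ⊛ Exp (⌜ ½ ⌝ ⊛ x)
Exp-half x = ≈-trans (Exp-cong (solve 1 (λ x → x := con ½ :* x :+ con ½ :* x) ≈-refl x)) (Exp-⊕ (⌜ ½ ⌝ ⊛ x) (⌜ ½ ⌝ ⊛ x))

-- For negative x the series shows no sign; a square does.
0≼Exp : ∀ x → ⌜ 0ℚ ⌝ ≼ Exp x
0≼Exp x = ≼-respʳ (≈-sym (Exp-half x)) (0≼-square (Exp (⌜ ½ ⌝ ⊛ x)))

-- The error C x² of the first-order bound near 0 becomes C x² / 2ⁿ after n doublings, because g² ≥ 2 g − 1.
1+x≼Exp : ∀ x → ⌜ 1ℚ ⌝ ⊕ x ≼ Exp x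
1+x≼Exp x = ≼-2⁻-limit (x ⊛ x ⊛ E) λ n → doubled n x ≼-refl
  where
  E = Exp (∣ x ∣)
  doubled : ∀ n y → ∣ y ∣ ≼ ∣ x ∣ → ⌜ 1ℚ ⌝ ⊕ y ≼ Exp y ⊕ ⌜ 2⁻ n ⌝ ⊛ (y ⊛ y ⊛ E)
  doubled zero y p = begin
    ⌜ 1ℚ ⌝ ⊕ y                                ≈⟨ solve 1 (λ y → con 1ℚ :+ y := con 1ℚ :+ y :* con 1ℚ) ≈-refl y ⟩
    ⌜ 1ℚ ⌝ ⊕ y ⊛ ⌜ 1ℚ ⌝                       ≈⟨ ⊕-cong Exp-0 (⊛-cong ≈-refl Exp-0) ⟨
    Exp ⌜ 0ℚ ⌝ ⊕ y ⊛ Exp ⌜ 0ℚ ⌝               ≤⟨ ∣∣≼⇒≼ (∣∣-swap (∣∣-resp (solve 3 (λ a b y → (a :- b) :- y :* b := a :- (b :+ y :* b)) ≈-refl (Exp (⌜ 0ℚ ⌝ ⊕ y)) (Exp ⌜ 0ℚ ⌝) y)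
      (Exp-increment (≼-trans (∣⌜⌝∣ ℚ.≤-refl) (∣∣-nonneg x)) (∣∣-resp (solve 1 (λ y → y := con 0ℚ :+ y) ≈-refl y) p)))) ⟩
    Exp (⌜ 0ℚ ⌝ ⊕ y) ⊕ y ⊛ y ⊛ E              ≈⟨ ⊕-cong (Exp-cong (solve 1 (λ y → con 0ℚ :+ y := y) ≈-refl y)) (solve 1 (λ a → a := con 1ℚ :* a) ≈-refl (y ⊛ y ⊛ E)) ⟩
    Exp y ⊕ ⌜ 1ℚ ⌝ ⊛ (y ⊛ y ⊛ E)              ∎
  doubled (suc n) y p = ≼-by ((g ⊝ ⌜ 1ℚ ⌝) ⊛ (g ⊝ ⌜ 1ℚ ⌝) ⊕ ⌜ ι 2 ⌝ ⊛ ((g ⊕ e) ⊝ (⌜ 1ℚ ⌝ ⊕ z)))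
    (0≼⊕ (0≼-square (g ⊝ ⌜ 1ℚ ⌝)) (⊛-nonneg (⌜⌝-mono (0≤ι 2)) (0≼⊝ (doubled n z (∣⌜⌝⊛∣≼ (ℚ.<⇒≤ 0<½) (ℚ.<⇒≤ ½<1) p)))))
    (≈-trans (⊕-cong (Exp-half y) (⊛-cong (⌜⌝-* ½ (2⁻ n)) ≈-refl))
      (solve 4 (λ g a y E → g :* g :+ (con ½ :* a) :* (y :* y :* E) :=
          (con 1ℚ :+ y) :+ ((g :- con 1ℚ) :* (g :- con 1ℚ) :+ con (ι 2) :* ((g :+ a :* ((con ½ :* y) :* (con ½ :* y) :* E)) :- (con 1ℚ :+ con ½ :* y)))) ≈-refl
        g ⌜ 2⁻ n ⌝ y E))
    where
    z = ⌜ ½ ⌝ ⊛ y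
    g = Exp z
    e = ⌜ 2⁻ n ⌝ ⊛ (z ⊛ z ⊛ E)
    ½<1 : ½ ℚ.< 1ℚ
    ½<1 = ℚ.*<* (ℤ.+<+ (ℕ.s≤s (ℕ.s≤s ℕ.z≤n)))

-- The logarithm

opaque
  Inv : (y : ℝ) → 0ℝ < y → ℝ
  Inv = inv

  Artanh : (z : ℝ) → ∣ z ∣<1 → ℝ
  Artanh = artanh

opaque
  unfolding Inv

  Inv-inverseʳ : ∀ y (0<y : 0ℝ < y) → y ⊛ Inv y 0<y ≈ ⌜ 1ℚ ⌝
  Inv-inverseʳ = inv-inverseʳ

  Inv-nonneg : ∀ y (0<y : 0ℝ < y) → ⌜ 0ℚ ⌝ ≼ Inv y 0<y
  Inv-nonneg = inv-nonneg

opaque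
  unfolding Artanh

  Artanh-⟶ : ∀ z z<1 → ∑< (artanh-terms z) ⟶ Artanh z z<1
  Artanh-⟶ = artanh-⟶

opaque
  unfolding _⊕_ ∣_∣

  0<⌜⌝ : ∀ {q} → 0ℚ ℚ.< q → 0ℝ < ⌜ q ⌝
  0<⌜⌝ = 0<fromℚ

  ∣∣<1⇒≼ : ∀ {z} → ∣ z ∣<1 → ∃ λ s → 0ℚ ℚ.< s × s ℚ.≤ 1ℚ × ∣ z ∣ ≼ ⌜ 1ℚ ℚ.- s ⌝
  ∣∣<1⇒≼ {z} (s , 0<s , N , h) = s , 0<s ,
    subst₂ ℚ._≤_ (Q.solve 1 (λ s → Q.con 0ℚ Q.:+ s Q.:= s) refl s) (Q.solve 1 (λ s → (Q.con 1ℚ Q.:- s) Q.:+ s Q.:= Q.con 1ℚ) refl s)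
      (ℚ.+-monoˡ-≤ s (ℚ.≤-trans (ℚ.0≤∣p∣ (seq z N)) (h N ℕ.≤-refl))) ,
    ∣∣-lub {z} {⌜ 1ℚ ℚ.- s ⌝}
      (λ ε 0<ε → N , λ n r → ℚ.≤-trans (≤∣∣ (seq z n)) (ℚ.≤-trans (h n r) (≤-by ε (ℚ.<⇒≤ 0<ε) refl)))
      (λ ε 0<ε → N , λ n r → ℚ.≤-trans (≤∣∣ (ℚ.- seq z n)) (ℚ.≤-trans (ℚ.≤-reflexive (ℚ.∣-p∣≡∣p∣ (seq z n)))
        (ℚ.≤-trans (h n r) (≤-by ε (ℚ.<⇒≤ 0<ε) refl))))
    where module Q = +-*-Solver

  ≼⇒∣∣<1 : ∀ {z} s → 0ℚ ℚ.< s → ∣ z ∣ ≼ ⌜ 1ℚ ℚ.- s ⌝ → ∣ z ∣<1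
  ≼⇒∣∣<1 {z} s 0<s h =
    let (M , p) = ≼-trans {z} {∣ z ∣} {⌜ 1ℚ ℚ.- s ⌝} (x≼∣x∣ z) h (½ ℚ.* s) (0<half 0<s)
        (N , q) = ≼-trans {⊖ z} {∣ z ∣} {⌜ 1ℚ ℚ.- s ⌝} (⊖x≼∣x∣ z) h (½ ℚ.* s) (0<half 0<s)
        eq = Q.solve 1 (λ s → (Q.con 1ℚ Q.:- s) Q.:+ Q.con ½ Q.:* s Q.:= Q.con 1ℚ Q.:- Q.con ½ Q.:* s) refl s
    -- `_≼_` bounds the terms only up to a positive slack, and half of the margin s is spent on it.
    in ½ ℚ.* s , 0<half 0<s , M ℕ.⊔ N , λ n r → ∣∣-≤
      (ℚ.≤-trans (ℚ.neg-antimono-≤ (ℚ.≤-trans (q n (proj₂ (lub₂ {M} r))) (ℚ.≤-reflexive eq)))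
        (ℚ.≤-reflexive (Q.solve 1 (λ z → Q.:- (Q.:- z) Q.:= z) refl (seq z n))))
      (ℚ.≤-trans (p n (proj₁ (lub₂ r))) (ℚ.≤-reflexive eq))
    where module Q = +-*-Solver

-- Doubling by recursion, so that `t ↑ double (suc k)` unfolds to two more factors t.
double : ℕ → ℕ
double zero    = zero
double (suc k) = suc (suc (double k))

double≡2* : ∀ k → double k ≡ 2 ℕ.* k
double≡2* zero    = refl
double≡2* (suc k) = trans (cong (λ m → suc (suc m)) (double≡2* k)) (cong suc (sym (ℕ.+-suc k (k ℕ.+ 0))))

≤double : ∀ k → k ℕ.≤ double k
≤double zero    = ℕ.z≤n
≤double (suc k) = ℕ.s≤s (ℕ.m≤n⇒m≤1+n (≤double k))

artanh-terms-odd : ∀ t k → artanh-terms t k ≈ t ↑ suc (double k) ⊛ ⌜ 1/odd k ⌝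
artanh-terms-odd t k = ⊛-cong (⊛-cong ≈-refl (even k)) ≈-refl
  where
  even : ∀ k → (t ⊛ t) ↑ k ≈ t ↑ double k
  even zero    = ≈-refl
  even (suc k) = ≈-trans (⊛-cong ≈-refl (even k)) (solve 2 (λ t a → (t :* t) :* a := t :* (t :* a)) ≈-refl t (t ↑ double k))

ι⊛1/odd : ∀ k x → ⌜ ι (suc (double k)) ⌝ ⊛ x ⊛ ⌜ 1/odd k ⌝ ≈ x
ι⊛1/odd k x = begin-equality
  ⌜ ι (suc (double k)) ⌝ ⊛ x ⊛ ⌜ 1/odd k ⌝   ≈⟨ solve 3 (λ n x c → n :* x :* c := (n :* c) :* x) ≈-refl ⌜ ι (suc (double k)) ⌝ x ⌜ 1/odd k ⌝ ⟩
  (⌜ ι (suc (double k)) ⌝ ⊛ ⌜ 1/odd k ⌝) ⊛ x ≈⟨ ⊛-cong (≈-trans (≈-sym (⌜⌝-* (ι (suc (double k))) (1/odd k))) (≡⇒≈ (cong ⌜_⌝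
    (trans (cong (λ m → ι (suc m) ℚ.* 1/odd k) (double≡2* k)) (ι*frac 1 (suc (2 ℕ.* k))))))) ≈-refl ⟩
  ⌜ 1ℚ ⌝ ⊛ x                                 ≈⟨ solve 1 (λ x → con 1ℚ :* x := x) ≈-refl x ⟩
  x                                          ∎

-- The sum is the truncated derivative of artanh. Multiplying by 1 - t² instead of dividing keeps
-- the increment bound free of inverses.
geometric : ∀ t n → (⌜ 1ℚ ⌝ ⊝ t ⊛ t) ⊛ ∑< (λ k → t ↑ double k) n ≈ ⌜ 1ℚ ⌝ ⊝ t ↑ double n
geometric t zero = solve 1 (λ t → (con 1ℚ :- t :* t) :* con 0ℚ := con 1ℚ :- con 1ℚ) ≈-refl t
geometric t (suc n) = begin-equality
  (⌜ 1ℚ ⌝ ⊝ t ⊛ t) ⊛ (G ⊕ a)                     ≈⟨ solve 3 (λ t G a → (con 1ℚ :- t :* t) :* (G :+ a) := (con 1ℚ :- t :* t) :* G :+ (a :- t :* (t :* a))) ≈-refl t G a ⟩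
  (⌜ 1ℚ ⌝ ⊝ t ⊛ t) ⊛ G ⊕ (a ⊝ t ⊛ (t ⊛ a))       ≈⟨ ⊕-cong (geometric t n) ≈-refl ⟩
  (⌜ 1ℚ ⌝ ⊝ a) ⊕ (a ⊝ t ⊛ (t ⊛ a))               ≈⟨ solve 2 (λ a b → (con 1ℚ :- a) :+ (a :- b) := con 1ℚ :- b) ≈-refl a (t ⊛ (t ⊛ a)) ⟩
  ⌜ 1ℚ ⌝ ⊝ t ⊛ (t ⊛ a)                           ∎
  where
  G = ∑< (λ k → t ↑ double k) n
  a = t ↑ double n

-- All arguments stay in |t| ≤ r = 1 - s, at distance at least s from the singularities ±1 of
-- artanh; σ = 1/s then bounds the inverses of 1 - t and 1 + t.
module UnitInterval (s : ℚ) (0<s : 0ℚ ℚ.< s) (s≤1 : s ℚ.≤ 1ℚ) where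

  σ : ℚ
  σ = recip s 0<s

  r : ℝ
  r = ⌜ 1ℚ ℚ.- s ⌝

  0≤s = ℚ.<⇒≤ 0<s

  0≼σ : ⌜ 0ℚ ⌝ ≼ ⌜ σ ⌝
  0≼σ = ⌜⌝-mono (ℚ.<⇒≤ (0<recip s 0<s))

  0≼r : ⌜ 0ℚ ⌝ ≼ r
  0≼r = ⌜⌝-mono (0≤-diff s≤1)

  r≈ : r ≈ ⌜ 1ℚ ⌝ ⊝ ⌜ s ⌝
  r≈ = ≈-trans (⌜⌝-+ 1ℚ (ℚ.- s)) (⊕-cong ≈-refl (⌜⌝-neg s))

  r≼1 : r ≼ ⌜ 1ℚ ⌝
  r≼1 = ≼-by ⌜ s ⌝ (⌜⌝-mono 0≤s) (≈-trans (solve 1 (λ s → con 1ℚ := (con 1ℚ :- s) :+ s) ≈-refl ⌜ s ⌝) (⊕-cong (≈-sym r≈) ≈-refl))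

  sσ : ⌜ s ⌝ ⊛ ⌜ σ ⌝ ≈ ⌜ 1ℚ ⌝
  sσ = ≈-trans (≈-sym (⌜⌝-* s σ)) (≡⇒≈ (cong ⌜_⌝ (*-recip s 0<s)))

  s⊛-cancel : ∀ {x y} → ⌜ s ⌝ ⊛ x ≼ y → x ≼ ⌜ σ ⌝ ⊛ y
  s⊛-cancel {x} {y} h = begin
    x                      ≈⟨ solve 1 (λ x → x := con 1ℚ :* x) ≈-refl x ⟩
    ⌜ 1ℚ ⌝ ⊛ x             ≈⟨ ⊛-cong sσ ≈-refl ⟨
    ⌜ s ⌝ ⊛ ⌜ σ ⌝ ⊛ x      ≈⟨ solve 3 (λ s σ x → s :* σ :* x := σ :* (s :* x)) ≈-refl ⌜ s ⌝ ⌜ σ ⌝ x ⟩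
    ⌜ σ ⌝ ⊛ (⌜ s ⌝ ⊛ x)    ≤⟨ ⊛-monoˡ ⌜ σ ⌝ 0≼σ h ⟩
    ⌜ σ ⌝ ⊛ y              ∎

  Inv≼σ : ∀ y (0<y : 0ℝ < y) → ⌜ s ⌝ ≼ y → ∣ Inv y 0<y ∣ ≼ ⌜ σ ⌝
  Inv≼σ y 0<y s≼y = ≼-trans (nonneg⇒∣∣≼ (Inv-nonneg y 0<y)) (≼-respʳ (solve 1 (λ σ → σ :* con 1ℚ := σ) ≈-refl ⌜ σ ⌝)
    (s⊛-cancel (≼-respʳ (Inv-inverseʳ y 0<y) (⊛-monoʳ (Inv y 0<y) (Inv-nonneg y 0<y) s≼y))))

  -- Bernoulli's inequality in reciprocal form, which gives rⁿ the explicit rate 1 / (1 + n s). The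
  -- inductive step loses exactly rⁿ s² (1 + n).
  ↑-bernoulli : ∀ n → r ↑ n ⊛ (⌜ 1ℚ ⌝ ⊕ ⌜ ι n ⌝ ⊛ ⌜ s ⌝) ≼ ⌜ 1ℚ ⌝
  ↑-bernoulli zero = ≈⇒≼ (solve 1 (λ s → con 1ℚ :* (con 1ℚ :+ con 0ℚ :* s) := con 1ℚ) ≈-refl ⌜ s ⌝)
  ↑-bernoulli (suc n) = ≼-trans (≼-by (r ↑ n ⊛ ((⌜ s ⌝ ⊛ ⌜ s ⌝) ⊛ (⌜ 1ℚ ⌝ ⊕ ⌜ ι n ⌝)))
    (⊛-nonneg (0≼↑ 0≼r n) (⊛-nonneg (0≼-square ⌜ s ⌝) (0≼⊕ 0≼1 (⌜⌝-mono (0≤ι n)))))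
    (≈-sym (≈-trans (⊕-cong (⊛-cong (⊛-cong r≈ ≈-refl) (⊕-cong ≈-refl (⊛-cong (≈-trans (≡⇒≈ (cong ⌜_⌝ (ι-suc n))) (⌜⌝-+ 1ℚ (ι n))) ≈-refl))) ≈-refl)
      (solve 3 (λ s a n → (con 1ℚ :- s) :* a :* (con 1ℚ :+ (con 1ℚ :+ n) :* s) :+ a :* ((s :* s) :* (con 1ℚ :+ n)) := a :* (con 1ℚ :+ n :* s)) ≈-refl ⌜ s ⌝ (r ↑ n) ⌜ ι n ⌝))))
    (↑-bernoulli n)

  ↑-⟶0 : (λ n → r ↑ double n) ⟶ ⌜ 0ℚ ⌝
  ↑-⟶0 ε 0<ε =
    let w = recip ε 0<ε
        (N , h) = archimedean (w ℚ.* σ)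
    in N , λ n N≤n → ∣∣-resp (solve 1 (λ a → :- a := con 0ℚ :- a) ≈-refl (r ↑ double n))
      (≼-trans (∣⊖∣ (r ↑ double n)) (≼-trans (nonneg⇒∣∣≼ (0≼↑ 0≼r (double n)))
        (small (double n) (ℚ.≤-trans h (ι-mono (ℕ.≤-trans N≤n (≤double n)))))))
    where
    small : ∀ m → recip ε 0<ε ℚ.* σ ℚ.≤ ι m → r ↑ m ≼ ⌜ ε ⌝
    small m h = begin
      a                                                  ≈⟨ solve 1 (λ a → a := a :* con 1ℚ) ≈-refl a ⟩
      a ⊛ ⌜ 1ℚ ⌝                                         ≤⟨ ⊛-monoˡ a (0≼↑ 0≼r m) (⌜⌝-mono 1≤) ⟩
      a ⊛ ⌜ ε ℚ.* (1ℚ ℚ.+ ι m ℚ.* s) ⌝                   ≈⟨ ⊛-cong ≈-refl (≈-trans (⌜⌝-* ε (1ℚ ℚ.+ ι m ℚ.* s)) (⊛-cong ≈-refl (≈-trans (⌜⌝-+ 1ℚ (ι m ℚ.* s)) (⊕-cong ≈-refl (⌜⌝-* (ι m) s))))) ⟩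
      a ⊛ (⌜ ε ⌝ ⊛ (⌜ 1ℚ ⌝ ⊕ ⌜ ι m ⌝ ⊛ ⌜ s ⌝))           ≈⟨ solve 3 (λ a e b → a :* (e :* b) := e :* (a :* b)) ≈-refl a ⌜ ε ⌝ (⌜ 1ℚ ⌝ ⊕ ⌜ ι m ⌝ ⊛ ⌜ s ⌝) ⟩
      ⌜ ε ⌝ ⊛ (a ⊛ (⌜ 1ℚ ⌝ ⊕ ⌜ ι m ⌝ ⊛ ⌜ s ⌝))           ≤⟨ ⊛-monoˡ ⌜ ε ⌝ (⌜⌝-mono (ℚ.<⇒≤ 0<ε)) (↑-bernoulli m) ⟩
      ⌜ ε ⌝ ⊛ ⌜ 1ℚ ⌝                                     ≈⟨ solve 1 (λ a → a :* con 1ℚ := a) ≈-refl ⌜ ε ⌝ ⟩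
      ⌜ ε ⌝                                              ∎
      where
      a = r ↑ m
      w = recip ε 0<ε
      0≤εs = 0≤* (ℚ.<⇒≤ 0<ε) 0≤s
      1≤ : 1ℚ ℚ.≤ ε ℚ.* (1ℚ ℚ.+ ι m ℚ.* s)
      1≤ = ≤-by (ε ℚ.+ (ε ℚ.* s) ℚ.* (ι m ℚ.- w ℚ.* σ)) (ℚ.+-mono-≤ (ℚ.<⇒≤ 0<ε) (0≤* 0≤εs (0≤-diff h)))
        (trans (Q.solve 5 (λ e i s w v → e Q.:* (Q.con 1ℚ Q.:+ i Q.:* s) Q.:= (e Q.:* w) Q.:* (s Q.:* v) Q.:+ (e Q.:+ (e Q.:* s) Q.:* (i Q.:- w Q.:* v))) refl ε (ι m) s w σ)
          (cong (ℚ._+ (ε ℚ.+ (ε ℚ.* s) ℚ.* (ι m ℚ.- w ℚ.* σ))) (cong₂ ℚ._*_ (*-recip ε 0<ε) (*-recip s 0<s))))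
        where module Q = +-*-Solver

  -- With G m = s (rᵐ)′ + rᵐ, the differences G m − G (m+1) = s² (rᵐ)′ telescope.
  second-derivative-sum : ∀ n → ∑< (λ k → ↑′ r (double k)) n ≼ ⌜ σ ⌝ ⊛ ⌜ σ ⌝
  second-derivative-sum n = ≼-respʳ (solve 1 (λ σ → σ :* (σ :* con 1ℚ) := σ :* σ) ≈-refl ⌜ σ ⌝)
    (s⊛-cancel (s⊛-cancel (≼-trans (≼-by (G (double n)) (0≼⊕ (⊛-nonneg (⌜⌝-mono 0≤s) (0≼↑′ 0≼r (double n))) (0≼↑ 0≼r (double n)))
      ≈-refl) (telescope n))))
    where
    G : ℕ → ℝ
    G m = ⌜ s ⌝ ⊛ ↑′ r m ⊕ r ↑ m
    S : ℕ → ℝ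
    S = ∑< (λ k → ↑′ r (double k))
    step : ∀ m → G m ≈ ⌜ s ⌝ ⊛ (⌜ s ⌝ ⊛ ↑′ r m) ⊕ G (suc m)
    step m = ≈-trans
      (solve 3 (λ s d a → s :* d :+ a := s :* (s :* d) :+ (s :* ((con 1ℚ :- s) :* d :+ a) :+ (con 1ℚ :- s) :* a)) ≈-refl ⌜ s ⌝ (↑′ r m) (r ↑ m))
      (⊕-cong ≈-refl (⊕-cong (⊛-cong ≈-refl (⊕-cong (⊛-cong (≈-sym r≈) ≈-refl) ≈-refl)) (⊛-cong (≈-sym r≈) ≈-refl)))
    telescope : ∀ n → ⌜ s ⌝ ⊛ (⌜ s ⌝ ⊛ S n) ⊕ G (double n) ≼ ⌜ 1ℚ ⌝
    telescope zero = ≈⇒≼ (solve 1 (λ s → s :* (s :* con 0ℚ) :+ (s :* con 0ℚ :+ con 1ℚ) := con 1ℚ) ≈-refl ⌜ s ⌝)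
    telescope (suc n) = begin
      -- Only even powers enter the sum, so the nonnegative odd difference G (m + 1) - G (m + 2) is
      -- given away.
      ⌜ s ⌝ ⊛ (⌜ s ⌝ ⊛ (S n ⊕ d)) ⊕ G (suc (suc m))                   ≤⟨ ⊕-mono ≼-refl (≼-by (⌜ s ⌝ ⊛ (⌜ s ⌝ ⊛ ↑′ r (suc m)))
        (⊛-nonneg (⌜⌝-mono 0≤s) (⊛-nonneg (⌜⌝-mono 0≤s) (0≼↑′ 0≼r (suc m))))
        (≈-trans (step (suc m)) (solve 2 (λ a b → a :+ b := b :+ a) ≈-refl (⌜ s ⌝ ⊛ (⌜ s ⌝ ⊛ ↑′ r (suc m))) (G (suc (suc m)))))) ⟩
      ⌜ s ⌝ ⊛ (⌜ s ⌝ ⊛ (S n ⊕ d)) ⊕ G (suc m)                         ≈⟨ solve 4 (λ s S d g → s :* (s :* (S :+ d)) :+ g := s :* (s :* S) :+ (s :* (s :* d) :+ g)) ≈-refl ⌜ s ⌝ (S n) d (G (suc m)) ⟩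
      ⌜ s ⌝ ⊛ (⌜ s ⌝ ⊛ S n) ⊕ (⌜ s ⌝ ⊛ (⌜ s ⌝ ⊛ d) ⊕ G (suc m))       ≈⟨ ⊕-cong ≈-refl (step m) ⟨
      ⌜ s ⌝ ⊛ (⌜ s ⌝ ⊛ S n) ⊕ G m                                     ≤⟨ telescope n ⟩
      ⌜ 1ℚ ⌝                                                          ∎
      where
      m = double n
      d = ↑′ r m

  module _ {t h : ℝ} (∣t∣≼r : ∣ t ∣ ≼ r) (∣t+h∣≼r : ∣ t ⊕ h ∣ ≼ r) where

    private
      term : ∀ k → ∣ (artanh-terms (t ⊕ h) k ⊝ artanh-terms t k) ⊝ h ⊛ t ↑ double k ∣ ≼ h ⊛ h ⊛ ↑′ r (double k)
      term k = ∣∣-resp eq (≼-trans (∣⌜⌝⊛∣ (0≤1/odd k) (↑-increment ∣t∣≼r ∣t+h∣≼r (suc m))) le)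
        where
        m = double k
        c = ⌜ 1/odd k ⌝
        a = (t ⊕ h) ↑ suc m
        b = t ↑ suc m
        eq : ((a ⊝ b) ⊝ h ⊛ ↑′ t (suc m)) ⊛ c ≈ (artanh-terms (t ⊕ h) k ⊝ artanh-terms t k) ⊝ h ⊛ t ↑ m
        eq = begin-equality
          ((a ⊝ b) ⊝ h ⊛ ↑′ t (suc m)) ⊛ c          ≈⟨ solve 5 (λ a b h d c → ((a :- b) :- h :* d) :* c := (a :* c :- b :* c) :- h :* (d :* c)) ≈-refl a b h (↑′ t (suc m)) c ⟩
          (a ⊛ c ⊝ b ⊛ c) ⊝ h ⊛ (↑′ t (suc m) ⊛ c)  ≈⟨ ⊕-cong (⊕-cong (≈-sym (artanh-terms-odd (t ⊕ h) k)) (⊖-cong (≈-sym (artanh-terms-odd t k))))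
            (⊖-cong (⊛-cong ≈-refl (≈-trans (⊛-cong (↑′-suc t m) ≈-refl) (ι⊛1/odd k (t ↑ m))))) ⟩
          (artanh-terms (t ⊕ h) k ⊝ artanh-terms t k) ⊝ h ⊛ t ↑ m ∎
        le : h ⊛ h ⊛ ↑″ r (suc m) ⊛ c ≼ h ⊛ h ⊛ ↑′ r m
        le = begin
          h ⊛ h ⊛ ↑″ r (suc m) ⊛ c                  ≈⟨ solve 3 (λ h e c → h :* h :* e :* c := h :* h :* (e :* c)) ≈-refl h (↑″ r (suc m)) c ⟩
          h ⊛ h ⊛ (↑″ r (suc m) ⊛ c)                ≤⟨ ⊛-monoˡ (h ⊛ h) (0≼-square h) (⊛-monoʳ c (⌜⌝-mono (0≤1/odd k)) (↑″-suc 0≼r m)) ⟩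
          h ⊛ h ⊛ (⌜ ι (suc m) ⌝ ⊛ ↑′ r m ⊛ c)      ≈⟨ ⊛-cong ≈-refl (ι⊛1/odd k (↑′ r m)) ⟩
          h ⊛ h ⊛ ↑′ r m                            ∎

      sum : ∀ n → ∣ (∑< (artanh-terms (t ⊕ h)) n ⊝ ∑< (artanh-terms t) n) ⊝ h ⊛ ∑< (λ k → t ↑ double k) n ∣
        ≼ h ⊛ h ⊛ ∑< (λ k → ↑′ r (double k)) n
      sum zero = ∣∣-resp (solve 1 (λ h → con 0ℚ := (con 0ℚ :- con 0ℚ) :- h :* con 0ℚ) ≈-refl h)
        (≼-respʳ (solve 1 (λ h → con 0ℚ := h :* h :* con 0ℚ) ≈-refl h) (∣⌜⌝∣ ℚ.≤-refl))
      sum (suc n) = ∣∣-resp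
        (solve 7 (λ a b c x y z h → ((a :- b) :- h :* c) :+ ((x :- y) :- h :* z) := ((a :+ x) :- (b :+ y)) :- h :* (c :+ z)) ≈-refl
          (∑< (artanh-terms (t ⊕ h)) n) (∑< (artanh-terms t) n) (∑< (λ k → t ↑ double k) n)
          (artanh-terms (t ⊕ h) n) (artanh-terms t n) (t ↑ double n) h)
        (≼-respʳ (solve 3 (λ h a x → h :* h :* a :+ h :* h :* x := h :* h :* (a :+ x)) ≈-refl h (∑< (λ k → ↑′ r (double k)) n) (↑′ r (double n)))
          (∣⊕∣ (sum n) (term n)))

      q : ℝ
      q = ⌜ 1ℚ ⌝ ⊝ t ⊛ t

      ∣q∣≼2 : ∣ q ∣ ≼ ⌜ ι 2 ⌝
      ∣q∣≼2 = ≼-respʳ (solve 0 (con 1ℚ :+ con 1ℚ :* con 1ℚ := con (ι 2)) ≈-refl)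
        (∣⊝∣ (∣⌜⌝∣ (ℚ.<⇒≤ 0<1)) (∣⊛∣ (≼-trans ∣t∣≼r r≼1) (≼-trans ∣t∣≼r r≼1)))

      -- Replacing (1 - t²) times the geometric sum by 1 costs t²ⁿ, hence the extra term |h| r²ⁿ,
      -- which vanishes in the limit. The factor 2 bounds |1 - t²|.
      bound-at : ∀ n → ∣ q ⊛ (∑< (artanh-terms (t ⊕ h)) n ⊕ ⊖ ∑< (artanh-terms t) n) ⊝ h ∣
        ≼ h ⊛ h ⊛ (⌜ ι 2 ⌝ ⊛ ⌜ σ ⌝ ⊛ ⌜ σ ⌝) ⊕ ∣ h ∣ ⊛ r ↑ double n
      bound-at n = ∣∣-resp eq (≼-respʳ bounds
        (∣⊝∣ (∣⊛∣ ∣q∣≼2 (≼-trans (sum n) (⊛-monoˡ (h ⊛ h) (0≼-square h) (second-derivative-sum n))))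
          (∣⊛∣ (≼-refl {∣ h ∣}) (∣↑∣ ∣t∣≼r (double n)))))
        where
        a = ∑< (artanh-terms (t ⊕ h)) n
        b = ∑< (artanh-terms t) n
        G = ∑< (λ k → t ↑ double k) n
        eq : q ⊛ ((a ⊝ b) ⊝ h ⊛ G) ⊝ h ⊛ t ↑ double n ≈ q ⊛ (a ⊝ b) ⊝ h
        eq = begin-equality
          q ⊛ ((a ⊝ b) ⊝ h ⊛ G) ⊝ h ⊛ t ↑ double n             ≈⟨ solve 5 (λ q d h G u → q :* (d :- h :* G) :- h :* u := (q :* d :- h :* (q :* G)) :- h :* u) ≈-refl q (a ⊝ b) h G (t ↑ double n) ⟩
          (q ⊛ (a ⊝ b) ⊝ h ⊛ (q ⊛ G)) ⊝ h ⊛ t ↑ double n       ≈⟨ ⊕-cong (⊕-cong ≈-refl (⊖-cong (⊛-cong ≈-refl (geometric t n)))) ≈-refl ⟩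
          (q ⊛ (a ⊝ b) ⊝ h ⊛ (⌜ 1ℚ ⌝ ⊝ t ↑ double n)) ⊝ h ⊛ t ↑ double n ≈⟨ solve 3 (λ d h u → (d :- h :* (con 1ℚ :- u)) :- h :* u := d :- h) ≈-refl (q ⊛ (a ⊝ b)) h (t ↑ double n) ⟩
          q ⊛ (a ⊝ b) ⊝ h                                      ∎
        bounds : ⌜ ι 2 ⌝ ⊛ (h ⊛ h ⊛ (⌜ σ ⌝ ⊛ ⌜ σ ⌝)) ⊕ ∣ h ∣ ⊛ r ↑ double n ≈ h ⊛ h ⊛ (⌜ ι 2 ⌝ ⊛ ⌜ σ ⌝ ⊛ ⌜ σ ⌝) ⊕ ∣ h ∣ ⊛ r ↑ double n
        bounds = ⊕-cong (solve 2 (λ h σ → con (ι 2) :* (h :* h :* (σ :* σ)) := h :* h :* (con (ι 2) :* σ :* σ)) ≈-refl h ⌜ σ ⌝) ≈-refl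

    Artanh-increment : ∀ p p′ → ∣ (⌜ 1ℚ ⌝ ⊝ t ⊛ t) ⊛ (Artanh (t ⊕ h) p′ ⊝ Artanh t p) ⊝ h ∣
      ≼ h ⊛ h ⊛ (⌜ ι 2 ⌝ ⊛ ⌜ σ ⌝ ⊛ ⌜ σ ⌝)
    Artanh-increment p p′ = ≼-respʳ (solve 2 (λ a b → a :+ b :* con 0ℚ := a) ≈-refl (h ⊛ h ⊛ (⌜ ι 2 ⌝ ⊛ ⌜ σ ⌝ ⊛ ⌜ σ ⌝)) (∣ h ∣))
      (⟶-∣∣ (⟶-⊕ (⟶-⊛ q (⟶-⊕ (Artanh-⟶ (t ⊕ h) p′) (⟶-⊖ (Artanh-⟶ t p)))) (⟶-⊖ (⟶-const h)))
        (⟶-⊕ (⟶-const (h ⊛ h ⊛ (⌜ ι 2 ⌝ ⊛ ⌜ σ ⌝ ⊛ ⌜ σ ⌝))) (⟶-⊛ (∣ h ∣) ↑-⟶0)) bound-at)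

Artanh-cong : ∀ {x y} p q → x ≈ y → Artanh x p ≈ Artanh y q
Artanh-cong {x} {y} p q e = ⟶-unique (Artanh-⟶ x p) (Artanh-⟶ y q)
  (∑<-cong λ k → ⊛-cong (⊛-cong e (↑-cong (⊛-cong e e) k)) ≈-refl)

Artanh-0 : ∀ p → Artanh ⌜ 0ℚ ⌝ p ≈ ⌜ 0ℚ ⌝
Artanh-0 p = ⟶-unique (Artanh-⟶ ⌜ 0ℚ ⌝ p) (⟶-const ⌜ 0ℚ ⌝) sums
  where
  sums : ∀ n → ∑< (artanh-terms ⌜ 0ℚ ⌝) n ≈ ⌜ 0ℚ ⌝
  sums zero    = ≈-refl
  sums (suc n) = ≈-trans (⊕-cong (sums n) ≈-refl)
    (solve 2 (λ a c → con 0ℚ :+ con 0ℚ :* a :* c := con 0ℚ) ≈-refl ((⌜ 0ℚ ⌝ ⊛ ⌜ 0ℚ ⌝) ↑ n) ⌜ 1/odd n ⌝)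

-- `ZeroDerivative` takes a function on all of ℚ, while artanh (c z) needs a proof of |c z| < 1;
-- clamping c to [0, 1] supplies that proof for every c.
clamp : ℚ → ℚ
clamp c = 0ℚ ℚ.⊔ (c ℚ.⊓ 1ℚ)

0≤clamp : ∀ c → 0ℚ ℚ.≤ clamp c
0≤clamp c = ℚ.p≤p⊔q 0ℚ (c ℚ.⊓ 1ℚ)

clamp≤1 : ∀ c → clamp c ℚ.≤ 1ℚ
clamp≤1 c = ℚ.⊔-lub (ℚ.<⇒≤ 0<1) (ℚ.p⊓q≤q c 1ℚ)

clamp-id : ∀ {c} → 0ℚ ℚ.≤ c → c ℚ.≤ 1ℚ → clamp c ≡ c
clamp-id {c} p q = trans (cong (0ℚ ℚ.⊔_) (ℚ.p≤q⇒p⊓q≡p q)) (ℚ.p≤q⇒p⊔q≡q p)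

-- Along t = c z, c ∈ [0,1], the product of exp (−2 artanh t) and (1 + t) / (1 − t) = 2 / (1 − t) − 1 is constant.
module _ (z : ℝ) (s : ℚ) (0<s : 0ℚ ℚ.< s) (s≤1 : s ℚ.≤ 1ℚ) (∣z∣≼r : ∣ z ∣ ≼ ⌜ 1ℚ ℚ.- s ⌝) where

  open UnitInterval s 0<s s≤1

  private
    t : ℚ → ℝ
    t c = ⌜ clamp c ⌝ ⊛ z

    ∣t∣ : ∀ c → ∣ t c ∣ ≼ r
    ∣t∣ c = ∣⌜⌝⊛∣≼ (0≤clamp c) (clamp≤1 c) ∣z∣≼r

    t<1 : ∀ c → ∣ t c ∣<1
    t<1 c = ≼⇒∣∣<1 {t c} s 0<s (∣t∣ c)

    s≼1-x : ∀ {x} → x ≼ r → ⌜ s ⌝ ≼ ⌜ 1ℚ ⌝ ⊝ x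
    s≼1-x {x} p = ≼-by (r ⊝ x) (0≼⊝ p) (≈-sym (≈-trans (⊕-cong ≈-refl (⊕-cong r≈ ≈-refl))
      (solve 2 (λ s x → s :+ ((con 1ℚ :- s) :- x) := con 1ℚ :- x) ≈-refl ⌜ s ⌝ x)))

    s≼1-t : ∀ c → ⌜ s ⌝ ≼ ⌜ 1ℚ ⌝ ⊝ t c
    s≼1-t c = s≼1-x (≼-trans (x≼∣x∣ (t c)) (∣t∣ c))

    s≼1+t : ∀ c → ⌜ s ⌝ ≼ ⌜ 1ℚ ⌝ ⊕ t c
    s≼1+t c = ≼-respʳ (solve 1 (λ t → con 1ℚ :- (:- t) := con 1ℚ :+ t) ≈-refl (t c)) (s≼1-x (≼-trans (⊖x≼∣x∣ (t c)) (∣t∣ c)))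

    0<1-t : ∀ c → 0ℝ < ⌜ 1ℚ ⌝ ⊝ t c
    0<1-t c = 0<-≼-trans {⌜ s ⌝} {⌜ 1ℚ ⌝ ⊝ t c} (0<⌜⌝ 0<s) (s≼1-t c)

    0<1+t : ∀ c → 0ℝ < ⌜ 1ℚ ⌝ ⊕ t c
    0<1+t c = 0<-≼-trans {⌜ s ⌝} {⌜ 1ℚ ⌝ ⊕ t c} (0<⌜⌝ 0<s) (s≼1+t c)

    A κ ν f g : ℚ → ℝ
    A c = Artanh (t c) (t<1 c)
    κ c = Inv (⌜ 1ℚ ⌝ ⊝ t c) (0<1-t c)
    ν c = Inv (⌜ 1ℚ ⌝ ⊕ t c) (0<1+t c)
    f c = Exp (⊖ (⌜ ι 2 ⌝ ⊛ A c))
    g c = ⌜ ι 2 ⌝ ⊛ κ c ⊝ ⌜ 1ℚ ⌝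

    -- `C₁` is the constant of `Artanh-increment`, `R` bounds |2 artanh t|, `E` bounds f and `N`
    -- bounds |g|. In a step η the exponent moves by `w` with linear part `k`, where |k| ≤ η d, |w -
    -- k| ≤ η² C₂ and |w| ≤ η ω. `C` is the constant that `product-increment` returns.
    C₁ R E C₂ d ω N C : ℝ
    C₁ = ⌜ ι 2 ⌝ ⊛ ⌜ σ ⌝ ⊛ ⌜ σ ⌝
    R  = ⌜ ι 2 ⌝ ⊛ (C₁ ⊕ ⌜ 1ℚ ⌝)
    E  = Exp R
    C₂ = (⌜ ι 2 ⌝ ⊛ (⌜ σ ⌝ ⊛ ⌜ σ ⌝)) ⊛ (z ⊛ z ⊛ C₁)
    d  = ⌜ ι 2 ⌝ ⊛ (∣ z ∣ ⊛ (⌜ σ ⌝ ⊛ ⌜ σ ⌝))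
    ω  = d ⊕ C₂
    N  = ⌜ ι 2 ⌝ ⊛ ⌜ σ ⌝ ⊕ ⌜ 1ℚ ⌝

    C = (ω ⊛ ω ⊛ E ⊕ C₂ ⊛ E) ⊛ N ⊕ (E ⊕ d ⊛ E) ⊛ (⌜ ι 2 ⌝ ⊛ (z ⊛ z ⊛ (⌜ σ ⌝ ⊛ ⌜ σ ⌝ ⊛ ⌜ σ ⌝))) ⊕ d ⊛ d ⊛ (E ⊛ N)

    0≼2 : ⌜ 0ℚ ⌝ ≼ ⌜ ι 2 ⌝
    0≼2 = ⌜⌝-mono (0≤ι 2)

    ∣2∣ : ∣ ⌜ ι 2 ⌝ ∣ ≼ ⌜ ι 2 ⌝
    ∣2∣ = ∣⌜⌝∣ (0≤ι 2)

    0≼C₁ : ⌜ 0ℚ ⌝ ≼ C₁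
    0≼C₁ = ⊛-nonneg (⊛-nonneg 0≼2 0≼σ) 0≼σ

    0≼C₂ : ⌜ 0ℚ ⌝ ≼ C₂
    0≼C₂ = ⊛-nonneg (⊛-nonneg 0≼2 (⊛-nonneg 0≼σ 0≼σ)) (⊛-nonneg (0≼-square z) 0≼C₁)

    0≼d : ⌜ 0ℚ ⌝ ≼ d
    0≼d = ⊛-nonneg 0≼2 (⊛-nonneg (∣∣-nonneg z) (⊛-nonneg 0≼σ 0≼σ))

    ∣κ∣ : ∀ c → ∣ κ c ∣ ≼ ⌜ σ ⌝
    ∣κ∣ c = Inv≼σ (⌜ 1ℚ ⌝ ⊝ t c) (0<1-t c) (s≼1-t c)

    ∣ν∣ : ∀ c → ∣ ν c ∣ ≼ ⌜ σ ⌝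
    ∣ν∣ c = Inv≼σ (⌜ 1ℚ ⌝ ⊕ t c) (0<1+t c) (s≼1+t c)

    ∣g∣ : ∀ c → ∣ g c ∣ ≼ N
    ∣g∣ c = ∣⊝∣ (∣⊛∣ ∣2∣ (∣κ∣ c)) (∣⌜⌝∣ (ℚ.<⇒≤ 0<1))

    ∣0∣≼r : ∣ ⌜ 0ℚ ⌝ ∣ ≼ r
    ∣0∣≼r = ≼-trans (∣⌜⌝∣ ℚ.≤-refl) 0≼r

    -- The increment bound is applied from the base point 0, where artanh vanishes: |artanh t - t| ≤
    -- t² C₁ ≤ C₁, and |t| ≤ 1.
    ∣A∣ : ∀ c → ∣ A c ∣ ≼ C₁ ⊕ ⌜ 1ℚ ⌝
    ∣A∣ c = ∣∣-resp (≈-trans (⊕-cong (⊕-cong (⊛-cong ≈-refl (⊕-cong (Artanh-cong 0+t<1 (t<1 c) 0+t) (⊖-cong (Artanh-0 0∣<1)))) ≈-refl) ≈-refl)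
        (solve 2 (λ a t → ((con 1ℚ :- con 0ℚ :* con 0ℚ) :* (a :- con 0ℚ) :- t) :+ t := a) ≈-refl (A c) (t c)))
      (∣⊕∣ (≼-trans (Artanh-increment ∣0∣≼r (∣∣-resp (≈-sym 0+t) (∣t∣ c)) 0∣<1 0+t<1) tt≼) (≼-trans (∣t∣ c) r≼1))
      where
      0+t : ⌜ 0ℚ ⌝ ⊕ t c ≈ t c
      0+t = solve 1 (λ t → con 0ℚ :+ t := t) ≈-refl (t c)
      0+t<1 : ∣ ⌜ 0ℚ ⌝ ⊕ t c ∣<1
      0+t<1 = ≼⇒∣∣<1 {⌜ 0ℚ ⌝ ⊕ t c} s 0<s (∣∣-resp (≈-sym 0+t) (∣t∣ c))
      0∣<1 : ∣ ⌜ 0ℚ ⌝ ∣<1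
      0∣<1 = ≼⇒∣∣<1 {⌜ 0ℚ ⌝} s 0<s ∣0∣≼r
      tt≼ : t c ⊛ t c ⊛ C₁ ≼ C₁
      tt≼ = ≼-respʳ (solve 1 (λ a → con 1ℚ :* con 1ℚ :* a := a) ≈-refl C₁)
        (⊛-monoʳ C₁ 0≼C₁ (≼-trans (x≼∣x∣ (t c ⊛ t c)) (∣⊛∣ (≼-trans (∣t∣ c) r≼1) (≼-trans (∣t∣ c) r≼1))))

    ∣arg∣ : ∀ c → ∣ ⊖ (⌜ ι 2 ⌝ ⊛ A c) ∣ ≼ R
    ∣arg∣ c = ≼-trans (∣⊖∣ (⌜ ι 2 ⌝ ⊛ A c)) (∣⊛∣ ∣2∣ (∣A∣ c))

    module _ (c η : ℚ) (0≤c : 0ℚ ℚ.≤ c) (0≤η : 0ℚ ℚ.≤ η) (c+η≤1 : c ℚ.+ η ℚ.≤ 1ℚ) where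
      c≤1 : c ℚ.≤ 1ℚ
      c≤1 = ℚ.≤-trans (c≤c+η {c} {η} 0≤η) c+η≤1
      η≤1 : η ℚ.≤ 1ℚ
      η≤1 = ℚ.≤-trans (η≤c+η {c} {η} 0≤c) c+η≤1
      h = ⌜ η ⌝ ⊛ z
      e = ⌜ η ℚ.* η ⌝
      -- `κ c ⊛ ν c` is 1 / (1 - t²), the derivative of artanh at t, so `k` is the linear part of
      -- the increment `w` of the exponent -2 artanh t.
      k = ⊖ (⌜ ι 2 ⌝ ⊛ (h ⊛ (κ c ⊛ ν c)))
      w = ⊖ (⌜ ι 2 ⌝ ⊛ (A (c ℚ.+ η) ⊝ A c))

      e≼η : e ≼ ⌜ η ⌝
      e≼η = ⌜⌝-mono (ℚ.≤-trans (*-monoˡ {η} {1ℚ} {η} 0≤η η≤1) (ℚ.≤-reflexive (ℚ.*-identityʳ η)))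

      t-step : t (c ℚ.+ η) ≈ t c ⊕ h
      t-step = begin-equality
        ⌜ clamp (c ℚ.+ η) ⌝ ⊛ z              ≈⟨ ⊛-cong (≡⇒≈ (cong ⌜_⌝ (clamp-id (ℚ.+-mono-≤ 0≤c 0≤η) c+η≤1))) ≈-refl ⟩
        ⌜ c ℚ.+ η ⌝ ⊛ z               ≈⟨ ⊛-cong (⌜⌝-+ c η) ≈-refl ⟩
        (⌜ c ⌝ ⊕ ⌜ η ⌝) ⊛ z           ≈⟨ solve 3 (λ c η z → (c :+ η) :* z := c :* z :+ η :* z) ≈-refl ⌜ c ⌝ ⌜ η ⌝ z ⟩
        ⌜ c ⌝ ⊛ z ⊕ h                 ≈⟨ ⊕-cong (⊛-cong (≡⇒≈ (cong ⌜_⌝ (sym (clamp-id 0≤c c≤1)))) ≈-refl) ≈-refl ⟩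
        t c ⊕ h                       ∎

      κ-inverse : (⌜ 1ℚ ⌝ ⊝ t c) ⊛ κ c ≈ ⌜ 1ℚ ⌝
      κ-inverse = Inv-inverseʳ (⌜ 1ℚ ⌝ ⊝ t c) (0<1-t c)

      ν-inverse : (⌜ 1ℚ ⌝ ⊕ t c) ⊛ ν c ≈ ⌜ 1ℚ ⌝
      ν-inverse = Inv-inverseʳ (⌜ 1ℚ ⌝ ⊕ t c) (0<1+t c)

      κ′-inverse : (⌜ 1ℚ ⌝ ⊝ (t c ⊕ h)) ⊛ κ (c ℚ.+ η) ≈ ⌜ 1ℚ ⌝
      κ′-inverse = ≈-trans (⊛-cong (⊕-cong ≈-refl (⊖-cong (≈-sym t-step))) ≈-refl) (Inv-inverseʳ (⌜ 1ℚ ⌝ ⊝ t (c ℚ.+ η)) (0<1-t (c ℚ.+ η)))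

      A-increment : ∣ (⌜ 1ℚ ⌝ ⊝ t c ⊛ t c) ⊛ (A (c ℚ.+ η) ⊝ A c) ⊝ h ∣ ≼ h ⊛ h ⊛ C₁
      A-increment = ∣∣-resp (⊕-cong (⊛-cong ≈-refl (⊕-cong (Artanh-cong t+h<1 (t<1 (c ℚ.+ η)) (≈-sym t-step)) ≈-refl)) ≈-refl)
        (Artanh-increment (∣t∣ c) ∣t+h∣ (t<1 c) t+h<1)
        where
        ∣t+h∣ : ∣ t c ⊕ h ∣ ≼ r
        ∣t+h∣ = ∣∣-resp t-step (∣t∣ (c ℚ.+ η))
        t+h<1 : ∣ t c ⊕ h ∣<1
        t+h<1 = ≼⇒∣∣<1 {t c ⊕ h} s 0<s ∣t+h∣

      ∣w-k∣ : ∣ w ⊝ k ∣ ≼ e ⊛ C₂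
      ∣w-k∣ = ∣∣-resp eq (≼-respʳ (≈-trans (⊛-cong ≈-refl (⊛-cong (square-scaled η z) ≈-refl))
          (solve 4 (λ a e z C → a :* (e :* z :* C) := e :* (a :* (z :* C))) ≈-refl (⌜ ι 2 ⌝ ⊛ (⌜ σ ⌝ ⊛ ⌜ σ ⌝)) e (z ⊛ z) C₁))
        (∣⊛∣ (≼-trans (∣⊖∣ (⌜ ι 2 ⌝ ⊛ (κ c ⊛ ν c))) (∣⊛∣ ∣2∣ (∣⊛∣ (∣κ∣ c) (∣ν∣ c)))) A-increment))
        where
        eq : ⊖ (⌜ ι 2 ⌝ ⊛ (κ c ⊛ ν c)) ⊛ ((⌜ 1ℚ ⌝ ⊝ t c ⊛ t c) ⊛ (A (c ℚ.+ η) ⊝ A c) ⊝ h) ≈ w ⊝ k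
        eq = ≈-trans (solve 5 (λ κ ν t Δ h → (:- (con (ι 2) :* (κ :* ν))) :* ((con 1ℚ :- t :* t) :* Δ :- h) :=
              :- (con (ι 2) :* ((((con 1ℚ :- t) :* κ) :* ((con 1ℚ :+ t) :* ν)) :* Δ)) :- :- (con (ι 2) :* (h :* (κ :* ν)))) ≈-refl
            (κ c) (ν c) (t c) (A (c ℚ.+ η) ⊝ A c) h)
          (⊕-cong (⊖-cong (⊛-cong ≈-refl (≈-trans (⊛-cong (⊛-cong κ-inverse ν-inverse) ≈-refl)
            (solve 1 (λ a → (con 1ℚ :* con 1ℚ) :* a := a) ≈-refl (A (c ℚ.+ η) ⊝ A c))))) ≈-refl)

      ∣k∣ : ∣ k ∣ ≼ ⌜ η ⌝ ⊛ d
      ∣k∣ = ≼-trans (∣⊖∣ (⌜ ι 2 ⌝ ⊛ (h ⊛ (κ c ⊛ ν c)))) (≼-respʳ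
        (solve 3 (λ η z b → con (ι 2) :* ((η :* z) :* b) := η :* (con (ι 2) :* (z :* b))) ≈-refl ⌜ η ⌝ (∣ z ∣) (⌜ σ ⌝ ⊛ ⌜ σ ⌝))
        (∣⊛∣ ∣2∣ (∣⊛∣ (∣⊛∣ (∣⌜⌝∣ 0≤η) ≼-refl) (∣⊛∣ (∣κ∣ c) (∣ν∣ c)))))

      ∣w∣ : ∣ w ∣ ≼ ⌜ η ⌝ ⊛ ω
      ∣w∣ = ∣∣-resp (solve 2 (λ w k → k :+ (w :- k) := w) ≈-refl w k)
        (≼-respʳ (solve 3 (λ η d C → η :* d :+ η :* C := η :* (d :+ C)) ≈-refl ⌜ η ⌝ d C₂)
          (∣⊕∣ ∣k∣ (≼-trans ∣w-k∣ (⊛-monoʳ C₂ 0≼C₂ e≼η))))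

      f-increment : ∣ (f (c ℚ.+ η) ⊝ f c) ⊝ k ⊛ f c ∣ ≼ e ⊛ (ω ⊛ ω ⊛ E ⊕ C₂ ⊛ E)
      f-increment = ∣∣-resp
        (≈-trans (⊕-cong (⊕-cong (⊕-cong (Exp-cong arg) ≈-refl) ≈-refl) ≈-refl)
          (solve 4 (λ f′ f w k → ((f′ :- f) :- w :* f) :+ (w :- k) :* f := (f′ :- f) :- k :* f) ≈-refl (f (c ℚ.+ η)) (f c) w k))
        (≼-respʳ (solve 4 (λ e ω E C → e :* ω :* E :+ e :* C :* E := e :* (ω :* E :+ C :* E)) ≈-refl e (ω ⊛ ω) E C₂)
          (∣⊕∣ (≼-trans (Exp-increment (∣arg∣ c) (∣∣-resp (≈-sym arg) (∣arg∣ (c ℚ.+ η)))) (⊛-monoʳ E (0≼Exp R) ww))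
            (∣⊛∣ ∣w-k∣ (∣Exp∣ (∣arg∣ c)))))
        where
        arg : ⊖ (⌜ ι 2 ⌝ ⊛ A c) ⊕ w ≈ ⊖ (⌜ ι 2 ⌝ ⊛ A (c ℚ.+ η))
        arg = solve 2 (λ a a′ → :- (con (ι 2) :* a) :+ :- (con (ι 2) :* (a′ :- a)) := :- (con (ι 2) :* a′)) ≈-refl (A c) (A (c ℚ.+ η))
        ww : w ⊛ w ≼ e ⊛ (ω ⊛ ω)
        ww = ≼-respʳ (square-scaled η ω) (≼-trans (x≼∣x∣ (w ⊛ w)) (∣⊛∣ ∣w∣ ∣w∣))

      -- The remainder is exactly 2 h² κ² κ′, because κ′ - κ = h κ κ′ and ν g = κ, that is, g = (1 +
      -- t) κ.
      g-increment : ∣ (g (c ℚ.+ η) ⊝ g c) ⊕ k ⊛ g c ∣ ≼ e ⊛ (⌜ ι 2 ⌝ ⊛ (z ⊛ z ⊛ (⌜ σ ⌝ ⊛ ⌜ σ ⌝ ⊛ ⌜ σ ⌝)))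
      g-increment = ∣∣-resp (≈-sym eq) (≼-respʳ
        (≈-trans (⊛-cong ≈-refl (⊛-cong (square-scaled η z) ≈-refl)) (solve 3 (λ e z s → con (ι 2) :* (e :* z :* s) := e :* (con (ι 2) :* (z :* s))) ≈-refl e (z ⊛ z) (⌜ σ ⌝ ⊛ ⌜ σ ⌝ ⊛ ⌜ σ ⌝)))
        (∣⊛∣ ∣2∣ (∣⊛∣ (nonneg⇒∣∣≼ (0≼-square h)) (∣⊛∣ (∣⊛∣ (∣κ∣ c) (∣κ∣ c)) (∣κ∣ (c ℚ.+ η))))))
        where
        K = κ c
        K′ = κ (c ℚ.+ η)
        V = ν c
        T = t c
        difference : K′ ⊝ K ≈ h ⊛ (K ⊛ K′)
        difference = begin-equality
          K′ ⊝ K                                                          ≈⟨ solve 2 (λ a b → a :- b := a :* con 1ℚ :- b :* con 1ℚ) ≈-refl K′ K ⟩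
          K′ ⊛ ⌜ 1ℚ ⌝ ⊝ K ⊛ ⌜ 1ℚ ⌝                                        ≈⟨ ⊕-cong (⊛-cong ≈-refl κ-inverse) (⊖-cong (⊛-cong ≈-refl κ′-inverse)) ⟨
          K′ ⊛ ((⌜ 1ℚ ⌝ ⊝ T) ⊛ K) ⊝ K ⊛ ((⌜ 1ℚ ⌝ ⊝ (T ⊕ h)) ⊛ K′)         ≈⟨ solve 4 (λ K K′ T h → K′ :* ((con 1ℚ :- T) :* K) :- K :* ((con 1ℚ :- (T :+ h)) :* K′) := h :* (K :* K′)) ≈-refl K K′ T h ⟩
          h ⊛ (K ⊛ K′)                                                    ∎
        Vg≈K : V ⊛ (⌜ ι 2 ⌝ ⊛ K ⊝ ⌜ 1ℚ ⌝) ≈ K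
        Vg≈K = begin-equality
          V ⊛ (⌜ ι 2 ⌝ ⊛ K ⊝ ⌜ 1ℚ ⌝)             ≈⟨ ⊛-cong ≈-refl (⊕-cong ≈-refl (⊖-cong κ-inverse)) ⟨
          V ⊛ (⌜ ι 2 ⌝ ⊛ K ⊝ (⌜ 1ℚ ⌝ ⊝ T) ⊛ K)   ≈⟨ solve 3 (λ V K T → V :* (con (ι 2) :* K :- (con 1ℚ :- T) :* K) := ((con 1ℚ :+ T) :* V) :* K) ≈-refl V K T ⟩
          ((⌜ 1ℚ ⌝ ⊕ T) ⊛ V) ⊛ K                 ≈⟨ ⊛-cong ν-inverse ≈-refl ⟩
          ⌜ 1ℚ ⌝ ⊛ K                             ≈⟨ solve 1 (λ a → con 1ℚ :* a := a) ≈-refl K ⟩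
          K                                      ∎
        eq : (g (c ℚ.+ η) ⊝ g c) ⊕ k ⊛ g c ≈ ⌜ ι 2 ⌝ ⊛ (h ⊛ h ⊛ (K ⊛ K ⊛ K′))
        eq = begin-equality
          (g (c ℚ.+ η) ⊝ g c) ⊕ k ⊛ g c                                        ≈⟨ solve 5 (λ K K′ h V g → ((con (ι 2) :* K′ :- con 1ℚ) :- (con (ι 2) :* K :- con 1ℚ)) :+ (:- (con (ι 2) :* (h :* (K :* V)))) :* g
                                                                              := con (ι 2) :* ((K′ :- K) :- h :* (K :* (V :* g)))) ≈-refl K K′ h V (g c) ⟩
          ⌜ ι 2 ⌝ ⊛ ((K′ ⊝ K) ⊝ h ⊛ (K ⊛ (V ⊛ g c)))                    ≈⟨ ⊛-cong ≈-refl (⊕-cong difference (⊖-cong (⊛-cong ≈-refl (⊛-cong ≈-refl Vg≈K)))) ⟩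
          ⌜ ι 2 ⌝ ⊛ (h ⊛ (K ⊛ K′) ⊝ h ⊛ (K ⊛ K))                        ≈⟨ solve 3 (λ h K K′ → con (ι 2) :* (h :* (K :* K′) :- h :* (K :* K)) := con (ι 2) :* (h :* K :* (K′ :- K))) ≈-refl h K K′ ⟩
          ⌜ ι 2 ⌝ ⊛ (h ⊛ K ⊛ (K′ ⊝ K))                                  ≈⟨ ⊛-cong ≈-refl (⊛-cong ≈-refl difference) ⟩
          ⌜ ι 2 ⌝ ⊛ (h ⊛ K ⊛ (h ⊛ (K ⊛ K′)))                            ≈⟨ solve 3 (λ h K K′ → con (ι 2) :* (h :* K :* (h :* (K :* K′))) := con (ι 2) :* (h :* h :* (K :* K :* K′))) ≈-refl h K K′ ⟩
          ⌜ ι 2 ⌝ ⊛ (h ⊛ h ⊛ (K ⊛ K ⊛ K′))                              ∎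

      fg-increment : ∣ f (c ℚ.+ η) ⊛ g (c ℚ.+ η) ⊝ f c ⊛ g c ∣ ≼ ⌜ η ℚ.* η ⌝ ⊛ C
      fg-increment = product-increment η 0≤η η≤1 f-increment g-increment
        (∣Exp∣ (∣arg∣ c)) (∣g∣ c) (∣g∣ (c ℚ.+ η)) ∣k∣ 0≼d

  private
    z-end : t 1ℚ ≈ z
    z-end = solve 1 (λ z → con 1ℚ :* z := z) ≈-refl z

    z-start : t 0ℚ ≈ ⌜ 0ℚ ⌝
    z-start = solve 1 (λ z → con 0ℚ :* z := con 0ℚ) ≈-refl z

    f0 : f 0ℚ ≈ ⌜ 1ℚ ⌝
    f0 = ≈-trans (Exp-cong (≈-trans (⊖-cong (⊛-cong ≈-refl (≈-trans (Artanh-cong (t<1 0ℚ) 0∣<1 z-start) (Artanh-0 0∣<1))))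
      (solve 0 (:- (con (ι 2) :* con 0ℚ) := con 0ℚ) ≈-refl))) Exp-0
      where
      0∣<1 : ∣ ⌜ 0ℚ ⌝ ∣<1
      0∣<1 = ≼⇒∣∣<1 {⌜ 0ℚ ⌝} s 0<s ∣0∣≼r

    g0 : g 0ℚ ≈ ⌜ 1ℚ ⌝
    g0 = begin-equality
      ⌜ ι 2 ⌝ ⊛ κ 0ℚ ⊝ ⌜ 1ℚ ⌝                         ≈⟨ solve 1 (λ a → con (ι 2) :* a :- con 1ℚ := con (ι 2) :* ((con 1ℚ :- con 0ℚ) :* a) :- con 1ℚ) ≈-refl (κ 0ℚ) ⟩
      ⌜ ι 2 ⌝ ⊛ ((⌜ 1ℚ ⌝ ⊝ ⌜ 0ℚ ⌝) ⊛ κ 0ℚ) ⊝ ⌜ 1ℚ ⌝   ≈⟨ ⊕-cong (⊛-cong ≈-refl (⊛-cong (⊕-cong ≈-refl (⊖-cong z-start)) ≈-refl)) ≈-refl ⟨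
      ⌜ ι 2 ⌝ ⊛ ((⌜ 1ℚ ⌝ ⊝ t 0ℚ) ⊛ κ 0ℚ) ⊝ ⌜ 1ℚ ⌝     ≈⟨ ⊕-cong (⊛-cong ≈-refl (Inv-inverseʳ (⌜ 1ℚ ⌝ ⊝ t 0ℚ) (0<1-t 0ℚ))) ≈-refl ⟩
      ⌜ ι 2 ⌝ ⊛ ⌜ 1ℚ ⌝ ⊝ ⌜ 1ℚ ⌝                       ≈⟨ solve 0 (con (ι 2) :* con 1ℚ :- con 1ℚ := con 1ℚ) ≈-refl ⟩
      ⌜ 1ℚ ⌝                                         ∎

    fg-constant : f 1ℚ ⊛ g 1ℚ ≈ f 0ℚ ⊛ g 0ℚ
    fg-constant = ZeroDerivative.constant (λ c → f c ⊛ g c) C fg-increment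

    fg≈1 : f 1ℚ ⊛ g 1ℚ ≈ ⌜ 1ℚ ⌝
    fg≈1 = ≈-trans fg-constant
      (≈-trans (⊛-cong f0 g0) (solve 0 (con 1ℚ :* con 1ℚ := con 1ℚ) ≈-refl))

  -- At c = 1 both g and exp (2 artanh z) are inverse to f, hence equal, and g there is (1 + z) / (1
  -- - z).
  Exp-2Artanh′ : ∀ z<1 → Exp (⌜ ι 2 ⌝ ⊛ Artanh z z<1) ⊛ (⌜ 1ℚ ⌝ ⊝ z) ≈ ⌜ 1ℚ ⌝ ⊕ z
  Exp-2Artanh′ z<1 = begin-equality
    X ⊛ (⌜ 1ℚ ⌝ ⊝ z)                          ≈⟨ ⊛-cong X≈g (⊕-cong ≈-refl (⊖-cong (≈-sym z-end))) ⟩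
    g 1ℚ ⊛ (⌜ 1ℚ ⌝ ⊝ t 1ℚ)                    ≈⟨ solve 2 (λ κ t → (con (ι 2) :* κ :- con 1ℚ) :* (con 1ℚ :- t) := con (ι 2) :* ((con 1ℚ :- t) :* κ) :- (con 1ℚ :- t)) ≈-refl (κ 1ℚ) (t 1ℚ) ⟩
    ⌜ ι 2 ⌝ ⊛ ((⌜ 1ℚ ⌝ ⊝ t 1ℚ) ⊛ κ 1ℚ) ⊝ (⌜ 1ℚ ⌝ ⊝ t 1ℚ) ≈⟨ ⊕-cong (⊛-cong ≈-refl (Inv-inverseʳ (⌜ 1ℚ ⌝ ⊝ t 1ℚ) (0<1-t 1ℚ))) ≈-refl ⟩
    ⌜ ι 2 ⌝ ⊛ ⌜ 1ℚ ⌝ ⊝ (⌜ 1ℚ ⌝ ⊝ t 1ℚ)        ≈⟨ solve 1 (λ t → con (ι 2) :* con 1ℚ :- (con 1ℚ :- t) := con 1ℚ :+ t) ≈-refl (t 1ℚ) ⟩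
    ⌜ 1ℚ ⌝ ⊕ t 1ℚ                             ≈⟨ ⊕-cong ≈-refl z-end ⟩
    ⌜ 1ℚ ⌝ ⊕ z                                ∎
    where
    X = Exp (⌜ ι 2 ⌝ ⊛ Artanh z z<1)
    Xf≈1 : X ⊛ f 1ℚ ≈ ⌜ 1ℚ ⌝
    Xf≈1 = ≈-trans (⊛-cong (Exp-cong (⊛-cong ≈-refl (Artanh-cong z<1 (t<1 1ℚ) (≈-sym z-end)))) ≈-refl) (Exp-inverse (⌜ ι 2 ⌝ ⊛ A 1ℚ))
    X≈g : X ≈ g 1ℚ
    X≈g = begin-equality
      X                       ≈⟨ solve 1 (λ a → a := a :* con 1ℚ) ≈-refl X ⟩
      X ⊛ ⌜ 1ℚ ⌝              ≈⟨ ⊛-cong ≈-refl fg≈1 ⟨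
      X ⊛ (f 1ℚ ⊛ g 1ℚ)       ≈⟨ solve 3 (λ a b c → a :* (b :* c) := (a :* b) :* c) ≈-refl X (f 1ℚ) (g 1ℚ) ⟩
      (X ⊛ f 1ℚ) ⊛ g 1ℚ       ≈⟨ ⊛-cong Xf≈1 ≈-refl ⟩
      ⌜ 1ℚ ⌝ ⊛ g 1ℚ           ≈⟨ solve 1 (λ a → con 1ℚ :* a := a) ≈-refl (g 1ℚ) ⟩
      g 1ℚ                    ∎

Exp-2Artanh : ∀ z z<1 → Exp (⌜ ι 2 ⌝ ⊛ Artanh z z<1) ⊛ (⌜ 1ℚ ⌝ ⊝ z) ≈ ⌜ 1ℚ ⌝ ⊕ z
Exp-2Artanh z z<1 = let (s , 0<s , s≤1 , h) = ∣∣<1⇒≼ {z} z<1 in Exp-2Artanh′ z s 0<s s≤1 h z<1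

opaque
  Log : (x : ℝ) → 0ℝ < x → ℝ
  Log = log

opaque
  unfolding _⊕_

  0<1⊕ : ∀ {x} → 0ℝ < x → 0ℝ < ⌜ 1ℚ ⌝ ⊕ x
  0<1⊕ {x} = 0<1+ {x}

opaque
  unfolding _⊕_ Log Artanh Inv 0<1⊕

  Log≈2Artanh : ∀ x 0<x → Log x 0<x ≈ ⌜ ι 2 ⌝ ⊛ Artanh (cayley x 0<x) (∣cayley∣<1 x 0<x)
  Log≈2Artanh x 0<x = pointwise-≈ {log x 0<x} {⌜ ι 2 ⌝ ⊛ Artanh (cayley x 0<x) (∣cayley∣<1 x 0<x)} λ _ → refl

  cayley≈ : ∀ x 0<x → cayley x 0<x ≈ (x ⊝ ⌜ 1ℚ ⌝) ⊛ Inv (⌜ 1ℚ ⌝ ⊕ x) (0<1⊕ {x} 0<x)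
  cayley≈ x 0<x = pointwise-≈ {cayley x 0<x} {(x ⊝ ⌜ 1ℚ ⌝) ⊛ Inv (⌜ 1ℚ ⌝ ⊕ x) (0<1⊕ {x} 0<x)} λ _ → refl

-- With u = 1 / (1 + x), the Cayley transform z satisfies 1 - z = 2u and 1 + z = 2xu. So
-- `Exp-2Artanh` reads X · 2u = 2xu, and multiplying by ½ (1 + x) isolates X.
Exp-Log : ∀ x 0<x → Exp (Log x 0<x) ≈ x
Exp-Log x 0<x = begin-equality
  X                                      ≈⟨ solve 1 (λ a → a := a :* con 1ℚ) ≈-refl X ⟩
  X ⊛ ⌜ 1ℚ ⌝                             ≈⟨ ⊛-cong ≈-refl yu ⟨
  X ⊛ (y ⊛ u)                            ≈⟨ solve 3 (λ X y u → X :* (y :* u) := con ½ :* (y :* (X :* (con (ι 2) :* u)))) ≈-refl X y u ⟩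
  ⌜ ½ ⌝ ⊛ (y ⊛ (X ⊛ (⌜ ι 2 ⌝ ⊛ u)))      ≈⟨ ⊛-cong ≈-refl (⊛-cong ≈-refl (⊛-cong ≈-refl 1-z≈)) ⟨
  ⌜ ½ ⌝ ⊛ (y ⊛ (X ⊛ (⌜ 1ℚ ⌝ ⊝ z)))       ≈⟨ ⊛-cong ≈-refl (⊛-cong ≈-refl (≈-trans (⊛-cong (Exp-cong (Log≈2Artanh x 0<x)) ≈-refl) (Exp-2Artanh z (∣cayley∣<1 x 0<x)))) ⟩
  ⌜ ½ ⌝ ⊛ (y ⊛ (⌜ 1ℚ ⌝ ⊕ z))             ≈⟨ ⊛-cong ≈-refl (⊛-cong ≈-refl 1+z≈) ⟩
  ⌜ ½ ⌝ ⊛ (y ⊛ (⌜ ι 2 ⌝ ⊛ x ⊛ u))        ≈⟨ solve 3 (λ x y u → con ½ :* (y :* (con (ι 2) :* x :* u)) := x :* (y :* u)) ≈-refl x y u ⟩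
  x ⊛ (y ⊛ u)                            ≈⟨ ⊛-cong ≈-refl yu ⟩
  x ⊛ ⌜ 1ℚ ⌝                             ≈⟨ solve 1 (λ a → a :* con 1ℚ := a) ≈-refl x ⟩
  x                                      ∎
  where
  X = Exp (Log x 0<x)
  z = cayley x 0<x
  y = ⌜ 1ℚ ⌝ ⊕ x
  u = Inv y (0<1⊕ {x} 0<x)
  yu : y ⊛ u ≈ ⌜ 1ℚ ⌝
  yu = Inv-inverseʳ y (0<1⊕ {x} 0<x)
  1-z≈ : ⌜ 1ℚ ⌝ ⊝ z ≈ ⌜ ι 2 ⌝ ⊛ u
  1-z≈ = ≈-trans (⊕-cong (≈-sym yu) (⊖-cong (cayley≈ x 0<x)))
    (solve 2 (λ x u → (con 1ℚ :+ x) :* u :- (x :- con 1ℚ) :* u := con (ι 2) :* u) ≈-refl x u)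
  1+z≈ : ⌜ 1ℚ ⌝ ⊕ z ≈ ⌜ ι 2 ⌝ ⊛ x ⊛ u
  1+z≈ = ≈-trans (⊕-cong (≈-sym yu) (cayley≈ x 0<x))
    (solve 2 (λ x u → (con 1ℚ :+ x) :* u :+ (x :- con 1ℚ) :* u := con (ι 2) :* x :* u) ≈-refl x u)

-- Likelihood-ratio potentials

½≤ : 0ℚ ℚ.≤ ½
½≤ = ℚ.<⇒≤ 0<½

0<1⊕Exp : ∀ x → 0ℝ < ⌜ 1ℚ ⌝ ⊕ Exp x
0<1⊕Exp x = 0<-≼-trans {⌜ 1ℚ ⌝} {⌜ 1ℚ ⌝ ⊕ Exp x} (0<⌜⌝ 0<1) (≼-by (Exp x) (0≼Exp x) ≈-refl)

-- This is log (1 + y) ≤ y. It serves for log 2 ≤ 1 and for the additive 3 = 4 - 1 in the bound on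
-- log (1/δ).
Exp≼⇒≼ : ∀ {x y} → Exp x ≼ ⌜ 1ℚ ⌝ ⊕ y → x ≼ y
Exp≼⇒≼ {x} {y} h = begin
  x                            ≈⟨ solve 1 (λ x → x := (con 1ℚ :+ x) :- con 1ℚ) ≈-refl x ⟩
  (⌜ 1ℚ ⌝ ⊕ x) ⊝ ⌜ 1ℚ ⌝        ≤⟨ ⊕-mono (≼-trans (1+x≼Exp x) h) ≼-refl ⟩
  (⌜ 1ℚ ⌝ ⊕ y) ⊝ ⌜ 1ℚ ⌝        ≈⟨ solve 1 (λ y → (con 1ℚ :+ y) :- con 1ℚ := y) ≈-refl y ⟩
  y                            ∎

module _ {p a l : ℝ} (Exp-a : Exp a ≈ p) (Exp-l : Exp l ≈ ⌜ ι 2 ⌝) where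

  √2p : ℝ
  √2p = Exp (⌜ ½ ⌝ ⊛ (l ⊕ a))

  √2p-square : √2p ⊛ √2p ≈ ⌜ ι 2 ⌝ ⊛ p
  √2p-square = ≈-trans (≈-sym (Exp-half (l ⊕ a))) (≈-trans (Exp-⊕ l a) (⊛-cong Exp-l Exp-a))

  -- With v = ½ log (2p), the inequality e⁻ᵛ ≥ 1 - v says v ≥ 1 - 1/√(2p); multiply by 2p.
  p-log-2p : ⌜ ι 2 ⌝ ⊛ p ⊝ √2p ≼ p ⊛ (l ⊕ a)
  p-log-2p = begin
    ⌜ ι 2 ⌝ ⊛ p ⊝ g                                   ≈⟨ ⊕-cong (≈-sym √2p-square) (⊖-cong (solve 1 (λ g → g := g :* con 1ℚ) ≈-refl g)) ⟩
    g ⊛ g ⊝ g ⊛ ⌜ 1ℚ ⌝                                ≈⟨ ⊕-cong ≈-refl (⊖-cong (⊛-cong ≈-refl (Exp-inverse (⌜ ½ ⌝ ⊛ (l ⊕ a))))) ⟨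
    g ⊛ g ⊝ g ⊛ (g ⊛ Exp (⊖ (⌜ ½ ⌝ ⊛ (l ⊕ a))))       ≈⟨ solve 2 (λ g e → g :* g :- g :* (g :* e) := g :* g :* (con 1ℚ :- e)) ≈-refl g (Exp (⊖ (⌜ ½ ⌝ ⊛ (l ⊕ a)))) ⟩
    g ⊛ g ⊛ (⌜ 1ℚ ⌝ ⊝ Exp (⊖ (⌜ ½ ⌝ ⊛ (l ⊕ a))))      ≤⟨ ⊛-monoˡ (g ⊛ g) (0≼-square g) (⊕-mono ≼-refl (⊖-anti (1+x≼Exp (⊖ (⌜ ½ ⌝ ⊛ (l ⊕ a)))))) ⟩
    g ⊛ g ⊛ (⌜ 1ℚ ⌝ ⊝ (⌜ 1ℚ ⌝ ⊕ ⊖ (⌜ ½ ⌝ ⊛ (l ⊕ a)))) ≈⟨ ⊛-cong √2p-square ≈-refl ⟩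
    ⌜ ι 2 ⌝ ⊛ p ⊛ (⌜ 1ℚ ⌝ ⊝ (⌜ 1ℚ ⌝ ⊕ ⊖ (⌜ ½ ⌝ ⊛ (l ⊕ a)))) ≈⟨ solve 2 (λ p x → con (ι 2) :* p :* (con 1ℚ :- (con 1ℚ :+ :- (con ½ :* x))) := p :* x) ≈-refl p (l ⊕ a) ⟩
    p ⊛ (l ⊕ a)                                       ∎
    where g = √2p

-- With g₁² = 2p and g₂² = 2q, the relative entropy of (p, q) to (½, ½) is at least
-- 2 − g₁ − g₂ = ½ (1 − g₁)² + ½ (1 − g₂)², while 1 − 2p = (1 − g₁)(1 + g₁).
entropy-bound : ∀ {p a b l u} → p ≼ ⌜ ½ ⌝ → Exp a ≈ p → Exp b ≈ ⌜ 1ℚ ⌝ ⊝ p → Exp l ≈ ⌜ ι 2 ⌝ →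
  l ⊛ u ≈ ⌜ 1ℚ ⌝ → ⌜ 0ℚ ⌝ ≼ u → let z = ⌜ 1ℚ ⌝ ⊝ ⌜ ι 2 ⌝ ⊛ p in
  ⌜ + 1 / 8 ⌝ ⊛ (z ⊛ z) ≼ ⌜ 1ℚ ⌝ ⊝ (⊖ (p ⊛ (a ⊛ u)) ⊝ (⌜ 1ℚ ⌝ ⊝ p) ⊛ (b ⊛ u))
entropy-bound {p} {a} {b} {l} {u} p≼½ Exp-a Exp-b Exp-l lu 0≼u = begin
  z²/8                                ≤⟨ z²/8≼F ⟩
  F                                   ≈⟨ solve 1 (λ a → a := con 1ℚ :* a) ≈-refl F ⟩
  -- `F` is the relative entropy in nats; the factor `u` = 1 / log 2 ≥ 1 converts it to bits and
  -- only enlarges it.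
  ⌜ 1ℚ ⌝ ⊛ F                          ≤⟨ ⊛-monoʳ F 0≼F 1≼u ⟩
  u ⊛ F                               ≈⟨ solve 5 (λ p a b l u → u :* (p :* (l :+ a) :+ (con 1ℚ :- p) :* (l :+ b)) := l :* u :- (:- (p :* (a :* u)) :- (con 1ℚ :- p) :* (b :* u))) ≈-refl p a b l u ⟩
  l ⊛ u ⊝ (⊖ (p ⊛ (a ⊛ u)) ⊝ q ⊛ (b ⊛ u)) ≈⟨ ⊕-cong lu ≈-refl ⟩
  ⌜ 1ℚ ⌝ ⊝ (⊖ (p ⊛ (a ⊛ u)) ⊝ q ⊛ (b ⊛ u)) ∎
  where
  q = ⌜ 1ℚ ⌝ ⊝ p
  z = ⌜ 1ℚ ⌝ ⊝ ⌜ ι 2 ⌝ ⊛ p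
  z²/8 = ⌜ + 1 / 8 ⌝ ⊛ (z ⊛ z)
  F = p ⊛ (l ⊕ a) ⊕ q ⊛ (l ⊕ b)
  g₁ = √2p Exp-a Exp-l
  g₂ = √2p Exp-b Exp-l
  g₁² : g₁ ⊛ g₁ ≈ ⌜ ι 2 ⌝ ⊛ p
  g₁² = √2p-square Exp-a Exp-l
  g₂² : g₂ ⊛ g₂ ≈ ⌜ ι 2 ⌝ ⊛ q
  g₂² = √2p-square Exp-b Exp-l
  l≼1 : l ≼ ⌜ 1ℚ ⌝
  l≼1 = Exp≼⇒≼ (≈⇒≼ (≈-trans Exp-l (solve 0 (con (ι 2) := con 1ℚ :+ con 1ℚ) ≈-refl)))
  1≼u : ⌜ 1ℚ ⌝ ≼ u
  1≼u = ≼-trans (≼-respˡ lu (⊛-monoʳ u 0≼u l≼1)) (≈⇒≼ (solve 1 (λ u → con 1ℚ :* u := u) ≈-refl u))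
  x = ⌜ 1ℚ ⌝ ⊝ g₁
  y = ⌜ 1ℚ ⌝ ⊝ g₂
  0≼z : ⌜ 0ℚ ⌝ ≼ z
  0≼z = ≼-respʳ (solve 1 (λ p → con (ι 2) :* (con ½ :- p) := con 1ℚ :- con (ι 2) :* p) ≈-refl p)
    (⊛-nonneg (⌜⌝-mono (0≤ι 2)) (0≼⊝ p≼½))
  sq : ⌜ ½ ⌝ ⊛ (x ⊛ x) ⊕ ⌜ ½ ⌝ ⊛ (y ⊛ y) ≈ (⌜ ι 2 ⌝ ⊛ p ⊝ g₁) ⊕ (⌜ ι 2 ⌝ ⊛ q ⊝ g₂)
  sq = ≈-trans (solve 2 (λ g k → con ½ :* ((con 1ℚ :- g) :* (con 1ℚ :- g)) :+ con ½ :* ((con 1ℚ :- k) :* (con 1ℚ :- k))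
      := con ½ :* (con (ι 2) :+ g :* g :+ k :* k) :- g :- k) ≈-refl g₁ g₂)
    (≈-trans (⊕-cong (⊕-cong (⊛-cong ≈-refl (⊕-cong (⊕-cong ≈-refl g₁²) g₂²)) ≈-refl) ≈-refl)
      (solve 3 (λ p g k → con ½ :* (con (ι 2) :+ con (ι 2) :* p :+ con (ι 2) :* (con 1ℚ :- p)) :- g :- k
        := (con (ι 2) :* p :- g) :+ (con (ι 2) :* (con 1ℚ :- p) :- k)) ≈-refl p g₁ g₂))
  x²/2≼F : ⌜ ½ ⌝ ⊛ (x ⊛ x) ≼ F
  x²/2≼F = ≼-trans (≼-by (⌜ ½ ⌝ ⊛ (y ⊛ y)) (⊛-nonneg (⌜⌝-mono ½≤) (0≼-square y)) ≈-refl)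
    (≼-respˡ (≈-sym sq) (⊕-mono (p-log-2p Exp-a Exp-l) (p-log-2p Exp-b Exp-l)))
  z≈ : z ≈ ⌜ 1ℚ ⌝ ⊝ g₁ ⊛ g₁
  z≈ = ⊕-cong ≈-refl (⊖-cong (≈-sym g₁²))
  z²/8≼x²/2 : z²/8 ≼ ⌜ ½ ⌝ ⊛ (x ⊛ x)
  -- As z = x (1 + g₁), the difference is ⅛ x² (4 - (1 + g₁)²). The last factor equals x² + 2z,
  -- whose sign follows from 0 ≤ z.
  z²/8≼x²/2 = ≼-by (⌜ + 1 / 8 ⌝ ⊛ (x ⊛ x ⊛ (x ⊛ x ⊕ ⌜ ι 2 ⌝ ⊛ z)))
    (⊛-nonneg (⌜⌝-mono (ℚ.nonNegative⁻¹ (+ 1 / 8))) (⊛-nonneg (0≼-square x) (0≼⊕ (0≼-square x) (⊛-nonneg (⌜⌝-mono (0≤ι 2)) 0≼z))))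
    (≈-sym (≈-trans (⊕-cong (⊛-cong ≈-refl (⊛-cong z≈ z≈)) (⊛-cong ≈-refl (⊛-cong ≈-refl (⊕-cong ≈-refl (⊛-cong ≈-refl z≈)))))
      (solve 1 (λ g → let x = con 1ℚ :- g ; z = con 1ℚ :- g :* g in
        con (+ 1 / 8) :* (z :* z) :+ con (+ 1 / 8) :* (x :* x :* (x :* x :+ con (ι 2) :* z)) := con ½ :* (x :* x)) ≈-refl g₁)))
  z²/8≼F : z²/8 ≼ F
  z²/8≼F = ≼-trans z²/8≼x²/2 x²/2≼F
  0≼F : ⌜ 0ℚ ⌝ ≼ F
  0≼F = ≼-trans (⊛-nonneg (⌜⌝-mono ½≤) (0≼-square x)) x²/2≼F

module Channel {p lo : ℝ} (0<p : 0ℝ < p) (p≼½ : p ≼ ⌜ ½ ⌝) (Exp-lo : Exp lo ⊛ p ≈ ⌜ 1ℚ ⌝ ⊝ p) where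

  q z : ℝ
  q = ⌜ 1ℚ ⌝ ⊝ p
  z = ⌜ 1ℚ ⌝ ⊝ ⌜ ι 2 ⌝ ⊛ p

  0≼p : ⌜ 0ℚ ⌝ ≼ p
  0≼p = 0<⇒0≼ {p} 0<p

  0≼z : ⌜ 0ℚ ⌝ ≼ z
  0≼z = ≼-respʳ (solve 1 (λ p → con (ι 2) :* (con ½ :- p) := con 1ℚ :- con (ι 2) :* p) ≈-refl p)
    (⊛-nonneg (⌜⌝-mono (0≤ι 2)) (0≼⊝ p≼½))

  ½≼q : ⌜ ½ ⌝ ≼ q
  ½≼q = ≼-by (⌜ ½ ⌝ ⊝ p) (0≼⊝ p≼½) (solve 1 (λ p → con 1ℚ :- p := con ½ :+ (con ½ :- p)) ≈-refl p)

  0≼q : ⌜ 0ℚ ⌝ ≼ q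
  0≼q = ≼-trans (⌜⌝-mono ½≤) ½≼q

  0<q : 0ℝ < q
  0<q = 0<-≼-trans {⌜ ½ ⌝} {q} (0<⌜⌝ 0<½) ½≼q

  up : ∀ x → Exp (x ⊕ lo) ⊛ p ≈ Exp x ⊛ q
  up x = ≈-trans (⊛-cong (Exp-⊕ x lo) ≈-refl) (≈-trans (solve 3 (λ a b p → a :* b :* p := a :* (b :* p)) ≈-refl (Exp x) (Exp lo) p)
    (⊛-cong ≈-refl Exp-lo))

  down : ∀ x → Exp (x ⊝ lo) ⊛ q ≈ Exp x ⊛ p
  down x = ≈-trans (≈-sym (up (x ⊝ lo))) (⊛-cong (Exp-cong (solve 2 (λ x l → (x :- l) :+ l := x) ≈-refl x lo)) ≈-refl)

  -- Under the all-zero sequence the queried bit is seen as 0 with probability q, which multiplies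
  -- the likelihood ratio by p/q, and as 1 with probability p, which multiplies it by q/p. Because
  -- of this the eˣ part of either potential contributes nothing to its drop.
  martingale : ∀ x → q ⊛ Exp (x ⊝ lo) ⊕ p ⊛ Exp (x ⊕ lo) ≈ Exp x
  martingale x = ≈-trans (solve 3 (λ p a b → (con 1ℚ :- p) :* a :+ p :* b := a :* (con 1ℚ :- p) :+ b :* p) ≈-refl p (Exp (x ⊝ lo)) (Exp (x ⊕ lo)))
    (≈-trans (⊕-cong (down x) (up x)) (solve 2 (λ p a → a :* p :+ a :* (con 1ℚ :- p) := a) ≈-refl p (Exp x)))

  -- From p = e^(-lo) q ≥ (1 - lo) q one gets z = q - p ≤ lo · q ≤ lo. The right-hand side `z ⊛ lo`
  -- is the divergence D.
  z²≼z⊛lo : ⌜ 0ℚ ⌝ ≼ lo → z ⊛ z ≼ z ⊛ lo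
  z²≼z⊛lo 0≼lo = ⊛-monoˡ z 0≼z (begin
    z                                   ≈⟨ solve 1 (λ p → con 1ℚ :- con (ι 2) :* p := (con 1ℚ :- p) :- p) ≈-refl p ⟩
    q ⊝ p                               ≈⟨ ⊕-cong ≈-refl (⊖-cong (≈-trans (≈-sym Exp--lo) (⊛-cong ≈-refl ≈-refl))) ⟩
    q ⊝ Exp (⊖ lo) ⊛ q                  ≤⟨ ⊕-mono ≼-refl (⊖-anti (⊛-monoʳ q 0≼q (1+x≼Exp (⊖ lo)))) ⟩
    q ⊝ (⌜ 1ℚ ⌝ ⊕ ⊖ lo) ⊛ q             ≤⟨ ≼-by (p ⊛ lo) (⊛-nonneg 0≼p 0≼lo)
      (solve 2 (λ p l → l := ((con 1ℚ :- p) :- (con 1ℚ :+ :- l) :* (con 1ℚ :- p)) :+ p :* l) ≈-refl p lo) ⟩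
    lo                                  ∎)
    where
    Exp--lo : Exp (⊖ lo) ⊛ q ≈ p
    Exp--lo = ≈-trans (⊛-cong (Exp-cong (solve 1 (λ l → :- l := con 0ℚ :- l) ≈-refl lo)) ≈-refl)
      (≈-trans (down ⌜ 0ℚ ⌝) (≈-trans (⊛-cong Exp-0 ≈-refl) (solve 1 (λ p → con 1ℚ :* p := p) ≈-refl p)))

  -- Here x is the log-likelihood ratio; an uninformative query leaves it unchanged, an informative one moves it by ± lo.
  record Potential (φ : ℝ → ℝ) (d : ℝ) : Set where
    field
      φ≼1   : ∀ x → φ x ≼ ⌜ 1ℚ ⌝
      φ≼Exp : ∀ x → φ x ≼ Exp x
      drop  : ∀ x → φ x ≼ (q ⊛ φ (x ⊝ lo) ⊕ p ⊛ φ (x ⊕ lo)) ⊕ d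

  -- The tangent of log to e^(-X), on top of the tangent of log to 2.
  module Bretagnolle–Huber (X : ℝ) where

    C : ℝ
    C = ⌜ ½ ⌝ ⊛ Exp (⊖ X)

    φ : ℝ → ℝ
    φ x = C ⊛ ((⌜ ι 2 ⌝ ⊕ X ⊕ x) ⊝ ⌜ ½ ⌝ ⊛ (⌜ 1ℚ ⌝ ⊕ Exp x))

    0≼C : ⌜ 0ℚ ⌝ ≼ C
    0≼C = ⊛-nonneg (⌜⌝-mono ½≤) (0≼Exp (⊖ X))

    private
      module _ (x : ℝ) where
        m = Exp (⌜ ½ ⌝ ⊛ x)
        f = Exp (⌜ ½ ⌝ ⊛ X)

        -- This is 1 + t ≤ eᵗ at t = ½ (x + X). With L = m² and u = 1/f the new bound is m u - ¼ (1
        -- + L) u², which is at most L / (1 + L) for every u; hence it lies below both 1 and L.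
        φ≼ : φ x ≼ C ⊛ (⌜ ι 2 ⌝ ⊛ (m ⊛ f) ⊝ ⌜ ½ ⌝ ⊛ (⌜ 1ℚ ⌝ ⊕ m ⊛ m))
        φ≼ = ⊛-monoˡ C 0≼C (⊕-mono (begin
          ⌜ ι 2 ⌝ ⊕ X ⊕ x                                   ≈⟨ solve 2 (λ X x → con (ι 2) :+ X :+ x := con (ι 2) :* (con 1ℚ :+ (con ½ :* x :+ con ½ :* X))) ≈-refl X x ⟩
          ⌜ ι 2 ⌝ ⊛ (⌜ 1ℚ ⌝ ⊕ (⌜ ½ ⌝ ⊛ x ⊕ ⌜ ½ ⌝ ⊛ X))      ≤⟨ ⊛-monoˡ ⌜ ι 2 ⌝ (⌜⌝-mono (0≤ι 2)) (1+x≼Exp _) ⟩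
          ⌜ ι 2 ⌝ ⊛ Exp (⌜ ½ ⌝ ⊛ x ⊕ ⌜ ½ ⌝ ⊛ X)             ≈⟨ ⊛-cong ≈-refl (Exp-⊕ (⌜ ½ ⌝ ⊛ x) (⌜ ½ ⌝ ⊛ X)) ⟩
          ⌜ ι 2 ⌝ ⊛ (m ⊛ f)                                 ∎)
          (≈⇒≼ (⊖-cong (⊛-cong ≈-refl (⊕-cong ≈-refl (Exp-half x))))))

        Cff : C ⊛ (f ⊛ f) ≈ ⌜ ½ ⌝
        Cff = ≈-trans (⊛-cong ≈-refl (≈-sym (Exp-half X))) (≈-trans (solve 2 (λ a b → con ½ :* a :* b := con ½ :* (b :* a)) ≈-refl (Exp (⊖ X)) (Exp X))
          (≈-trans (⊛-cong ≈-refl (Exp-inverse X)) (solve 0 (con ½ :* con 1ℚ := con ½) ≈-refl)))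

        ≼1 : φ x ≼ ⌜ 1ℚ ⌝
        ≼1 = ≼-trans φ≼ (≼-by (C ⊛ (⌜ ½ ⌝ ⊛ ((⌜ ι 2 ⌝ ⊛ f ⊝ m) ⊛ (⌜ ι 2 ⌝ ⊛ f ⊝ m)) ⊕ ⌜ ½ ⌝))
          (⊛-nonneg 0≼C (0≼⊕ (⊛-nonneg (⌜⌝-mono ½≤) (0≼-square (⌜ ι 2 ⌝ ⊛ f ⊝ m))) (⌜⌝-mono ½≤)))
          (≈-sym (≈-trans (solve 3 (λ C f m → C :* (con (ι 2) :* (m :* f) :- con ½ :* (con 1ℚ :+ m :* m)) :+
              C :* (con ½ :* ((con (ι 2) :* f :- m) :* (con (ι 2) :* f :- m)) :+ con ½) := con (ι 2) :* (C :* (f :* f))) ≈-refl C f m)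
            (≈-trans (⊛-cong ≈-refl Cff) (solve 0 (con (ι 2) :* con ½ := con 1ℚ) ≈-refl)))))

        ≼Exp : φ x ≼ Exp x
        ≼Exp = ≼-respʳ (≈-sym (Exp-half x)) (≼-trans φ≼ (≼-by (C ⊛ (⌜ ½ ⌝ ⊛ ((⌜ ι 2 ⌝ ⊛ (m ⊛ f) ⊝ ⌜ 1ℚ ⌝) ⊛ (⌜ ι 2 ⌝ ⊛ (m ⊛ f) ⊝ ⌜ 1ℚ ⌝)) ⊕ ⌜ ½ ⌝ ⊛ (m ⊛ m)))
          (⊛-nonneg 0≼C (0≼⊕ (⊛-nonneg (⌜⌝-mono ½≤) (0≼-square (⌜ ι 2 ⌝ ⊛ (m ⊛ f) ⊝ ⌜ 1ℚ ⌝))) (⊛-nonneg (⌜⌝-mono ½≤) (0≼-square m))))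
          (≈-sym (≈-trans (solve 3 (λ C f m → C :* (con (ι 2) :* (m :* f) :- con ½ :* (con 1ℚ :+ m :* m)) :+
              C :* (con ½ :* ((con (ι 2) :* (m :* f) :- con 1ℚ) :* (con (ι 2) :* (m :* f) :- con 1ℚ)) :+ con ½ :* (m :* m)) := con (ι 2) :* (C :* (f :* f)) :* (m :* m)) ≈-refl C f m)
            (≈-trans (⊛-cong (⊛-cong ≈-refl Cff) ≈-refl) (solve 1 (λ a → con (ι 2) :* con ½ :* a := a) ≈-refl (m ⊛ m)))))))

    -- `drop` is an equality: the eˣ part is a martingale, and x has mean drift -(1 - 2p) lo.
    potential : Potential φ (C ⊛ (z ⊛ lo))
    potential = record { φ≼1 = ≼1 ; φ≼Exp = ≼Exp ; drop = λ x → ≈⇒≼ (≈-sym (≈-trans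
      (solve 7 (λ p C X x l a b →
          ((con 1ℚ :- p) :* (C :* ((con (ι 2) :+ X :+ (x :- l)) :- con ½ :* (con 1ℚ :+ a))) :+ p :* (C :* ((con (ι 2) :+ X :+ (x :+ l)) :- con ½ :* (con 1ℚ :+ b)))) :+ C :* ((con 1ℚ :- con (ι 2) :* p) :* l)
          := C :* ((con (ι 2) :+ X :+ x) :- con ½ :* (con 1ℚ :+ ((con 1ℚ :- p) :* a :+ p :* b)))) ≈-refl
        p C X x lo (Exp (x ⊝ lo)) (Exp (x ⊕ lo)))
      (⊛-cong ≈-refl (⊕-cong ≈-refl (⊖-cong (⊛-cong ≈-refl (⊕-cong ≈-refl (martingale x)))))))) }

    φ-0 : φ ⌜ 0ℚ ⌝ ≈ C ⊛ (⌜ 1ℚ ⌝ ⊕ X)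
    φ-0 = ⊛-cong ≈-refl (≈-trans (⊕-cong ≈-refl (⊖-cong (⊛-cong ≈-refl (⊕-cong ≈-refl Exp-0))))
      (solve 1 (λ X → (con (ι 2) :+ X :+ con 0ℚ) :- con ½ :* (con 1ℚ :+ con 1ℚ) := con 1ℚ :+ X) ≈-refl X))

  -- min(1, L) bounds (1+L)/2 − (η(1+L) + (1−L)²/(η(1+L)))/4 at L = eˣ, with η = 1/50.
  module Vincze–LeCam where

    S y φ : ℝ → ℝ
    S x = ⌜ 1ℚ ⌝ ⊕ Exp x
    y x = Inv (S x) (0<1⊕Exp x)
    φ x = ⌜ ι 50 ⌝ ⊛ (⌜ 1ℚ ⌝ ⊝ y x) ⊝ ⌜ + 2401 / 200 ⌝ ⊛ S x

    private
      module _ (x : ℝ) where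
        Sy : S x ⊛ y x ≈ ⌜ 1ℚ ⌝
        Sy = Inv-inverseʳ (S x) (0<1⊕Exp x)

        0≼y : ⌜ 0ℚ ⌝ ≼ y x
        0≼y = Inv-nonneg (S x) (0<1⊕Exp x)

        -- For c = 1 - η and c = 1 + η the base c S - 2 is (L - 1) - η S and (L - 1) + η S. Times
        -- 1/(4η) = 25/2, the two expressions are the slacks 1 - φ and L - φ left by the inequality
        -- of arithmetic and geometric means.
        gap : ∀ c → ⌜ 0ℚ ⌝ ≼ y x ⊛ ((⌜ c ⌝ ⊛ S x ⊝ ⌜ ι 2 ⌝) ⊛ (⌜ c ⌝ ⊛ S x ⊝ ⌜ ι 2 ⌝))
        gap c = ⊛-nonneg 0≼y (0≼-square (⌜ c ⌝ ⊛ S x ⊝ ⌜ ι 2 ⌝))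

        gap≈ : ∀ c → y x ⊛ ((⌜ c ⌝ ⊛ S x ⊝ ⌜ ι 2 ⌝) ⊛ (⌜ c ⌝ ⊛ S x ⊝ ⌜ ι 2 ⌝)) ≈ ⌜ c ⌝ ⊛ ⌜ c ⌝ ⊛ S x ⊝ ⌜ ι 4 ⌝ ⊛ ⌜ c ⌝ ⊕ ⌜ ι 4 ⌝ ⊛ y x
        gap≈ c = ≈-trans (solve 3 (λ y S c → y :* ((c :* S :- con (ι 2)) :* (c :* S :- con (ι 2))) := c :* c :* S :* (S :* y) :- con (ι 4) :* c :* (S :* y) :+ con (ι 4) :* y) ≈-refl (y x) (S x) ⌜ c ⌝)
          (≈-trans (⊕-cong (⊕-cong (⊛-cong ≈-refl Sy) (⊖-cong (⊛-cong ≈-refl Sy))) ≈-refl)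
            (solve 3 (λ y S c → c :* c :* S :* con 1ℚ :- con (ι 4) :* c :* con 1ℚ :+ con (ι 4) :* y := c :* c :* S :- con (ι 4) :* c :+ con (ι 4) :* y) ≈-refl (y x) (S x) ⌜ c ⌝))

        ≼1 : φ x ≼ ⌜ 1ℚ ⌝
        ≼1 = ≼-by (⌜ + 25 / 2 ⌝ ⊛ (y x ⊛ ((⌜ + 49 / 50 ⌝ ⊛ S x ⊝ ⌜ ι 2 ⌝) ⊛ (⌜ + 49 / 50 ⌝ ⊛ S x ⊝ ⌜ ι 2 ⌝))))
          (⊛-nonneg (⌜⌝-mono (ℚ.nonNegative⁻¹ (+ 25 / 2))) (gap (+ 49 / 50)))
          (≈-sym (≈-trans (⊕-cong ≈-refl (⊛-cong ≈-refl (gap≈ (+ 49 / 50))))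
            (solve 2 (λ y S → (con (ι 50) :* (con 1ℚ :- y) :- con (+ 2401 / 200) :* S) :+ con (+ 25 / 2) :* (con (+ 49 / 50) :* con (+ 49 / 50) :* S :- con (ι 4) :* con (+ 49 / 50) :+ con (ι 4) :* y) := con 1ℚ) ≈-refl (y x) (S x))))

        ≼Exp : φ x ≼ Exp x
        ≼Exp = ≼-by (⌜ + 25 / 2 ⌝ ⊛ (y x ⊛ ((⌜ + 51 / 50 ⌝ ⊛ S x ⊝ ⌜ ι 2 ⌝) ⊛ (⌜ + 51 / 50 ⌝ ⊛ S x ⊝ ⌜ ι 2 ⌝))))
          (⊛-nonneg (⌜⌝-mono (ℚ.nonNegative⁻¹ (+ 25 / 2))) (gap (+ 51 / 50)))
          (≈-sym (≈-trans (⊕-cong ≈-refl (⊛-cong ≈-refl (gap≈ (+ 51 / 50))))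
            (solve 2 (λ y L → (con (ι 50) :* (con 1ℚ :- y) :- con (+ 2401 / 200) :* (con 1ℚ :+ L)) :+ con (+ 25 / 2) :* (con (+ 51 / 50) :* con (+ 51 / 50) :* (con 1ℚ :+ L) :- con (ι 4) :* con (+ 51 / 50) :+ con (ι 4) :* y) := L) ≈-refl (y x) (Exp x))))

        L = Exp x
        -- `A` and `B` weigh the observations 0 and 1: null probability plus L times the probability
        -- when the bit is 1. Then a = 1/A, b = 1/B and W = 1/(S A B), so that q a and p b are the
        -- two possible next values of `y`.
        a b A B W P : ℝ
        a = y (x ⊝ lo) ⊛ Inv q 0<q
        b = y (x ⊕ lo) ⊛ Inv p 0<p
        A = q ⊕ L ⊛ p
        B = p ⊕ L ⊛ q
        W = y x ⊛ a ⊛ b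

        qa : q ⊛ a ≈ y (x ⊝ lo)
        qa = ≈-trans (solve 3 (λ q y i → q :* (y :* i) := y :* (q :* i)) ≈-refl q (y (x ⊝ lo)) (Inv q 0<q))
          (≈-trans (⊛-cong ≈-refl (Inv-inverseʳ q 0<q)) (solve 1 (λ y → y :* con 1ℚ := y) ≈-refl (y (x ⊝ lo))))

        pb : p ⊛ b ≈ y (x ⊕ lo)
        pb = ≈-trans (solve 3 (λ q y i → q :* (y :* i) := y :* (q :* i)) ≈-refl p (y (x ⊕ lo)) (Inv p 0<p))
          (≈-trans (⊛-cong ≈-refl (Inv-inverseʳ p 0<p)) (solve 1 (λ y → y :* con 1ℚ := y) ≈-refl (y (x ⊕ lo))))

        Aa : A ⊛ a ≈ ⌜ 1ℚ ⌝
        Aa = begin-equality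
          (q ⊕ L ⊛ p) ⊛ a                    ≈⟨ ⊛-cong (⊕-cong ≈-refl (≈-sym (down x))) ≈-refl ⟩
          (q ⊕ Exp (x ⊝ lo) ⊛ q) ⊛ a         ≈⟨ solve 3 (λ q e a → (q :+ e :* q) :* a := (con 1ℚ :+ e) :* (q :* a)) ≈-refl q (Exp (x ⊝ lo)) a ⟩
          S (x ⊝ lo) ⊛ (q ⊛ a)               ≈⟨ ⊛-cong ≈-refl qa ⟩
          S (x ⊝ lo) ⊛ y (x ⊝ lo)            ≈⟨ Inv-inverseʳ (S (x ⊝ lo)) (0<1⊕Exp (x ⊝ lo)) ⟩
          ⌜ 1ℚ ⌝                             ∎

        Bb : B ⊛ b ≈ ⌜ 1ℚ ⌝
        Bb = begin-equality
          (p ⊕ L ⊛ q) ⊛ b                    ≈⟨ ⊛-cong (⊕-cong ≈-refl (≈-sym (up x))) ≈-refl ⟩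
          (p ⊕ Exp (x ⊕ lo) ⊛ p) ⊛ b         ≈⟨ solve 3 (λ q e a → (q :+ e :* q) :* a := (con 1ℚ :+ e) :* (q :* a)) ≈-refl p (Exp (x ⊕ lo)) b ⟩
          S (x ⊕ lo) ⊛ (p ⊛ b)               ≈⟨ ⊛-cong ≈-refl pb ⟩
          S (x ⊕ lo) ⊛ y (x ⊕ lo)            ≈⟨ Inv-inverseʳ (S (x ⊕ lo)) (0<1⊕Exp (x ⊕ lo)) ⟩
          ⌜ 1ℚ ⌝                             ∎

        0≼a : ⌜ 0ℚ ⌝ ≼ a
        0≼a = ⊛-nonneg (Inv-nonneg (S (x ⊝ lo)) (0<1⊕Exp (x ⊝ lo))) (Inv-nonneg q 0<q)

        0≼b : ⌜ 0ℚ ⌝ ≼ b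
        0≼b = ⊛-nonneg (Inv-nonneg (S (x ⊕ lo)) (0<1⊕Exp (x ⊕ lo))) (Inv-nonneg p 0<p)

        P = (z ⊛ z) ⊛ (L ⊕ S x ⊛ (p ⊛ q ⊛ ((⌜ 1ℚ ⌝ ⊝ L) ⊛ (⌜ 1ℚ ⌝ ⊝ L))))

        0≼P : ⌜ 0ℚ ⌝ ≼ P
        0≼P = ⊛-nonneg (0≼-square z) (0≼⊕ (0≼Exp x) (⊛-nonneg (0≼⊕ 0≼1 (0≼Exp x)) (⊛-nonneg (⊛-nonneg 0≼p 0≼q) (0≼-square (⌜ 1ℚ ⌝ ⊝ L)))))

        -- Multiplying by (1 + L) A B = 1 / (y a b) turns the average drop of y into the polynomial P.
        polynomial : (A ⊛ B ⊕ (z ⊛ z) ⊛ (S x ⊛ (A ⊛ B))) ⊝ S x ⊛ (q ⊛ q ⊛ B ⊕ p ⊛ p ⊛ A) ≈ P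
        polynomial = solve 2 (λ L p → let q = con 1ℚ :- p ; z = con 1ℚ :- con (ι 2) :* p ; A = q :+ L :* p ; B = p :+ L :* q ; S = con 1ℚ :+ L in
          (A :* B :+ (z :* z) :* (S :* (A :* B))) :- S :* (q :* q :* B :+ p :* p :* A)
            := (z :* z) :* (L :+ S :* (p :* q :* ((con 1ℚ :- L) :* (con 1ℚ :- L))))) ≈-refl L p

        -- The likelihood ratio is a martingale, so φ drops only through the convex function y = 1 /
        -- (1 + L). Its mean rises by at most (1 - 2p)², which stays bounded as p → 0, unlike the
        -- drift of the logarithm.
        y-drop : q ⊛ y (x ⊝ lo) ⊕ p ⊛ y (x ⊕ lo) ≼ y x ⊕ z ⊛ z
        y-drop = ≼-by (W ⊛ P) (⊛-nonneg (⊛-nonneg (⊛-nonneg 0≼y 0≼a) 0≼b) 0≼P) (≈-sym (begin-equality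
          (q ⊛ y (x ⊝ lo) ⊕ p ⊛ y (x ⊕ lo)) ⊕ W ⊛ P    ≈⟨ ⊕-cong (⊕-cong (⊛-cong ≈-refl (≈-sym qa)) (⊛-cong ≈-refl (≈-sym pb))) (⊛-cong ≈-refl (≈-sym polynomial)) ⟩
          (q ⊛ (q ⊛ a) ⊕ p ⊛ (p ⊛ b)) ⊕ W ⊛ ((A ⊛ B ⊕ (z ⊛ z) ⊛ (S x ⊛ (A ⊛ B))) ⊝ S x ⊛ (q ⊛ q ⊛ B ⊕ p ⊛ p ⊛ A))
            ≈⟨ solve 9 (λ q p z S y A B a b →
              (q :* (q :* a) :+ p :* (p :* b)) :+ y :* a :* b :* ((A :* B :+ (z :* z) :* (S :* (A :* B))) :- S :* (q :* q :* B :+ p :* p :* A))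
              := (q :* (q :* a) :+ p :* (p :* b)) :+ ((y :* ((A :* a) :* (B :* b)) :+ z :* z :* ((S :* y) :* ((A :* a) :* (B :* b)))) :- (q :* (q :* a) :* ((S :* y) :* (B :* b)) :+ p :* (p :* b) :* ((S :* y) :* (A :* a)))))
              ≈-refl q p z (S x) (y x) A B a b ⟩
          (q ⊛ (q ⊛ a) ⊕ p ⊛ (p ⊛ b)) ⊕ ((y x ⊛ ((A ⊛ a) ⊛ (B ⊛ b)) ⊕ z ⊛ z ⊛ ((S x ⊛ y x) ⊛ ((A ⊛ a) ⊛ (B ⊛ b)))) ⊝ (q ⊛ (q ⊛ a) ⊛ ((S x ⊛ y x) ⊛ (B ⊛ b)) ⊕ p ⊛ (p ⊛ b) ⊛ ((S x ⊛ y x) ⊛ (A ⊛ a))))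
            ≈⟨ ⊕-cong ≈-refl (⊕-cong (⊕-cong (⊛-cong ≈-refl (⊛-cong Aa Bb)) (⊛-cong ≈-refl (⊛-cong Sy (⊛-cong Aa Bb))))
                 (⊖-cong (⊕-cong (⊛-cong ≈-refl (⊛-cong Sy Bb)) (⊛-cong ≈-refl (⊛-cong Sy Aa))))) ⟩
          (q ⊛ (q ⊛ a) ⊕ p ⊛ (p ⊛ b)) ⊕ ((y x ⊛ (⌜ 1ℚ ⌝ ⊛ ⌜ 1ℚ ⌝) ⊕ z ⊛ z ⊛ (⌜ 1ℚ ⌝ ⊛ (⌜ 1ℚ ⌝ ⊛ ⌜ 1ℚ ⌝))) ⊝ (q ⊛ (q ⊛ a) ⊛ (⌜ 1ℚ ⌝ ⊛ ⌜ 1ℚ ⌝) ⊕ p ⊛ (p ⊛ b) ⊛ (⌜ 1ℚ ⌝ ⊛ ⌜ 1ℚ ⌝)))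
            ≈⟨ solve 4 (λ u v y z → (u :+ v) :+ ((y :* (con 1ℚ :* con 1ℚ) :+ z :* z :* (con 1ℚ :* (con 1ℚ :* con 1ℚ))) :- (u :* (con 1ℚ :* con 1ℚ) :+ v :* (con 1ℚ :* con 1ℚ))) := y :+ z :* z) ≈-refl (q ⊛ (q ⊛ a)) (p ⊛ (p ⊛ b)) (y x) z ⟩
          y x ⊕ z ⊛ z                                  ∎))

        φ-drop : φ x ≼ (q ⊛ φ (x ⊝ lo) ⊕ p ⊛ φ (x ⊕ lo)) ⊕ ⌜ ι 50 ⌝ ⊛ (z ⊛ z)
        φ-drop = ≼-by (⌜ ι 50 ⌝ ⊛ ((y x ⊕ z ⊛ z) ⊝ (q ⊛ y (x ⊝ lo) ⊕ p ⊛ y (x ⊕ lo))))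
          (⊛-nonneg (⌜⌝-mono (0≤ι 50)) (0≼⊝ y-drop))
          (≈-trans
            (solve 7 (λ p e f u v y zz →
              (((con 1ℚ :- p) :* (con (ι 50) :* (con 1ℚ :- u) :- con (+ 2401 / 200) :* (con 1ℚ :+ e)) :+ p :* (con (ι 50) :* (con 1ℚ :- v) :- con (+ 2401 / 200) :* (con 1ℚ :+ f))) :+ con (ι 50) :* zz)
              := ((con (ι 50) :* (con 1ℚ :- y) :- con (+ 2401 / 200) :* (con 1ℚ :+ ((con 1ℚ :- p) :* e :+ p :* f))) :+ con (ι 50) :* ((y :+ zz) :- ((con 1ℚ :- p) :* u :+ p :* v))))
              ≈-refl p (Exp (x ⊝ lo)) (Exp (x ⊕ lo)) (y (x ⊝ lo)) (y (x ⊕ lo)) (y x) (z ⊛ z))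
            (⊕-cong (⊕-cong ≈-refl (⊖-cong (⊛-cong ≈-refl (⊕-cong ≈-refl (martingale x))))) ≈-refl))

    potential : Potential φ (⌜ ι 50 ⌝ ⊛ (z ⊛ z))
    potential = record { φ≼1 = ≼1 ; φ≼Exp = ≼Exp ; drop = φ-drop }

    -- The value is 1 - η/2; any η below 1/25 keeps it above 2 · 0.49, and η = 1/50 leaves a gap of
    -- 1/100.
    φ-0 : φ ⌜ 0ℚ ⌝ ≈ ⌜ + 99 / 100 ⌝
    φ-0 = begin-equality
      ⌜ ι 50 ⌝ ⊛ (⌜ 1ℚ ⌝ ⊝ y ⌜ 0ℚ ⌝) ⊝ ⌜ + 2401 / 200 ⌝ ⊛ (⌜ 1ℚ ⌝ ⊕ Exp ⌜ 0ℚ ⌝)   ≈⟨ ⊕-cong (⊛-cong ≈-refl (⊕-cong ≈-refl (⊖-cong y0))) (⊖-cong (⊛-cong ≈-refl S0)) ⟩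
      ⌜ ι 50 ⌝ ⊛ (⌜ 1ℚ ⌝ ⊝ ⌜ ½ ⌝) ⊝ ⌜ + 2401 / 200 ⌝ ⊛ ⌜ ι 2 ⌝                    ≈⟨ solve 0 (con (ι 50) :* (con 1ℚ :- con ½) :- con (+ 2401 / 200) :* con (ι 2) := con (+ 99 / 100)) ≈-refl ⟩
      ⌜ + 99 / 100 ⌝ ∎
      where
      S0 : S ⌜ 0ℚ ⌝ ≈ ⌜ ι 2 ⌝
      S0 = ≈-trans (⊕-cong ≈-refl Exp-0) (solve 0 (con 1ℚ :+ con 1ℚ := con (ι 2)) ≈-refl)
      y0 : y ⌜ 0ℚ ⌝ ≈ ⌜ ½ ⌝
      y0 = ≈-trans (solve 1 (λ y → y := con ½ :* (con (ι 2) :* y)) ≈-refl (y ⌜ 0ℚ ⌝))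
        (≈-trans (⊛-cong ≈-refl (≈-trans (⊛-cong (≈-sym S0) ≈-refl) (Inv-inverseʳ (S ⌜ 0ℚ ⌝) (0<1⊕Exp ⌜ 0ℚ ⌝))))
          (solve 0 (con ½ :* con 1ℚ := con ½) ≈-refl))

-- Adaptive algorithms

∑ : ∀ {n} → (Fin n → ℝ) → ℝ
∑ {zero}  f = ⌜ 0ℚ ⌝
∑ {suc n} f = f zero ⊕ ∑ (λ k → f (suc k))

∑-mono : ∀ {n} {f g : Fin n → ℝ} → (∀ k → f k ≼ g k) → ∑ f ≼ ∑ g
∑-mono {zero}  h = ≼-refl
∑-mono {suc n} h = ⊕-mono (h zero) (∑-mono λ k → h (suc k))

∑-cong : ∀ {n} {f g : Fin n → ℝ} → (∀ k → f k ≈ g k) → ∑ f ≈ ∑ g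
∑-cong h = ≼-antisym (∑-mono λ k → ≈⇒≼ (h k)) (∑-mono λ k → ≈⇒≼ (≈-sym (h k)))

∑-⊕ : ∀ {n} (f g : Fin n → ℝ) → ∑ (λ k → f k ⊕ g k) ≈ ∑ f ⊕ ∑ g
∑-⊕ {zero}  f g = solve 0 (con 0ℚ := con 0ℚ :+ con 0ℚ) ≈-refl
∑-⊕ {suc n} f g = ≈-trans (⊕-cong ≈-refl (∑-⊕ (λ k → f (suc k)) (λ k → g (suc k))))
  (solve 4 (λ a b x y → (a :+ b) :+ (x :+ y) := (a :+ x) :+ (b :+ y)) ≈-refl
    (f zero) (g zero) (∑ λ k → f (suc k)) (∑ λ k → g (suc k)))

∑-⊛ : ∀ {n} c (f : Fin n → ℝ) → ∑ (λ k → c ⊛ f k) ≈ c ⊛ ∑ f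
∑-⊛ {zero}  c f = solve 1 (λ c → con 0ℚ := c :* con 0ℚ) ≈-refl c
∑-⊛ {suc n} c f = ≈-trans (⊕-cong ≈-refl (∑-⊛ c λ k → f (suc k)))
  (solve 3 (λ c a b → c :* a :+ c :* b := c :* (a :+ b)) ≈-refl c (f zero) (∑ λ k → f (suc k)))

∑-⊛ʳ : ∀ {n} (f : Fin n → ℝ) c → ∑ (λ k → f k ⊛ c) ≈ ∑ f ⊛ c
∑-⊛ʳ f c = ≈-trans (∑-cong λ k → solve 2 (λ a c → a :* c := c :* a) ≈-refl (f k) c)
  (≈-trans (∑-⊛ c f) (solve 2 (λ a c → c :* a := a :* c) ≈-refl (∑ f) c))

∑-const : ∀ n c → ∑ {n} (λ _ → c) ≈ ⌜ ι n ⌝ ⊛ c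
∑-const zero    c = solve 1 (λ c → con 0ℚ := con 0ℚ :* c) ≈-refl c
∑-const (suc n) c = ≈-trans (⊕-cong ≈-refl (∑-const n c))
  (≈-trans (solve 2 (λ n c → c :+ n :* c := (con 1ℚ :+ n) :* c) ≈-refl ⌜ ι n ⌝ c)
    (⊛-cong (≈-trans (≈-sym (⌜⌝-+ 1ℚ (ι n))) (≡⇒≈ (cong ⌜_⌝ (sym (ι-suc n))))) ≈-refl))

∑-zero : ∀ n → ∑ {n} (λ _ → ⌜ 0ℚ ⌝) ≈ ⌜ 0ℚ ⌝
∑-zero n = ≈-trans (∑-const n ⌜ 0ℚ ⌝) (solve 1 (λ n → n :* con 0ℚ := con 0ℚ) ≈-refl ⌜ ι n ⌝)

∑-swap : ∀ {m n} (f : Fin m → Fin n → ℝ) → ∑ (λ i → ∑ (f i)) ≈ ∑ (λ j → ∑ (λ i → f i j))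
∑-swap {zero} {n} f = ≈-sym (∑-zero n)
∑-swap {suc m}    f = ≈-trans (⊕-cong ≈-refl (∑-swap λ i → f (suc i)))
  (≈-sym (∑-⊕ (f zero) (λ j → ∑ (λ i → f (suc i) j))))

δ : ∀ {n} → Fin n → Fin n → ℝ
δ j k = if does (j Fin.≟ k) then ⌜ 1ℚ ⌝ else ⌜ 0ℚ ⌝

∑-δ : ∀ {n} (j : Fin n) → ∑ (δ j) ≈ ⌜ 1ℚ ⌝
∑-δ {suc n} zero    = ≈-trans (⊕-cong ≈-refl (∑-zero n)) (solve 0 (con 1ℚ :+ con 0ℚ := con 1ℚ) ≈-refl)
∑-δ {suc n} (suc j) = ≈-trans (⊕-cong ≈-refl (∑-δ j)) (solve 0 (con 0ℚ :+ con 1ℚ := con 1ℚ) ≈-refl)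

opaque
  unfolding _⊕_

  private
    ∑Fin-pointwise : ∀ {n i} {f g : Fin n → ℝ} → (∀ k → seq (f k) i ≡ seq (g k) i) → seq (∑Fin f) i ≡ seq (∑ g) i
    ∑Fin-pointwise {zero}  h = refl
    ∑Fin-pointwise {suc n} h = cong₂ ℚ._+_ (h zero) (∑Fin-pointwise λ k → h (suc k))

  prob-nonneg : ∀ {A} {∑ : (A → ℝ) → ℝ} (D : Distribution ∑) a → ⌜ 0ℚ ⌝ ≼ prob D a
  prob-nonneg D a = prob-≥0 D a

  prob-∑ : ∀ {K} (D : Distribution (∑Fin {K})) → ∑ (prob D) ≈ ⌜ 1ℚ ⌝
  prob-∑ D = ≈-trans {∑ (prob D)} {∑Fin (prob D)} {⌜ 1ℚ ⌝}
    (pointwise-≈ {∑ (prob D)} {∑Fin (prob D)} λ i → sym (∑Fin-pointwise {f = prob D} {prob D} λ _ → refl)) (prob-sum D)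

  prob-Bool : (D : Distribution ∑Bool) → prob D false ⊕ prob D true ≈ ⌜ 1ℚ ⌝
  prob-Bool D = prob-sum D

  outputProb-suc : ∀ {K} T p (θ : Vec Bool K) (query : Distribution (∑Fin {K})) next b →
    outputProb (suc T) p θ (query , next) b ≈ ∑ λ k → prob query k ⊛
      (bsc p (lookup θ k) false ⊛ outputProb T p θ (next k false) b ⊕ bsc p (lookup θ k) true ⊛ outputProb T p θ (next k true) b)
  outputProb-suc {K} T p θ query next b = pointwise-≈ {outputProb (suc T) p θ (query , next) b} {∑ g}
    λ i → ∑Fin-pointwise {K} {i} {λ k → prob query k * ∑Bool λ y → bsc p (lookup θ k) y * outputProb T p θ (next k y) b} {g} λ k → refl
    where
    g : Fin K → ℝ
    g k = prob query k ⊛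
      (bsc p (lookup θ k) false ⊛ outputProb T p θ (next k false) b ⊕ bsc p (lookup θ k) true ⊛ outputProb T p θ (next k true) b)

  bsc-eq : ∀ p x → bsc p x x ≈ ⌜ 1ℚ ⌝ ⊝ p
  bsc-eq p false = pointwise-≈ {bsc p false false} {⌜ 1ℚ ⌝ ⊝ p} λ _ → refl
  bsc-eq p true  = pointwise-≈ {bsc p true true} {⌜ 1ℚ ⌝ ⊝ p} λ _ → refl

  private
    error : (Bool → ℝ) → Bool → ℝ
    error out c = ∑Bool λ b → if does (b Bool.≟ c) then 0ℝ else out b

    error-≽ : ∀ out {c} b → c ≡ not b → out b ≼ error out c
    error-≽ out false refl = pointwise-≼ {out false} {error out true} λ i → ℚ.≤-reflexive (sym (ℚ.+-identityʳ (seq (out false) i)))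
    error-≽ out true  refl = pointwise-≼ {out true} {error out false} λ i → ℚ.≤-reflexive (sym (ℚ.+-identityˡ (seq (out true) i)))

  outputProb≼errorProb : ∀ {K} T p μ (θ : Vec Bool K) b → OR θ ≡ not b → outputProb T p θ μ b ≼ errorProb T p μ θ
  outputProb≼errorProb T p μ θ b = error-≽ (outputProb T p θ μ) b

  ≼supBits : ∀ {K} (f : Vec Bool K → ℝ) θ → f θ ≼ supBits f
  ≼supBits f [] = ≼-refl {f []}
  ≼supBits f (false ∷ θ) = ≼-trans {f (false ∷ θ)} {supBits (λ θ → f (false ∷ θ))} {supBits f} (≼supBits (λ θ → f (false ∷ θ)) θ)
    (pointwise-≼ {supBits (λ θ → f (false ∷ θ))} {supBits f} λ i → ℚ.p≤p⊔q _ _)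
  ≼supBits f (true ∷ θ) = ≼-trans {f (true ∷ θ)} {supBits (λ θ → f (true ∷ θ))} {supBits f} (≼supBits (λ θ → f (true ∷ θ)) θ)
    (pointwise-≼ {supBits (λ θ → f (true ∷ θ))} {supBits f} λ i → ℚ.p≤q⊔p (seq (supBits (λ θ → f (false ∷ θ))) i) _)

zeros : ∀ K → Vec Bool K
zeros K = replicate K false

unit : ∀ {K} → Fin K → Vec Bool K
unit {K} k = zeros K [ k ]≔ true

OR-zeros : ∀ K → OR (zeros K) ≡ false
OR-zeros zero    = refl
OR-zeros (suc K) = OR-zeros K

OR-unit : ∀ {K} (k : Fin K) → OR (unit k) ≡ true
OR-unit {suc K} zero    = refl
OR-unit {suc K} (suc k) = OR-unit k

module _ {p lo : ℝ} (0<p : 0ℝ < p) (p≼½ : p ≼ ⌜ ½ ⌝) (Exp-lo : Exp lo ⊛ p ≈ ⌜ 1ℚ ⌝ ⊝ p) where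

  open Channel {p} {lo} 0<p p≼½ Exp-lo

  -- The expected number of queries of index k under the all-zero sequence.
  queries : ∀ {K} T → Algorithm K T → Fin K → ℝ
  queries zero    _              k = ⌜ 0ℚ ⌝
  queries (suc T) (query , next) k = ∑ λ j → prob query j ⊛
    (δ j k ⊕ (q ⊛ queries T (next j false) k ⊕ p ⊛ queries T (next j true) k))

  ∑-queries : ∀ {K} T (μ : Algorithm K T) → ∑ (queries T μ) ≈ ⌜ ι T ⌝
  ∑-queries {K} zero    μ = ∑-zero K
  ∑-queries {K} (suc T) (query , next) = begin-equality
    ∑ (λ k → ∑ λ j → prob query j ⊛ (δ j k ⊕ (q ⊛ n j false k ⊕ p ⊛ n j true k))) ≈⟨ ∑-swap (λ k j → prob query j ⊛ (δ j k ⊕ (q ⊛ n j false k ⊕ p ⊛ n j true k))) ⟩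
    ∑ (λ j → ∑ λ k → prob query j ⊛ (δ j k ⊕ (q ⊛ n j false k ⊕ p ⊛ n j true k))) ≈⟨ ∑-cong inner ⟩
    ∑ (λ j → prob query j ⊛ ⌜ ι (suc T) ⌝)   ≈⟨ ∑-⊛ʳ (prob query) ⌜ ι (suc T) ⌝ ⟩
    ∑ (prob query) ⊛ ⌜ ι (suc T) ⌝           ≈⟨ ⊛-cong (prob-∑ query) ≈-refl ⟩
    ⌜ 1ℚ ⌝ ⊛ ⌜ ι (suc T) ⌝                   ≈⟨ solve 1 (λ a → con 1ℚ :* a := a) ≈-refl ⌜ ι (suc T) ⌝ ⟩
    ⌜ ι (suc T) ⌝                            ∎
    where
    n : Fin K → Bool → Fin K → ℝ
    n j y = queries T (next j y)
    inner : ∀ j → ∑ (λ k → prob query j ⊛ (δ j k ⊕ (q ⊛ n j false k ⊕ p ⊛ n j true k))) ≈ prob query j ⊛ ⌜ ι (suc T) ⌝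
    inner j = ≈-trans (∑-⊛ (prob query j) (λ k → δ j k ⊕ (q ⊛ n j false k ⊕ p ⊛ n j true k))) (⊛-cong ≈-refl (begin-equality
      ∑ (λ k → δ j k ⊕ (q ⊛ n j false k ⊕ p ⊛ n j true k))                     ≈⟨ ∑-⊕ (δ j) (λ k → q ⊛ n j false k ⊕ p ⊛ n j true k) ⟩
      ∑ (δ j) ⊕ ∑ (λ k → q ⊛ n j false k ⊕ p ⊛ n j true k)                     ≈⟨ ⊕-cong (∑-δ j) (∑-⊕ (λ k → q ⊛ n j false k) (λ k → p ⊛ n j true k)) ⟩
      ⌜ 1ℚ ⌝ ⊕ (∑ (λ k → q ⊛ n j false k) ⊕ ∑ (λ k → p ⊛ n j true k))          ≈⟨ ⊕-cong ≈-refl (⊕-cong (∑-⊛ q (n j false)) (∑-⊛ p (n j true))) ⟩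
      ⌜ 1ℚ ⌝ ⊕ (q ⊛ ∑ (n j false) ⊕ p ⊛ ∑ (n j true))                          ≈⟨ ⊕-cong ≈-refl (⊕-cong (⊛-cong ≈-refl (∑-queries T (next j false))) (⊛-cong ≈-refl (∑-queries T (next j true)))) ⟩
      ⌜ 1ℚ ⌝ ⊕ (q ⊛ ⌜ ι T ⌝ ⊕ p ⊛ ⌜ ι T ⌝)                                     ≈⟨ solve 2 (λ p t → con 1ℚ :+ ((con 1ℚ :- p) :* t :+ p :* t) := con 1ℚ :+ t) ≈-refl p ⌜ ι T ⌝ ⟩
      ⌜ 1ℚ ⌝ ⊕ ⌜ ι T ⌝                                                         ≈⟨ ≈-sym (⌜⌝-+ 1ℚ (ι T)) ⟩
      ⌜ 1ℚ ℚ.+ ι T ⌝                                                           ≈⟨ ≡⇒≈ (cong ⌜_⌝ (sym (ι-suc T))) ⟩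
      ⌜ ι (suc T) ⌝                                                            ∎))

  module _ {φ : ℝ → ℝ} {d : ℝ} (P : Potential φ d) {K : ℕ} (k : Fin K) where

    open Potential P

    private
      out₀ out₁ : ∀ T → Algorithm K T → ℝ
      out₀ T μ = outputProb T p (zeros K) μ true
      out₁ T μ = outputProb T p (unit k) μ false

      observed : Bool → (Bool → ℝ) → ℝ
      observed b f = bsc p b false ⊛ f false ⊕ bsc p b true ⊛ f true

      module _ (x : ℝ) (a b n : Bool → ℝ) (h : ∀ y x → φ x ≼ (a y ⊕ Exp x ⊛ b y) ⊕ d ⊛ n y) where
        f = false
        t = true

        -- The two sequences differ at the queried index, so the alternative swaps the weights q and
        -- p. `down` and `up` absorb the swap: e^(x - lo) q = eˣ p and e^(x + lo) p = eˣ q.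
        hit : φ x ≼ (observed false a ⊕ Exp x ⊛ observed true b) ⊕ d ⊛ (⌜ 1ℚ ⌝ ⊕ (q ⊛ n f ⊕ p ⊛ n t))
        hit = begin
          φ x                                                            ≤⟨ drop x ⟩
          (q ⊛ φ (x ⊝ lo) ⊕ p ⊛ φ (x ⊕ lo)) ⊕ d                          ≤⟨ ⊕-mono (⊕-mono (⊛-monoˡ q 0≼q (h f (x ⊝ lo)))
                                                                              (⊛-monoˡ p 0≼p (h t (x ⊕ lo)))) ≼-refl ⟩
          (q ⊛ ((a f ⊕ Exp (x ⊝ lo) ⊛ b f) ⊕ d ⊛ n f) ⊕ p ⊛ ((a t ⊕ Exp (x ⊕ lo) ⊛ b t) ⊕ d ⊛ n t)) ⊕ d
            ≈⟨ ⊕-cong (⊕-cong (solve 6 (λ q a L b d n → q :* ((a :+ L :* b) :+ d :* n) := q :* a :+ (L :* q) :* b :+ d :* (q :* n)) ≈-refl q (a f) (Exp (x ⊝ lo)) (b f) d (n f))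
                 (solve 6 (λ q a L b d n → q :* ((a :+ L :* b) :+ d :* n) := q :* a :+ (L :* q) :* b :+ d :* (q :* n)) ≈-refl p (a t) (Exp (x ⊕ lo)) (b t) d (n t))) ≈-refl ⟩
          ((q ⊛ a f ⊕ (Exp (x ⊝ lo) ⊛ q) ⊛ b f ⊕ d ⊛ (q ⊛ n f)) ⊕ (p ⊛ a t ⊕ (Exp (x ⊕ lo) ⊛ p) ⊛ b t ⊕ d ⊛ (p ⊛ n t))) ⊕ d
            ≈⟨ ⊕-cong (⊕-cong (⊕-cong (⊕-cong ≈-refl (⊛-cong (down x) ≈-refl)) ≈-refl) (⊕-cong (⊕-cong ≈-refl (⊛-cong (up x) ≈-refl)) ≈-refl)) ≈-refl ⟩
          ((q ⊛ a f ⊕ (Exp x ⊛ p) ⊛ b f ⊕ d ⊛ (q ⊛ n f)) ⊕ (p ⊛ a t ⊕ (Exp x ⊛ q) ⊛ b t ⊕ d ⊛ (p ⊛ n t))) ⊕ d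
            ≈⟨ solve 9 (λ qa bf qn pa bt pn L p d → ((qa :+ (L :* p) :* bf :+ d :* qn) :+ (pa :+ (L :* (con 1ℚ :- p)) :* bt :+ d :* pn)) :+ d
                 := ((qa :+ pa) :+ L :* (p :* bf :+ (con 1ℚ :- p) :* bt)) :+ d :* (con 1ℚ :+ (qn :+ pn))) ≈-refl (q ⊛ a f) (b f) (q ⊛ n f) (p ⊛ a t) (b t) (p ⊛ n t) (Exp x) p d ⟩
          ((q ⊛ a f ⊕ p ⊛ a t) ⊕ Exp x ⊛ (p ⊛ b f ⊕ q ⊛ b t)) ⊕ d ⊛ (⌜ 1ℚ ⌝ ⊕ (q ⊛ n f ⊕ p ⊛ n t))
            ≈⟨ ⊕-cong (⊕-cong (⊕-cong (⊛-cong (bsc-eq p false) ≈-refl) ≈-refl) (⊛-cong ≈-refl (⊕-cong ≈-refl (⊛-cong (bsc-eq p true) ≈-refl)))) ≈-refl ⟨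
          (observed false a ⊕ Exp x ⊛ observed true b) ⊕ d ⊛ (⌜ 1ℚ ⌝ ⊕ (q ⊛ n f ⊕ p ⊛ n t)) ∎

        -- Both sequences carry a 0 at the queried index, so the observation has one law, the
        -- likelihood ratio stays the same and `drop` is not spent.
        miss : φ x ≼ (observed false a ⊕ Exp x ⊛ observed false b) ⊕ d ⊛ (⌜ 0ℚ ⌝ ⊕ (q ⊛ n f ⊕ p ⊛ n t))
        miss = begin
          φ x                                                            ≈⟨ solve 2 (λ p a → a := (con 1ℚ :- p) :* a :+ p :* a) ≈-refl p (φ x) ⟩
          q ⊛ φ x ⊕ p ⊛ φ x                                              ≤⟨ ⊕-mono (⊛-monoˡ q 0≼q (h f x)) (⊛-monoˡ p 0≼p (h t x)) ⟩
          q ⊛ ((a f ⊕ Exp x ⊛ b f) ⊕ d ⊛ n f) ⊕ p ⊛ ((a t ⊕ Exp x ⊛ b t) ⊕ d ⊛ n t)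
            ≈⟨ solve 10 (λ q p L d af bf nf at bt nt → q :* ((af :+ L :* bf) :+ d :* nf) :+ p :* ((at :+ L :* bt) :+ d :* nt)
                 := ((q :* af :+ p :* at) :+ L :* (q :* bf :+ p :* bt)) :+ d :* (con 0ℚ :+ (q :* nf :+ p :* nt))) ≈-refl q p (Exp x) d (a f) (b f) (n f) (a t) (b t) (n t) ⟩
          ((q ⊛ a f ⊕ p ⊛ a t) ⊕ Exp x ⊛ (q ⊛ b f ⊕ p ⊛ b t)) ⊕ d ⊛ (⌜ 0ℚ ⌝ ⊕ (q ⊛ n f ⊕ p ⊛ n t))
            ≈⟨ ⊕-cong (⊕-cong (⊕-cong (⊛-cong (bsc-eq p false) ≈-refl) ≈-refl) (⊛-cong ≈-refl (⊕-cong (⊛-cong (bsc-eq p false) ≈-refl) ≈-refl))) ≈-refl ⟨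
          (observed false a ⊕ Exp x ⊛ observed false b) ⊕ d ⊛ (⌜ 0ℚ ⌝ ⊕ (q ⊛ n f ⊕ p ⊛ n t)) ∎

    -- The log-likelihood ratio x of the history is arbitrary so that the induction can pass to
    -- subtrees. At a leaf the two output probabilities add up to 1: the output true costs 1 under
    -- the all-zero sequence, the output false costs eˣ under the other, and φ x is below both.
    errors≽potential : ∀ T (μ : Algorithm K T) x → φ x ≼ (out₀ T μ ⊕ Exp x ⊛ out₁ T μ) ⊕ d ⊛ queries T μ k
    errors≽potential zero μ x = begin
      φ x                                                    ≈⟨ solve 1 (λ a → a := con 1ℚ :* a) ≈-refl (φ x) ⟩
      ⌜ 1ℚ ⌝ ⊛ φ x                                           ≈⟨ ⊛-cong (prob-Bool μ) ≈-refl ⟨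
      (prob μ false ⊕ prob μ true) ⊛ φ x                     ≈⟨ solve 3 (λ f t a → (f :+ t) :* a := t :* a :+ f :* a) ≈-refl (prob μ false) (prob μ true) (φ x) ⟩
      prob μ true ⊛ φ x ⊕ prob μ false ⊛ φ x                 ≤⟨ ⊕-mono (⊛-monoˡ (prob μ true) (prob-nonneg μ true) (φ≼1 x)) (⊛-monoˡ (prob μ false) (prob-nonneg μ false) (φ≼Exp x)) ⟩
      prob μ true ⊛ ⌜ 1ℚ ⌝ ⊕ prob μ false ⊛ Exp x            ≈⟨ solve 4 (λ f t L d → t :* con 1ℚ :+ f :* L := (t :+ L :* f) :+ d :* con 0ℚ) ≈-refl (prob μ false) (prob μ true) (Exp x) d ⟩
      (prob μ true ⊕ Exp x ⊛ prob μ false) ⊕ d ⊛ ⌜ 0ℚ ⌝      ∎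
    errors≽potential (suc T) (query , next) x = begin
      φ x                                              ≈⟨ solve 1 (λ a → a := con 1ℚ :* a) ≈-refl (φ x) ⟩
      ⌜ 1ℚ ⌝ ⊛ φ x                                     ≈⟨ ⊛-cong (prob-∑ query) ≈-refl ⟨
      ∑ (prob query) ⊛ φ x                             ≈⟨ ∑-⊛ʳ (prob query) (φ x) ⟨
      ∑ (λ j → prob query j ⊛ φ x)                     ≤⟨ ∑-mono (λ j → ⊛-monoˡ (prob query j) (prob-nonneg query j) (at j)) ⟩
      ∑ (λ j → prob query j ⊛ ((A j ⊕ Exp x ⊛ B j) ⊕ d ⊛ N j))
        ≈⟨ ∑-cong (λ j → solve 6 (λ w A B N L d → w :* ((A :+ L :* B) :+ d :* N) := (w :* A :+ L :* (w :* B)) :+ d :* (w :* N)) ≈-refl (prob query j) (A j) (B j) (N j) (Exp x) d) ⟩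
      ∑ (λ j → (prob query j ⊛ A j ⊕ Exp x ⊛ (prob query j ⊛ B j)) ⊕ d ⊛ (prob query j ⊛ N j))
        ≈⟨ ≈-trans (∑-⊕ (λ j → prob query j ⊛ A j ⊕ Exp x ⊛ (prob query j ⊛ B j)) (λ j → d ⊛ (prob query j ⊛ N j)))
             (⊕-cong (≈-trans (∑-⊕ (λ j → prob query j ⊛ A j) (λ j → Exp x ⊛ (prob query j ⊛ B j))) (⊕-cong ≈-refl (∑-⊛ (Exp x) (λ j → prob query j ⊛ B j)))) (∑-⊛ d (λ j → prob query j ⊛ N j))) ⟩
      (∑ (λ j → prob query j ⊛ A j) ⊕ Exp x ⊛ ∑ (λ j → prob query j ⊛ B j)) ⊕ d ⊛ ∑ (λ j → prob query j ⊛ N j)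
        ≈⟨ ⊕-cong (⊕-cong (outputProb-suc T p (zeros K) query next true) (⊛-cong ≈-refl (outputProb-suc T p (unit k) query next false))) ≈-refl ⟨
      (out₀ (suc T) (query , next) ⊕ Exp x ⊛ out₁ (suc T) (query , next)) ⊕ d ⊛ queries (suc T) (query , next) k ∎
      where
      A B N : Fin K → ℝ
      A j = observed (lookup (zeros K) j) λ y → out₀ T (next j y)
      B j = observed (lookup (unit k) j) λ y → out₁ T (next j y)
      N j = δ j k ⊕ (q ⊛ queries T (next j false) k ⊕ p ⊛ queries T (next j true) k)

      at : ∀ j → φ x ≼ (A j ⊕ Exp x ⊛ B j) ⊕ d ⊛ N j
      at j = case (j Fin.≟ k)
        where
        n : Bool → ℝ
        n y = queries T (next j y) k
        -- The looked-up bits and the indicator become variables, so that `hit` and `miss` apply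
        -- after matching on the three equations.
        bits : ∀ {b c w} → lookup (zeros K) j ≡ b → lookup (unit k) j ≡ c → δ j k ≡ w →
          φ x ≼ (observed b (λ y → out₀ T (next j y)) ⊕ Exp x ⊛ observed c (λ y → out₁ T (next j y))) ⊕ d ⊛ (w ⊕ (q ⊛ n false ⊕ p ⊛ n true)) →
          φ x ≼ (A j ⊕ Exp x ⊛ B j) ⊕ d ⊛ N j
        bits refl refl refl h = h
        children : ∀ y x → φ x ≼ (out₀ T (next j y) ⊕ Exp x ⊛ out₁ T (next j y)) ⊕ d ⊛ n y
        children y = errors≽potential T (next j y)
        case : Dec (j ≡ k) → φ x ≼ (A j ⊕ Exp x ⊛ B j) ⊕ d ⊛ N j
        case (yes j≡k) = bits (Vec.lookup-replicate j false)
          (trans (cong (lookup (unit k)) j≡k) (Vec.lookup∘update k (zeros K) true))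
          (cong (λ b → if b then ⌜ 1ℚ ⌝ else ⌜ 0ℚ ⌝) (dec-true (j Fin.≟ k) j≡k)) (hit x _ _ n children)
        case (no j≢k) = bits (Vec.lookup-replicate j false)
          (trans (Vec.lookup∘update′ j≢k (zeros K) true) (Vec.lookup-replicate j false))
          (cong (λ b → if b then ⌜ 1ℚ ⌝ else ⌜ 0ℚ ⌝) (dec-false (j Fin.≟ k) j≢k)) (miss x _ _ n children)

  module _ {φ : ℝ → ℝ} {d : ℝ} (P : Potential φ d) {K : ℕ} T (μ : Algorithm K T) where

    private
      s = supBits (errorProb T p μ)

      each : ∀ k → φ ⌜ 0ℚ ⌝ ≼ (s ⊕ s) ⊕ d ⊛ queries T μ k
      each k = ≼-trans (errors≽potential P k T μ ⌜ 0ℚ ⌝) (⊕-mono (⊕-mono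
        (≼-trans (outputProb≼errorProb T p μ (zeros K) true (OR-zeros K)) (≼supBits (errorProb T p μ) (zeros K)))
        (≼-respˡ (≈-trans (solve 1 (λ a → a := con 1ℚ :* a) ≈-refl _) (⊛-cong (≈-sym Exp-0) ≈-refl))
          (≼-trans (outputProb≼errorProb T p μ (unit k) false (OR-unit k)) (≼supBits (errorProb T p μ) (unit k))))) ≼-refl)

    -- Summing over all k takes the place of choosing a rarely queried index, which would require
    -- comparing reals.
    average-bound : ⌜ ι K ⌝ ⊛ φ ⌜ 0ℚ ⌝ ≼ ⌜ ι K ⌝ ⊛ (s ⊕ s) ⊕ d ⊛ ⌜ ι T ⌝
    average-bound = begin
      ⌜ ι K ⌝ ⊛ φ ⌜ 0ℚ ⌝                                 ≈⟨ ∑-const K (φ ⌜ 0ℚ ⌝) ⟨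
      ∑ {K} (λ _ → φ ⌜ 0ℚ ⌝)                             ≤⟨ ∑-mono each ⟩
      ∑ (λ k → (s ⊕ s) ⊕ d ⊛ queries T μ k)              ≈⟨ ∑-⊕ (λ _ → s ⊕ s) (λ k → d ⊛ queries T μ k) ⟩
      ∑ {K} (λ _ → s ⊕ s) ⊕ ∑ (λ k → d ⊛ queries T μ k)  ≈⟨ ⊕-cong (∑-const K (s ⊕ s)) (≈-trans (∑-⊛ d (queries T μ)) (⊛-cong ≈-refl (∑-queries T μ))) ⟩
      ⌜ ι K ⌝ ⊛ (s ⊕ s) ⊕ d ⊛ ⌜ ι T ⌝                    ∎

-- Passage back to the operations of the statement

opaque
  unfolding _⊕_ Exp Log Inv

  ≼⇒≤ : ∀ {x y} → x ≼ y → x ≤ y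
  ≼⇒≤ h = h

  ≤⇒≼ : ∀ {x y} → x ≤ y → x ≼ y
  ≤⇒≼ h = h

  ⊕≈+ : ∀ x y → x ⊕ y ≈ x + y
  ⊕≈+ x y = pointwise-≈ {x ⊕ y} {x + y} λ _ → refl

  ⊛≈* : ∀ x y → x ⊛ y ≈ x * y
  ⊛≈* x y = pointwise-≈ {x ⊛ y} {x * y} λ _ → refl

  ⊖≈- : ∀ x → ⊖ x ≈ - x
  ⊖≈- x = pointwise-≈ {⊖ x} { - x} λ _ → refl

  ⌜⌝≈fromℚ : ∀ q → ⌜ q ⌝ ≈ fromℚ q
  ⌜⌝≈fromℚ q = pointwise-≈ {⌜ q ⌝} {fromℚ q} λ _ → refl

  Exp≈exp : ∀ x → Exp x ≈ exp x
  Exp≈exp x = pointwise-≈ {Exp x} {exp x} λ _ → refl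

  Log≈log : ∀ x 0<x → Log x 0<x ≈ log x 0<x
  Log≈log x 0<x = pointwise-≈ {Log x 0<x} {log x 0<x} λ _ → refl

  Inv≈inv : ∀ x 0<x → Inv x 0<x ≈ inv x 0<x
  Inv≈inv x 0<x = pointwise-≈ {Inv x 0<x} {inv x 0<x} λ _ → refl

*≈ : ∀ {x y} x′ y′ → x ≈ x′ → y ≈ y′ → x ⊛ y ≈ x′ * y′
*≈ x′ y′ p q = ≈-trans (⊛-cong p q) (⊛≈* x′ y′)

+≈ : ∀ {x y} x′ y′ → x ≈ x′ → y ≈ y′ → x ⊕ y ≈ x′ + y′
+≈ x′ y′ p q = ≈-trans (⊕-cong p q) (⊕≈+ x′ y′)

-≈ : ∀ {x y} x′ y′ → x ≈ x′ → y ≈ y′ → x ⊝ y ≈ x′ - y′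
-≈ x′ y′ p q = +≈ x′ (- y′) p (≈-trans (⊖-cong q) (⊖≈- y′))

/≈ : ∀ {x} x′ y′ 0<y′ → x ≈ x′ → x ⊛ Inv y′ 0<y′ ≈ x′ / y′ ⟨ 0<y′ ⟩
/≈ x′ y′ 0<y′ p = *≈ x′ (inv y′ 0<y′) p (Inv≈inv y′ 0<y′)

Exp-quotient : ∀ x y 0<y 0<x/y → Exp (Log (x / y ⟨ 0<y ⟩) 0<x/y) ⊛ y ≈ x
Exp-quotient x y 0<y 0<x/y = begin-equality
  Exp (Log (x / y ⟨ 0<y ⟩) 0<x/y) ⊛ y ≈⟨ ⊛-cong (≈-trans (Exp-Log (x / y ⟨ 0<y ⟩) 0<x/y) (≈-sym (/≈ x y 0<y ≈-refl))) ≈-refl ⟩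
  x ⊛ Inv y 0<y ⊛ y                   ≈⟨ solve 3 (λ x i y → x :* i :* y := x :* (y :* i)) ≈-refl x (Inv y 0<y) y ⟩
  x ⊛ (y ⊛ Inv y 0<y)                 ≈⟨ ⊛-cong ≈-refl (Inv-inverseʳ y 0<y) ⟩
  x ⊛ ⌜ 1ℚ ⌝                          ≈⟨ solve 1 (λ x → x :* con 1ℚ := x) ≈-refl x ⟩
  x                                   ∎

-- The minimax bound and the query bound

module _ {p lo : ℝ} (0<p : 0ℝ < p) (p≼½ : p ≼ ⌜ ½ ⌝) (Exp-lo : Exp lo ⊛ p ≈ ⌜ 1ℚ ⌝ ⊝ p) where

  open Channel {p} {lo} 0<p p≼½ Exp-lo

  module _ (D : ℝ) (D≈ : z ⊛ lo ≈ D) (K T : ℕ) .{{_ : NonZero K}} (μ : Algorithm K T) where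

    private
      s κ Y : ℝ
      s = supBits (errorProb T p μ)
      κ = Inv (fromℕ K) (0<fromℕ K)
      Y = ⌜ ι T ⌝ ⊛ D ⊛ κ

      Kκ : ⌜ ι K ⌝ ⊛ κ ≈ ⌜ 1ℚ ⌝
      Kκ = ≈-trans (⊛-cong (⌜⌝≈fromℚ (ι K)) ≈-refl) (Inv-inverseʳ (fromℕ K) (0<fromℕ K))

      0≼κ : ⌜ 0ℚ ⌝ ≼ κ
      0≼κ = Inv-nonneg (fromℕ K) (0<fromℕ K)

      error-bound : ⌜ + 1 / 4 ⌝ ⊛ Exp (⊖ Y) ≼ s
      error-bound = ≼-by (⌜ ½ ⌝ ⊛ (κ ⊛ gap)) (⊛-nonneg (⌜⌝-mono ½≤) (⊛-nonneg 0≼κ (0≼⊝ bound′))) (≈-sym (begin-equality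
        ⌜ + 1 / 4 ⌝ ⊛ e ⊕ ⌜ ½ ⌝ ⊛ (κ ⊛ gap)
          ≈⟨ solve 6 (λ e κ K s T D → let C = con ½ :* e ; Y = T :* D :* κ in
               con (+ 1 / 4) :* e :+ con ½ :* (κ :* ((K :* (s :+ s) :+ (C :* D) :* T) :- K :* (C :* (con 1ℚ :+ Y))))
               := (K :* κ) :* s :+ (con ½ :* C :+ con ½ :* C :* Y :- con ½ :* C :* (con 1ℚ :+ Y) :* (K :* κ))) ≈-refl e κ ⌜ ι K ⌝ s ⌜ ι T ⌝ D ⟩
        (⌜ ι K ⌝ ⊛ κ) ⊛ s ⊕ (⌜ ½ ⌝ ⊛ C ⊕ ⌜ ½ ⌝ ⊛ C ⊛ Y ⊝ ⌜ ½ ⌝ ⊛ C ⊛ (⌜ 1ℚ ⌝ ⊕ Y) ⊛ (⌜ ι K ⌝ ⊛ κ))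
          ≈⟨ ⊕-cong (⊛-cong Kκ ≈-refl) (⊕-cong ≈-refl (⊖-cong (⊛-cong ≈-refl Kκ))) ⟩
        ⌜ 1ℚ ⌝ ⊛ s ⊕ (⌜ ½ ⌝ ⊛ C ⊕ ⌜ ½ ⌝ ⊛ C ⊛ Y ⊝ ⌜ ½ ⌝ ⊛ C ⊛ (⌜ 1ℚ ⌝ ⊕ Y) ⊛ ⌜ 1ℚ ⌝)
          ≈⟨ solve 3 (λ s C Y → con 1ℚ :* s :+ (con ½ :* C :+ con ½ :* C :* Y :- con ½ :* C :* (con 1ℚ :+ Y) :* con 1ℚ) := s) ≈-refl s C Y ⟩
        s ∎))
        where
        -- With X = Y = T D / K the averaged charge C D T / K is C X, and φ 0 is C (1 + X). What
        -- remains is C = ½ e^(-X) ≤ 2 s.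
        open Bretagnolle–Huber Y
        e = Exp (⊖ Y)
        gap = (⌜ ι K ⌝ ⊛ (s ⊕ s) ⊕ (C ⊛ D) ⊛ ⌜ ι T ⌝) ⊝ ⌜ ι K ⌝ ⊛ (C ⊛ (⌜ 1ℚ ⌝ ⊕ Y))
        bound′ : ⌜ ι K ⌝ ⊛ (C ⊛ (⌜ 1ℚ ⌝ ⊕ Y)) ≼ ⌜ ι K ⌝ ⊛ (s ⊕ s) ⊕ (C ⊛ D) ⊛ ⌜ ι T ⌝
        bound′ = ≼-respˡ (⊛-cong ≈-refl φ-0) (≼-respʳ (⊕-cong ≈-refl (⊛-cong (⊛-cong ≈-refl D≈) ≈-refl))
          (average-bound 0<p p≼½ Exp-lo potential T μ))

    minimax : fromℚ (+ 1 / 4) * exp (- ((fromℕ T * D) / fromℕ K ⟨ 0<fromℕ K ⟩)) ≤ supBits (errorProb T p μ)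
    minimax = ≼⇒≤ {fromℚ (+ 1 / 4) * exp (- ((fromℕ T * D) / fromℕ K ⟨ 0<fromℕ K ⟩))} {supBits (errorProb T p μ)}
      (≼-respˡ (*≈ (fromℚ (+ 1 / 4)) (exp (- ((fromℕ T * D) / fromℕ K ⟨ 0<fromℕ K ⟩))) (⌜⌝≈fromℚ (+ 1 / 4))
        (≈-trans (Exp-cong (≈-trans (⊖-cong (/≈ (fromℕ T * D) (fromℕ K) (0<fromℕ K) (*≈ (fromℕ T) D (⌜⌝≈fromℚ (ι T)) ≈-refl)))
            (⊖≈- ((fromℕ T * D) / fromℕ K ⟨ 0<fromℕ K ⟩))))
          (Exp≈exp (- ((fromℕ T * D) / fromℕ K ⟨ 0<fromℕ K ⟩)))))
        error-bound)

    module _ (G : ℝ) (0<G : 0ℝ < G) (z²/8≼G : ⌜ + 1 / 8 ⌝ ⊛ (z ⊛ z) ≼ G) (0<D : 0ℝ < D) (z²≼D : z ⊛ z ≼ D)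
      (δ w : ℝ) (δ<49/100 : δ < fromℚ (+ 49 / 100)) (Exp-w : Exp w ⊛ δ ≈ ⌜ 1ℚ ⌝) (s≤δ : supBits (errorProb T p μ) ≤ δ) where

      private
        U V KT : ℝ
        U  = Inv G 0<G
        V  = Inv D 0<D
        KT = ⌜ ι 5000 ⌝ ⊛ ⌜ ι T ⌝

        0≼K : ⌜ 0ℚ ⌝ ≼ ⌜ ι K ⌝
        0≼K = ⌜⌝-mono (0≤ι K)

        0≼KT : ⌜ 0ℚ ⌝ ≼ KT
        0≼KT = ⊛-nonneg (⌜⌝-mono (0≤ι 5000)) (⌜⌝-mono (0≤ι T))

        0≼U : ⌜ 0ℚ ⌝ ≼ U
        0≼U = Inv-nonneg G 0<G

        0≼V : ⌜ 0ℚ ⌝ ≼ V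
        0≼V = Inv-nonneg D 0<D

        s≼δ : s ≼ δ
        s≼δ = ≤⇒≼ {s} {δ} s≤δ

        s≼49/100 : s ≼ ⌜ + 49 / 100 ⌝
        s≼49/100 = ≼-trans s≼δ (≼-respʳ (≈-sym (⌜⌝≈fromℚ (+ 49 / 100))) (<⇒≼ {δ} {fromℚ (+ 49 / 100)} δ<49/100))

        -- The gap 99/100 - 2 · 49/100 = 1/100 gives K / 100 ≤ 50 z² T, hence the factor 5000.
        K≼KTz² : ⌜ ι K ⌝ ≼ KT ⊛ (z ⊛ z)
        K≼KTz² = ≼-by (⌜ ι 100 ⌝ ⊛ (⌜ ι 2 ⌝ ⊛ (⌜ ι K ⌝ ⊛ (⌜ + 49 / 100 ⌝ ⊝ s)) ⊕ gap))
          (⊛-nonneg (⌜⌝-mono (0≤ι 100)) (0≼⊕ (⊛-nonneg (⌜⌝-mono (0≤ι 2)) (⊛-nonneg 0≼K (0≼⊝ s≼49/100))) (0≼⊝ bound′)))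
          (solve 4 (λ K s y T → con (ι 5000) :* T :* y := K :+ con (ι 100) :* (con (ι 2) :* (K :* (con (+ 49 / 100) :- s))
             :+ ((K :* (s :+ s) :+ con (ι 50) :* y :* T) :- K :* con (+ 99 / 100)))) ≈-refl ⌜ ι K ⌝ s (z ⊛ z) ⌜ ι T ⌝)
          where
          open Vincze–LeCam
          gap = (⌜ ι K ⌝ ⊛ (s ⊕ s) ⊕ ⌜ ι 50 ⌝ ⊛ (z ⊛ z) ⊛ ⌜ ι T ⌝) ⊝ ⌜ ι K ⌝ ⊛ ⌜ + 99 / 100 ⌝
          bound′ : ⌜ ι K ⌝ ⊛ ⌜ + 99 / 100 ⌝ ≼ ⌜ ι K ⌝ ⊛ (s ⊕ s) ⊕ ⌜ ι 50 ⌝ ⊛ (z ⊛ z) ⊛ ⌜ ι T ⌝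
          bound′ = ≼-respˡ (⊛-cong ≈-refl φ-0) (average-bound 0<p p≼½ Exp-lo potential T μ)

        K⊛≼ : ∀ {b} X → ⌜ 0ℚ ⌝ ≼ X → z ⊛ z ⊛ X ≼ b → ⌜ ι K ⌝ ⊛ X ≼ KT ⊛ b
        K⊛≼ {b} X 0≼X h = begin
          ⌜ ι K ⌝ ⊛ X         ≤⟨ ⊛-monoʳ X 0≼X K≼KTz² ⟩
          KT ⊛ (z ⊛ z) ⊛ X    ≈⟨ solve 3 (λ a b c → a :* b :* c := a :* (b :* c)) ≈-refl KT (z ⊛ z) X ⟩
          KT ⊛ (z ⊛ z ⊛ X)    ≤⟨ ⊛-monoˡ KT 0≼KT h ⟩
          KT ⊛ b              ∎

        KU : ⌜ ι K ⌝ ⊛ U ≼ KT ⊛ ⌜ ι 8 ⌝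
        KU = K⊛≼ U 0≼U (begin
          z ⊛ z ⊛ U                                   ≈⟨ solve 2 (λ z U → z :* U := con (ι 8) :* (con (+ 1 / 8) :* z :* U)) ≈-refl (z ⊛ z) U ⟩
          ⌜ ι 8 ⌝ ⊛ (⌜ + 1 / 8 ⌝ ⊛ (z ⊛ z) ⊛ U)       ≤⟨ ⊛-monoˡ ⌜ ι 8 ⌝ (⌜⌝-mono (0≤ι 8)) (⊛-monoʳ U 0≼U z²/8≼G) ⟩
          ⌜ ι 8 ⌝ ⊛ (G ⊛ U)                         ≈⟨ ⊛-cong ≈-refl (Inv-inverseʳ G 0<G) ⟩
          ⌜ ι 8 ⌝ ⊛ ⌜ 1ℚ ⌝                            ≈⟨ solve 0 (con (ι 8) :* con 1ℚ := con (ι 8)) ≈-refl ⟩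
          ⌜ ι 8 ⌝                                     ∎)

        DV : D ⊛ V ≈ ⌜ 1ℚ ⌝
        DV = Inv-inverseʳ D 0<D

        KV : ⌜ ι K ⌝ ⊛ V ≼ KT ⊛ ⌜ 1ℚ ⌝
        KV = K⊛≼ V 0≼V (≼-respʳ DV (⊛-monoʳ V 0≼V z²≼D))

        -- The minimax bound gives ¼ e^(-Y) ≤ δ, so e^(w - Y) ≤ 4 δ eʷ = 4 = 1 + 3, where w is log
        -- (1/δ).
        w≼Y+3 : w ≼ Y ⊕ ⌜ ι 3 ⌝
        w≼Y+3 = begin
          w                      ≈⟨ solve 2 (λ w Y → w := Y :+ (w :- Y)) ≈-refl w Y ⟩
          Y ⊕ (w ⊝ Y)            ≤⟨ ⊕-mono ≼-refl (Exp≼⇒≼ (begin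
            Exp (w ⊝ Y)                                    ≈⟨ Exp-⊕ w (⊖ Y) ⟩
            Exp w ⊛ Exp (⊖ Y)                              ≈⟨ solve 2 (λ a b → a :* b := con (ι 4) :* (a :* (con (+ 1 / 4) :* b))) ≈-refl (Exp w) (Exp (⊖ Y)) ⟩
            ⌜ ι 4 ⌝ ⊛ (Exp w ⊛ (⌜ + 1 / 4 ⌝ ⊛ Exp (⊖ Y)))  ≤⟨ ⊛-monoˡ ⌜ ι 4 ⌝ (⌜⌝-mono (0≤ι 4)) (⊛-monoˡ (Exp w) (0≼Exp w) (≼-trans error-bound s≼δ)) ⟩
            ⌜ ι 4 ⌝ ⊛ (Exp w ⊛ δ)                          ≈⟨ ⊛-cong ≈-refl Exp-w ⟩
            ⌜ ι 4 ⌝ ⊛ ⌜ 1ℚ ⌝                               ≈⟨ solve 0 (con (ι 4) :* con 1ℚ := con 1ℚ :+ con (ι 3)) ≈-refl ⟩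
            ⌜ 1ℚ ⌝ ⊕ ⌜ ι 3 ⌝                               ∎)) ⟩
          Y ⊕ ⌜ ι 3 ⌝            ∎

        -- The main part of w contributes K Y / D = T. The additive 3 contributes 3 K / D, which
        -- would spoil the bound on its own and is absorbed by K ≤ 5000 T z² together with z² ≤ D.
        KwV : ⌜ ι K ⌝ ⊛ w ⊛ V ≼ ⌜ ι T ⌝ ⊕ ⌜ ι 3 ⌝ ⊛ KT
        KwV = begin
          ⌜ ι K ⌝ ⊛ w ⊛ V                              ≤⟨ ⊛-monoʳ V 0≼V (⊛-monoˡ ⌜ ι K ⌝ 0≼K w≼Y+3) ⟩
          ⌜ ι K ⌝ ⊛ (Y ⊕ ⌜ ι 3 ⌝) ⊛ V                  ≈⟨ solve 5 (λ K T D κ V → K :* (T :* D :* κ :+ con (ι 3)) :* V := T :* (D :* V) :* (K :* κ) :+ con (ι 3) :* (K :* V)) ≈-refl ⌜ ι K ⌝ ⌜ ι T ⌝ D κ V ⟩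
          ⌜ ι T ⌝ ⊛ (D ⊛ V) ⊛ (⌜ ι K ⌝ ⊛ κ) ⊕ ⌜ ι 3 ⌝ ⊛ (⌜ ι K ⌝ ⊛ V) ≤⟨ ⊕-mono (≈⇒≼ (⊛-cong (⊛-cong ≈-refl DV) Kκ)) (⊛-monoˡ ⌜ ι 3 ⌝ (⌜⌝-mono (0≤ι 3)) KV) ⟩
          ⌜ ι T ⌝ ⊛ ⌜ 1ℚ ⌝ ⊛ ⌜ 1ℚ ⌝ ⊕ ⌜ ι 3 ⌝ ⊛ (KT ⊛ ⌜ 1ℚ ⌝) ≈⟨ solve 2 (λ T k → T :* con 1ℚ :* con 1ℚ :+ con (ι 3) :* (k :* con 1ℚ) := T :+ con (ι 3) :* k) ≈-refl ⌜ ι T ⌝ KT ⟩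
          ⌜ ι T ⌝ ⊕ ⌜ ι 3 ⌝ ⊛ KT                       ∎

        -- The sum in brackets is at most (8 · 5000 + 1 + 3 · 5000) T = 55001 T.
        c : ℚ
        c = + 1 / 55001

        bound-⊛ : ⌜ c ⌝ ⊛ (⌜ ι K ⌝ ⊛ U ⊕ ⌜ ι K ⌝ ⊛ w ⊛ V) ≼ ⌜ ι T ⌝
        bound-⊛ = begin
          ⌜ c ⌝ ⊛ (⌜ ι K ⌝ ⊛ U ⊕ ⌜ ι K ⌝ ⊛ w ⊛ V)          ≤⟨ ⊛-monoˡ ⌜ c ⌝ (⌜⌝-mono (ℚ.nonNegative⁻¹ c)) (⊕-mono KU KwV) ⟩
          ⌜ c ⌝ ⊛ (KT ⊛ ⌜ ι 8 ⌝ ⊕ (⌜ ι T ⌝ ⊕ ⌜ ι 3 ⌝ ⊛ KT)) ≈⟨ solve 1 (λ T → con (+ 1 / 55001) :* (con (ι 5000) :* T :* con (ι 8) :+ (T :+ con (ι 3) :* (con (ι 5000) :* T))) := T) ≈-refl ⌜ ι T ⌝ ⟩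
          ⌜ ι T ⌝                                          ∎

      query-bound : ∀ w′ → w ≈ w′ →
        fromℚ (+ 1 / 55001) * (fromℕ K / G ⟨ 0<G ⟩ + (fromℕ K * w′) / D ⟨ 0<D ⟩) ≤ fromℕ T
      query-bound w′ w≈ = ≼⇒≤ {fromℚ (+ 1 / 55001) * (fromℕ K / G ⟨ 0<G ⟩ + (fromℕ K * w′) / D ⟨ 0<D ⟩)} {fromℕ T}
        (≼-respˡ (*≈ (fromℚ (+ 1 / 55001)) (fromℕ K / G ⟨ 0<G ⟩ + (fromℕ K * w′) / D ⟨ 0<D ⟩) (⌜⌝≈fromℚ (+ 1 / 55001))
            (+≈ (fromℕ K / G ⟨ 0<G ⟩) ((fromℕ K * w′) / D ⟨ 0<D ⟩) (/≈ (fromℕ K) G 0<G (⌜⌝≈fromℚ (ι K)))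
              (/≈ (fromℕ K * w′) D 0<D (*≈ (fromℕ K) w′ (⌜⌝≈fromℚ (ι K)) w≈))))
          (≼-respʳ (⌜⌝≈fromℚ (ι T)) bound-⊛))

-- Specialisation to the entropy, the divergence and log (1/δ)

module _ (p : ℝ) (0<p : 0ℝ < p) (p<½ : p < ½ℝ) where

  private
    lo : ℝ
    lo = Log (odds p 0<p) (0<odds p 0<p p<½)

    p≼½ : p ≼ ⌜ ½ ⌝
    p≼½ = ≼-respʳ (≈-sym (⌜⌝≈fromℚ ½)) (<⇒≼ {p} {½ℝ} p<½)

    1-p≈ : ⌜ 1ℚ ⌝ ⊝ p ≈ 1ℝ - p
    1-p≈ = -≈ 1ℝ p (⌜⌝≈fromℚ 1ℚ) ≈-refl

    1-2p≈ : ⌜ 1ℚ ⌝ ⊝ ⌜ ι 2 ⌝ ⊛ p ≈ 1ℝ - 2ℝ * p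
    1-2p≈ = -≈ 1ℝ (2ℝ * p) (⌜⌝≈fromℚ 1ℚ) (*≈ 2ℝ p (⌜⌝≈fromℚ (ι 2)) ≈-refl)

    Exp-lo : Exp lo ⊛ p ≈ ⌜ 1ℚ ⌝ ⊝ p
    Exp-lo = ≈-trans (Exp-quotient (1ℝ - p) p 0<p (0<odds p 0<p p<½)) (≈-sym 1-p≈)

    open Channel {p} {lo} 0<p p≼½ Exp-lo

    D≈ : z ⊛ lo ≈ D-KL p 0<p p<½
    D≈ = *≈ (1ℝ - 2ℝ * p) (log (odds p 0<p) (0<odds p 0<p p<½)) 1-2p≈ (Log≈log (odds p 0<p) (0<odds p 0<p p<½))

    0≼lo : ⌜ 0ℚ ⌝ ≼ lo
    0≼lo = ≼-respʳ (≈-sym (Log≈log (odds p 0<p) (0<odds p 0<p p<½)))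
      (0<⇒0≼ {log (odds p 0<p) (0<odds p 0<p p<½)} (0<log {odds p 0<p} (0<odds p 0<p p<½) (1<odds p 0<p p<½)))

    z²≼D : z ⊛ z ≼ D-KL p 0<p p<½
    z²≼D = ≼-respʳ D≈ (z²≼z⊛lo 0≼lo)

    z²/8≼1-H : ⌜ + 1 / 8 ⌝ ⊛ (z ⊛ z) ≼ 1ℝ - H p 0<p p<½
    z²/8≼1-H = ≼-respʳ H≈ (entropy-bound p≼½ (Exp-Log p 0<p) (≈-trans (Exp-Log (1ℝ - p) (0<1-p {p} p<½)) (≈-sym 1-p≈))
      (≈-trans (Exp-Log 2ℝ 0<2) (≈-sym (⌜⌝≈fromℚ (ι 2))))
      (≈-trans (⊛-cong (Log≈log 2ℝ 0<2) ≈-refl) (Inv-inverseʳ (log 2ℝ 0<2) 0<log2)) (Inv-nonneg (log 2ℝ 0<2) 0<log2))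
      where
      u = Inv (log 2ℝ 0<2) 0<log2
      log₂≈ : ∀ x 0<x → Log x 0<x ⊛ u ≈ log₂ x 0<x
      log₂≈ x 0<x = /≈ (log x 0<x) (log 2ℝ 0<2) 0<log2 (Log≈log x 0<x)
      H≈ : ⌜ 1ℚ ⌝ ⊝ (⊖ (p ⊛ (Log p 0<p ⊛ u)) ⊝ (⌜ 1ℚ ⌝ ⊝ p) ⊛ (Log (1ℝ - p) (0<1-p {p} p<½) ⊛ u)) ≈ 1ℝ - H p 0<p p<½
      H≈ = -≈ 1ℝ (H p 0<p p<½) (⌜⌝≈fromℚ 1ℚ)
        (-≈ (- (p * log₂ p 0<p)) ((1ℝ - p) * log₂ (1ℝ - p) (0<1-p {p} p<½))
          (≈-trans (⊖-cong (*≈ p (log₂ p 0<p) ≈-refl (log₂≈ p 0<p))) (⊖≈- (p * log₂ p 0<p)))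
          (*≈ (1ℝ - p) (log₂ (1ℝ - p) (0<1-p {p} p<½)) 1-p≈ (log₂≈ (1ℝ - p) (0<1-p {p} p<½))))

  -- Dividing by 1 - H takes a positive rational lower bound as witness; the quantitative estimate
  -- (1 - 2p)² / 8 ≤ 1 - H provides it.
  0<1-H : 0ℝ < 1ℝ - H p 0<p p<½
  0<1-H = 0<-≼-trans {fromℚ (+ 1 / 8) * ((1ℝ - 2ℝ * p) * (1ℝ - 2ℝ * p))} {1ℝ - H p 0<p p<½}
    (0<*ℝ {fromℚ (+ 1 / 8)} {(1ℝ - 2ℝ * p) * (1ℝ - 2ℝ * p)} (0<fromℚ {+ 1 / 8} (ℚ.positive⁻¹ (+ 1 / 8)))
      (0<*ℝ {1ℝ - 2ℝ * p} {1ℝ - 2ℝ * p} (0<1-2p {p} p<½) (0<1-2p {p} p<½)))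
    (≼-respˡ (*≈ (fromℚ (+ 1 / 8)) ((1ℝ - 2ℝ * p) * (1ℝ - 2ℝ * p)) (⌜⌝≈fromℚ (+ 1 / 8)) (*≈ (1ℝ - 2ℝ * p) (1ℝ - 2ℝ * p) 1-2p≈ 1-2p≈))
      z²/8≼1-H)

  module _ (K T : ℕ) .{{_ : NonZero K}} (μ : Algorithm K T) where

    minimax-bound : fromℚ (+ 1 / 4) * exp (- ((fromℕ T * D-KL p 0<p p<½) / fromℕ K ⟨ 0<fromℕ K ⟩)) ≤ supBits (errorProb T p μ)
    minimax-bound = minimax 0<p p≼½ Exp-lo (D-KL p 0<p p<½) D≈ K T μ

    sample-complexity : ∀ δ (0<δ : 0ℝ < δ) → δ < fromℚ (+ 49 / 100) → supBits (errorProb T p μ) ≤ δ →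
      fromℚ (+ 1 / 55001) * (fromℕ K / (1ℝ - H p 0<p p<½) ⟨ 0<1-H ⟩
        + (fromℕ K * log (1ℝ / δ ⟨ 0<δ ⟩) (0<1/ δ 0<δ)) / D-KL p 0<p p<½ ⟨ 0<D-KL p 0<p p<½ ⟩) ≤ fromℕ T
    sample-complexity δ 0<δ δ<49/100 s≤δ = query-bound 0<p p≼½ Exp-lo (D-KL p 0<p p<½) D≈ K T μ
      (1ℝ - H p 0<p p<½) 0<1-H z²/8≼1-H (0<D-KL p 0<p p<½) z²≼D δ (Log (1ℝ / δ ⟨ 0<δ ⟩) (0<1/ δ 0<δ)) δ<49/100
      (≈-trans (Exp-quotient 1ℝ δ 0<δ (0<1/ δ 0<δ)) (≈-sym (⌜⌝≈fromℚ 1ℚ))) s≤δ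
      (log (1ℝ / δ ⟨ 0<δ ⟩) (0<1/ δ 0<δ)) (Log≈log (1ℝ / δ ⟨ 0<δ ⟩) (0<1/ δ 0<δ))

mainTheorem1 : (∀ (K T : ℕ) .{{_ : NonZero K}} (p : ℝ) (0<p : 0ℝ < p) (p<½ : p < ½ℝ) (μ : Algorithm K T) →
    fromℚ (+ 1 / 4) * exp (- ((fromℕ T * D-KL p 0<p p<½) / fromℕ K ⟨ 0<fromℕ K ⟩))
    ≤ supBits (errorProb T p μ))
    × (Σ[ 0<1-H ∈ (∀ (p : ℝ) (0<p : 0ℝ < p) (p<½ : p < ½ℝ) → 0ℝ < 1ℝ - H p 0<p p<½) ]
    ∃[ c ] (0ℝ < c ×
    (∀ (K T : ℕ) .{{_ : NonZero K}} (p : ℝ) (0<p : 0ℝ < p) (p<½ : p < ½ℝ)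
    (δ : ℝ) (0<δ : 0ℝ < δ) → δ < fromℚ (+ 49 / 100) → (μ : Algorithm K T) →
    supBits (errorProb T p μ) ≤ δ →
    c * (fromℕ K / (1ℝ - H p 0<p p<½) ⟨ 0<1-H p 0<p p<½ ⟩
    + (fromℕ K * log (1ℝ / δ ⟨ 0<δ ⟩) (0<1/ δ 0<δ)) / D-KL p 0<p p<½ ⟨ 0<D-KL p 0<p p<½ ⟩)
    ≤ fromℕ T)))
mainTheorem1 =
  (λ K T p 0<p p<½ μ → minimax-bound p 0<p p<½ K T μ) ,
  0<1-H ,
  fromℚ (+ 1 / 55001) ,
  0<fromℚ {+ 1 / 55001} (ℚ.positive⁻¹ (+ 1 / 55001)) ,
  λ K T p 0<p p<½ δ 0<δ δ<49/100 μ s≤δ → sample-complexity p 0<p p<½ K T μ δ 0<δ δ<49/100 s≤δ
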